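{- For every nonnegative integer $n$ there exist nonnegative integers $x,y,z,w$ such that $$n=p_5(x)+p_5(y)+p_5(z)+2p_5(w),$$ where $p_5(m)=m(3m-1)/2$. Equivalently, every nonnegative integer is a sum of five pentagonal numbers two of which are equal.
   Context: The pentagonal numbers are $p_5(m)=m(3m-1)/2$ for $m\in\{0,1,2,\ldots\}$. -}

module Defs where

open import Data.Nat using (ℕ; _*_; _∸_)
open import Data.Nat.DivMod using (_/_)

-- pentagonal numbers p₅(m) = m(3m-1)/2 ; m(3m-1) is always even so the
-- division is exact (for m = 0, 3m ∸ 1 = 0 and p₅ 0 = 0).
p₅ : ℕ → ℕ
p₅ m = (m * (3 * m ∸ 1)) / 2

{-# OPTIONS --safe #-}
-- With a = x²+y²+z²+2w² and b = x+y+z+2w the sum in question is (3a - b)/2, so n and b determine a. Putting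
-- X = x - w, Y = y - w, Z = z - w one has 5a - b² = 2G with G = 2(X²+Y²+Z²) - XY - YZ - ZX; conversely a solution
-- of 2G = 5a - b² gives x, y, z, w, and they are nonnegative as soon as b² is large compared with 4a (Cauchy). For
-- large n some b in this range makes m = (5a - b²)/2 congruent to 3 modulo 4 and to ±2 modulo 5.
--
-- G represents every such m. One may take m squarefree. If A > 0 is such that -m is a square modulo 4A and -5A is a
-- square modulo m, then m is represented by a ternary form of discriminant 25 whose 2×2 minors are divisible by 5,
-- and reduction shows that G is the only such form. So an A is needed whose primes split in ℚ(√-m) and whose
-- Legendre symbols at the primes p of m are those of -5; by quadratic reciprocity their product is 1, as it must be.
-- Sum ∏ₚ((b/p) + (-5/p)(a/p)) over ab ≤ X². Expanded, all terms but two are sums of products of two nonprincipal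
-- characters and are O(X) by the hyperbola method; the other two count ideals of norm at most X², and exceed any
-- multiple of X because the values of u² + mv² are among these norms. Hence some n = ab contributes, and A is its
-- squarefree part.
module Submission where

open import Data.Empty using (⊥; ⊥-elim)
open import Data.Product using (Σ; ∃-syntax; _×_; _,_; proj₁; proj₂)
open import Data.Sum using (_⊎_; inj₁; inj₂)
open import Data.Unit using (tt)
open import Relation.Binary.PropositionalEquality
open import Relation.Nullary using (¬_; Dec; yes; no; ¬?; _⊎-dec_; _×-dec_)
open import Relation.Nullary.Decidable using (toWitness; from-yes; from-no)

-- The classical route takes A prime by Dirichlet's theorem on primes in progressions. A product of
-- split primes does as well, and to find one it suffices that a single n has the prescribed symbols
-- and is the norm of an ideal, which is the nonvanishing of a finite sum. Even L(1, (-m/·)) ≠ 0 is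
-- sidestepped: it would give a main term of order X², but V² choices of u and V choices of v, with
-- V of order √X, already give V³ distinct norms u² + mv², and the error is only O(X).
--
-- The congruences on m make the sign product 1: m ≡ 3 modulo 4 gives (-1/m) = -1 and (ℓ/m) =
-- (-m/ℓ), and m ≡ ±2 modulo 5 then gives (5/m) = -1, so (-5/m) = 1. The latter also gives m² ≡ -1
-- modulo 5, so divisibility of a minor by 5 can be tested after multiplication by m².
--
-- Nonnegativity asks for b² above about 8n/3 and m > 0 for b² below about 10n/3. The admissible b
-- thus fill an interval of length proportional to √n, which leaves room for congruences on b once n
-- is large; the remaining n are settled by computation.

-- Finite sums and products over a commutative monoid

module Folds where

  open import Algebra.Structures using (IsCommutativeMonoid)
  open import Data.Nat
  open import Data.Nat.Properties
  open import Data.Fin using (Fin; toℕ; fromℕ<)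
  open import Data.Fin.Properties using (pigeonhole; toℕ<n; fromℕ<-injective)
  open import Relation.Unary using (Decidable)

  <1+⇒<∨≡ : ∀ {i n} → i < suc n → i < n ⊎ i ≡ n
  <1+⇒<∨≡ p = m≤n⇒m<n∨m≡n (≤-pred p)

  search : ∀ {P : ℕ → Set} → Decidable P → ∀ n → (∃[ i ] i < n × P i) ⊎ (∀ i → i < n → ¬ P i)
  search P? zero = inj₂ λ i ()
  search P? (suc n) with P? n
  ... | yes p = inj₁ (n , ≤-refl , p)
  ... | no ¬p with search P? n
  ... | inj₁ (i , i<n , p) = inj₁ (i , m<n⇒m<1+n i<n , p)
  ... | inj₂ none = inj₂ λ i i<1+n → case i (<1+⇒<∨≡ i<1+n)
    where
    case : ∀ i → i < n ⊎ i ≡ n → ¬ _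
    case i (inj₁ i<n) = none i i<n
    case i (inj₂ refl) = ¬p

  no-injection : ∀ n (f : ℕ → ℕ) → (∀ i → i < suc n → f i < n) → (∀ i j → i < suc n → j < suc n → f i ≡ f j → i ≡ j) → ⊥
  no-injection n f f< inj with pigeonhole ≤-refl (λ (i : Fin (suc n)) → fromℕ< (f< (toℕ i) (toℕ<n i)))
  ... | i , j , i<j , eq = <-irrefl (inj (toℕ i) (toℕ j) (toℕ<n i) (toℕ<n j) (fromℕ<-injective _ _ _ _ eq)) i<j

  module BigOp {A : Set} {_∙_ : A → A → A} {ε : A} (M : IsCommutativeMonoid _≡_ _∙_ ε) where
    open IsCommutativeMonoid M using (assoc; comm; identityˡ; identityʳ)

    fold : ℕ → (ℕ → A) → A
    fold zero f = ε
    fold (suc n) f = fold n f ∙ f n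

    fold-cong : ∀ n {f g : ℕ → A} → (∀ i → i < n → f i ≡ g i) → fold n f ≡ fold n g
    fold-cong zero h = refl
    fold-cong (suc n) h = cong₂ _∙_ (fold-cong n (λ i p → h i (m<n⇒m<1+n p))) (h n ≤-refl)

    fold-ε : ∀ n → fold n (λ _ → ε) ≡ ε
    fold-ε zero = refl
    fold-ε (suc n) = trans (identityʳ _) (fold-ε n)

    interchange : ∀ a b c d → (a ∙ b) ∙ (c ∙ d) ≡ (a ∙ c) ∙ (b ∙ d)
    interchange a b c d = trans (assoc a b (c ∙ d)) (trans (cong (a ∙_)
      (trans (sym (assoc b c d)) (trans (cong (_∙ d) (comm b c)) (assoc c b d)))) (sym (assoc a c (b ∙ d))))

    fold-merge : ∀ n (f g : ℕ → A) → fold n (λ i → f i ∙ g i) ≡ fold n f ∙ fold n g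
    fold-merge zero f g = sym (identityʳ ε)
    fold-merge (suc n) f g = trans (cong (_∙ (f n ∙ g n)) (fold-merge n f g)) (interchange _ _ _ _)

    fold-swap : ∀ n k (f : ℕ → ℕ → A) → fold n (λ i → fold k (f i)) ≡ fold k (λ j → fold n (λ i → f i j))
    fold-swap zero k f = sym (fold-ε k)
    fold-swap (suc n) k f = trans (cong (_∙ fold k (f n)) (fold-swap n k f)) (sym (fold-merge k _ _))

    fold-+ : ∀ n k (f : ℕ → A) → fold (n + k) f ≡ fold n f ∙ fold k (λ i → f (n + i))
    fold-+ n zero f rewrite +-identityʳ n = sym (identityʳ _)
    fold-+ n (suc k) f rewrite +-suc n k = trans (cong (_∙ f (n + k)) (fold-+ n k f)) (assoc _ _ _)

    fold-single : ∀ n i₀ (f : ℕ → A) → i₀ < n → (∀ i → i < n → i ≢ i₀ → f i ≡ ε) → fold n f ≡ f i₀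
    fold-single (suc n) i₀ f p h with <1+⇒<∨≡ p
    ... | inj₂ refl = trans (cong (_∙ f n) (trans (fold-cong n (λ i q → h i (m<n⇒m<1+n q) (<⇒≢ q))) (fold-ε n))) (identityˡ _)
    ... | inj₁ q = trans (cong₂ _∙_ (fold-single n i₀ f q (λ i r → h i (m<n⇒m<1+n r))) (h n ≤-refl (≢-sym (<⇒≢ q)))) (identityʳ _)

    -- Replacing one entry, in a form without division: the monoid has no inverses, so the old and
    -- the new entry appear on opposite sides.
    fold-exchange : ∀ n i₀ (f g : ℕ → A) → i₀ < n → (∀ i → i < n → i ≢ i₀ → f i ≡ g i) → fold n f ∙ g i₀ ≡ fold n g ∙ f i₀
    fold-exchange (suc n) i₀ f g p h with <1+⇒<∨≡ p
    ... | inj₂ refl = trans (assoc _ _ _) (trans (cong₂ _∙_ (fold-cong n (λ i q → h i (m<n⇒m<1+n q) (<⇒≢ q))) (comm _ _)) (sym (assoc _ _ _)))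
    ... | inj₁ q = trans (assoc _ _ _) (trans (cong (fold n f ∙_) (comm _ _)) (trans (sym (assoc _ _ _))
        (trans (cong₂ _∙_ (fold-exchange n i₀ f g q (λ i r → h i (m<n⇒m<1+n r))) (h n ≤-refl (≢-sym (<⇒≢ q))))
        (trans (assoc _ _ _) (trans (cong (fold n g ∙_) (comm _ _)) (sym (assoc _ _ _)))))))

    -- Induction on `n`. By the pigeonhole principle some `i₀` is sent to the last index. The map
    -- `f′` sends `i₀` to `f n` instead and so permutes the indices below `n`; `fold-exchange`
    -- accounts for the changed entry.
    fold-perm : ∀ n (f : ℕ → ℕ) (g : ℕ → A) → (∀ i → i < n → f i < n) → (∀ i j → i < n → j < n → f i ≡ f j → i ≡ j) →
                fold n (λ i → g (f i)) ≡ fold n g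
    fold-perm zero f g f< inj = refl
    fold-perm (suc n) f g f< inj with search (λ i → f i ≟ n) (suc n)
    ... | inj₂ none = ⊥-elim (no-injection n f (λ i p → ≤∧≢⇒< (≤-pred (f< i p)) (none i p)) inj)
    ... | inj₁ (i₀ , i₀< , fi₀≡n) with <1+⇒<∨≡ i₀<
    ... | inj₂ refl = cong₂ _∙_ (fold-perm n f g (λ i p → ≤∧≢⇒< (≤-pred (f< i (m<n⇒m<1+n p)))
                                    (λ e → <⇒≢ p (inj i n (m<n⇒m<1+n p) ≤-refl (trans e (sym fi₀≡n)))))
                                  (λ i j p q → inj i j (m<n⇒m<1+n p) (m<n⇒m<1+n q))) (cong g fi₀≡n)
    ... | inj₁ i₀<n = trans (cong (fold n (λ i → g (f i)) ∙_) (cong g (sym f′i₀)))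
          (trans (fold-exchange n i₀ (λ i → g (f i)) (λ i → g (f′ i)) i₀<n (λ i p ne → cong g (sym (f′≡f i p ne))))
          (cong₂ _∙_ (fold-perm n f′ g f′< f′-inj) (cong g fi₀≡n)))
      where
      fn≢n : f n ≢ n
      fn≢n e = <⇒≢ i₀<n (inj i₀ n i₀< ≤-refl (trans fi₀≡n (sym e)))
      f′ : ℕ → ℕ
      f′ i with f i ≟ n
      ... | yes _ = f n
      ... | no _ = f i
      f′i₀ : f′ i₀ ≡ f n
      f′i₀ with f i₀ ≟ n
      ... | yes _ = refl
      ... | no ne = ⊥-elim (ne fi₀≡n)
      f′≡f : ∀ i → i < n → i ≢ i₀ → f′ i ≡ f i
      f′≡f i p ne with f i ≟ n
      ... | yes e = ⊥-elim (ne (inj i i₀ (m<n⇒m<1+n p) i₀< (trans e (sym fi₀≡n))))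
      ... | no _ = refl
      f′< : ∀ i → i < n → f′ i < n
      f′< i p with f i ≟ n
      ... | yes _ = ≤∧≢⇒< (≤-pred (f< n ≤-refl)) fn≢n
      ... | no ne = ≤∧≢⇒< (≤-pred (f< i (m<n⇒m<1+n p))) ne
      f′-inj : ∀ i j → i < n → j < n → f′ i ≡ f′ j → i ≡ j
      f′-inj i j p q e with f i ≟ n | f j ≟ n
      ... | yes a | yes b = inj i j (m<n⇒m<1+n p) (m<n⇒m<1+n q) (trans a (sym b))
      ... | yes a | no b = ⊥-elim (<⇒≢ q (sym (inj n j ≤-refl (m<n⇒m<1+n q) e)))
      ... | no a | yes b = ⊥-elim (<⇒≢ p (inj i n (m<n⇒m<1+n p) ≤-refl e))
      ... | no a | no b = inj i j (m<n⇒m<1+n p) (m<n⇒m<1+n q) e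

-- Reduction of ternary quadratic forms

module TernaryForms where

  open import Data.Nat as ℕ using (ℕ; zero; suc)
  import Data.Nat.Properties as ℕ
  open import Data.Integer hiding (suc)
  open import Data.Integer.Properties
  open import Data.Integer.DivMod using (_/ℕ_; _%ℕ_; a≡a%ℕn+[a/ℕn]*n; n%ℕd<d)
  open import Data.Integer.Tactic.RingSolver using (solve; solve-∀)
  open import Data.List using (List; []; _∷_; map; upTo)
  open import Data.List.Relation.Unary.All as All using (All; all?)
  open import Data.List.Relation.Unary.Any using (here; there)
  open import Data.List.Membership.Propositional using (_∈_)
  open import Data.List.Membership.Propositional.Properties using (∈-map⁺; ∈-upTo⁺)
  open import Data.Integer.Divisibility.Signed using (_∣_; divides; _∣?_)

  G : ℤ → ℤ → ℤ → ℤ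
  G x y z = + 2 * (x * x + y * y + z * z) - x * y - y * z - z * x

  tern : (a b c r s t : ℤ) → ℤ → ℤ → ℤ → ℤ
  tern a b c r s t x y z = a * x * x + b * y * y + c * z * z + r * y * z + s * x * z + t * x * y

  0≤+ : ∀ {x y} → 0ℤ ≤ x → 0ℤ ≤ y → 0ℤ ≤ x + y
  0≤+ p q = +-mono-≤ p q

  0≤* : ∀ {x y} → 0ℤ ≤ x → 0ℤ ≤ y → 0ℤ ≤ x * y
  0≤* {+ m} {+ n} _ _ = subst (0ℤ ≤_) (pos-* m n) (+≤+ ℕ.z≤n)

  0≤ℕ : ∀ {n} → 0ℤ ≤ + n
  0≤ℕ = +≤+ ℕ.z≤n

  0≤sq : ∀ x → 0ℤ ≤ x * x
  0≤sq (+ n) = 0≤* {+ n} {+ n} 0≤ℕ 0≤ℕ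
  0≤sq -[1+ n ] = +≤+ ℕ.z≤n

  -- The end of every inequality argument on forms: the hypotheses are written `0ℤ ≤ …`, combined by
  -- sums and products, and the ring solver identifies the total with a negative numeral.
  ¬0≤neg : ∀ {x n} → 0ℤ ≤ x → x ≡ -[1+ n ] → ⊥
  ¬0≤neg () refl

  -- Certificates for equations: the conclusion is exhibited as a polynomial combination of the
  -- hypotheses, and the ring solver only has to check one identity. The multipliers `k` are the
  -- content of each use.
  by₁ : ∀ {x y L R} k → L ≡ R → x - y ≡ k * (L - R) → x ≡ y
  by₁ {x} {y} {L} k refl e = i-j≡0⇒i≡j x y (trans e (trans (cong (k *_) (+-inverseʳ L)) (*-zeroʳ k)))

  by₂ : ∀ {x y L R L′ R′} k k′ → L ≡ R → L′ ≡ R′ → x - y ≡ k * (L - R) + k′ * (L′ - R′) → x ≡ y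
  by₂ {x} {y} {L} {L′ = L′} k k′ h refl e =
    by₁ k h (trans e (trans (cong (λ u → k * (L - _) + k′ * u) (+-inverseʳ L′)) (trans (cong (λ u → k * (L - _) + u) (*-zeroʳ k′)) (+-identityʳ _))))

  by₃ : ∀ {x y L R L′ R′ L″ R″} k k′ k″ → L ≡ R → L′ ≡ R′ → L″ ≡ R″ → x - y ≡ k * (L - R) + k′ * (L′ - R′) + k″ * (L″ - R″) → x ≡ y
  by₃ {x} {y} {L} {L′ = L′} {L″ = L″} k k′ k″ h h′ refl e =
    by₂ k k′ h h′ (trans e (trans (cong (λ u → k * (L - _) + k′ * (L′ - _) + k″ * u) (+-inverseʳ L″))
      (trans (cong (λ u → k * (L - _) + k′ * (L′ - _) + u) (*-zeroʳ k″)) (+-identityʳ _))))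

  +-cancelʳ : ∀ k x y → x + k ≡ y + k → x ≡ y
  +-cancelʳ k x y e = by₁ 1ℤ e (solve (k ∷ x ∷ y ∷ []))

  <⇒0≤ : ∀ {x y} → x < y → 0ℤ ≤ y - x - 1ℤ
  <⇒0≤ {x} {y} p = subst (0ℤ ≤_) (lem x y) (i≤j⇒0≤j-i (i<j⇒suc[i]≤j p))
    where lem : ∀ x y → y - (1ℤ + x) ≡ y - x - 1ℤ
          lem = solve-∀

  pos-dec : ∀ x → (0ℤ ≤ x - 1ℤ) ⊎ (0ℤ ≤ - x)
  pos-dec (+ zero) = inj₂ 0≤ℕ
  pos-dec (+ suc n) = inj₁ 0≤ℕ
  pos-dec -[1+ n ] = inj₂ 0≤ℕ

  cmp : ∀ x y → (0ℤ ≤ y - x) ⊎ (0ℤ ≤ x - y - 1ℤ)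
  cmp x y with x ≤? y
  ... | yes p = inj₁ (i≤j⇒0≤j-i p)
  ... | no p = inj₂ (<⇒0≤ (≰⇒> p))

  half : ∀ x → 0ℤ ≤ + 2 * x → 0ℤ ≤ x
  half (+ n) _ = 0≤ℕ

  -- Division with remainder to the nearest multiple: dividing `2x + g` by `2g` centres the
  -- remainder about 0.
  centre : ∀ x g → 0ℤ ≤ g - 1ℤ → ∃[ k ] 0ℤ ≤ g - + 2 * (x + k * g) × 0ℤ ≤ g + + 2 * (x + k * g)
  centre x (+ suc n) _ = - q , subst (0ℤ ≤_) (l1 x g q r eq) (i≤j⇒0≤j-i (<⇒≤ r<)) , subst (0ℤ ≤_) (l2 x g q r eq) 0≤ℕ
    where
    g = + suc n
    M = 2 ℕ.* suc n
    q = (+ 2 * x + g) /ℕ M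
    r = + ((+ 2 * x + g) %ℕ M)
    eq : + 2 * x + g ≡ r + q * (+ 2 * g)
    eq = a≡a%ℕn+[a/ℕn]*n (+ 2 * x + g) M
    r< : r < + 2 * g
    r< = +<+ (n%ℕd<d (+ 2 * x + g) M)
    l1 : ∀ x g q r → + 2 * x + g ≡ r + q * (+ 2 * g) → + 2 * g - r ≡ g - + 2 * (x + - q * g)
    l1 x g q r e = by₁ 1ℤ e (solve (x ∷ g ∷ q ∷ r ∷ []))
    l2 : ∀ x g q r → + 2 * x + g ≡ r + q * (+ 2 * g) → r ≡ g + + 2 * (x + - q * g)
    l2 x g q r e = by₁ -1ℤ e (solve (x ∷ g ∷ q ∷ r ∷ []))
  centre x +0 p = ⊥-elim (¬0≤neg p refl)
  centre x -[1+ n ] p = ⊥-elim (¬0≤neg p refl)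

  -- Ternary forms ax²+by²+cz²+ryz+sxz+txy of discriminant 25 all of whose 2×2 minors are multiples of 5,
  -- together with a vector of value m.
  record Form (m : ℤ) : Set where
    field
      a b c r s t α β γ ρ ς τ : ℤ
      eα : + 4 * b * c - r * r ≡ + 5 * α
      eβ : + 4 * a * c - s * s ≡ + 5 * β
      eγ : + 4 * a * b - t * t ≡ + 5 * γ
      eρ : + 2 * a * r - s * t ≡ + 5 * ρ
      eς : + 2 * b * s - r * t ≡ + 5 * ς
      eτ : + 2 * c * t - r * s ≡ + 5 * τ
      disc : + 4 * a * b * c + r * s * t - a * r * r - b * s * s - c * t * t ≡ + 25
      x y z : ℤ
      val : tern a b c r s t x y z ≡ m

  module _ {m : ℤ} where
    open Form

    swap₁₂ : Form m → Form m
    swap₁₂ F = record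
      { a = F .b ; b = F .a ; c = F .c ; r = F .s ; s = F .r ; t = F .t
      ; α = F .β ; β = F .α ; γ = F .γ ; ρ = F .ς ; ς = F .ρ ; τ = F .τ
      ; eα = F .eβ ; eβ = F .eα
      ; eγ = trans (l1 (F .a) (F .b) (F .t)) (F .eγ) ; eρ = F .eς ; eς = F .eρ
      ; eτ = trans (l2 (F .c) (F .t) (F .r) (F .s)) (F .eτ)
      ; disc = trans (l3 (F .a) (F .b) (F .c) (F .r) (F .s) (F .t)) (F .disc)
      ; x = F .y ; y = F .x ; z = F .z
      ; val = trans (l4 (F .a) (F .b) (F .c) (F .r) (F .s) (F .t) (F .x) (F .y) (F .z)) (F .val) }
      where
      l1 : ∀ a b t → + 4 * b * a - t * t ≡ + 4 * a * b - t * t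
      l1 = solve-∀
      l2 : ∀ c t r s → + 2 * c * t - s * r ≡ + 2 * c * t - r * s
      l2 = solve-∀
      l3 : ∀ a b c r s t → + 4 * b * a * c + s * r * t - b * s * s - a * r * r - c * t * t ≡ + 4 * a * b * c + r * s * t - a * r * r - b * s * s - c * t * t
      l3 = solve-∀
      l4 : ∀ a b c r s t x y z → b * y * y + a * x * x + c * z * z + s * x * z + r * y * z + t * y * x ≡ a * x * x + b * y * y + c * z * z + r * y * z + s * x * z + t * x * y
      l4 = solve-∀

    swap₂₃ : Form m → Form m
    swap₂₃ F = record
      { a = F .a ; b = F .c ; c = F .b ; r = F .r ; s = F .t ; t = F .s
      ; α = F .α ; β = F .γ ; γ = F .β ; ρ = F .ρ ; ς = F .τ ; τ = F .ς
      ; eα = trans (l1 (F .b) (F .c) (F .r)) (F .eα) ; eβ = F .eγ ; eγ = F .eβ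
      ; eρ = trans (l2 (F .a) (F .r) (F .s) (F .t)) (F .eρ) ; eς = F .eτ ; eτ = F .eς
      ; disc = trans (l3 (F .a) (F .b) (F .c) (F .r) (F .s) (F .t)) (F .disc)
      ; x = F .x ; y = F .z ; z = F .y
      ; val = trans (l4 (F .a) (F .b) (F .c) (F .r) (F .s) (F .t) (F .x) (F .y) (F .z)) (F .val) }
      where
      l1 : ∀ b c r → + 4 * c * b - r * r ≡ + 4 * b * c - r * r
      l1 = solve-∀
      l2 : ∀ a r s t → + 2 * a * r - t * s ≡ + 2 * a * r - s * t
      l2 = solve-∀
      l3 : ∀ a b c r s t → + 4 * a * c * b + r * t * s - a * r * r - c * t * t - b * s * s ≡ + 4 * a * b * c + r * s * t - a * r * r - b * s * s - c * t * t
      l3 = solve-∀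
      l4 : ∀ a b c r s t x y z → a * x * x + c * z * z + b * y * y + r * z * y + t * x * y + s * x * z ≡ a * x * x + b * y * y + c * z * z + r * y * z + s * x * z + t * x * y
      l4 = solve-∀

    -- e₂ ↦ e₂ + k e₁
    shear₁₂ : ℤ → Form m → Form m
    shear₁₂ k F = record
      { a = F .a ; b = F .b + k * F .t + k * k * F .a ; c = F .c
      ; r = F .r + k * F .s ; s = F .s ; t = F .t + + 2 * F .a * k
      ; α = F .α + + 2 * k * F .τ + k * k * F .β ; β = F .β ; γ = F .γ
      ; ρ = F .ρ ; ς = F .ς - k * F .ρ ; τ = F .τ + k * F .β
      ; eα = trans (l1 (F .a) (F .b) (F .c) (F .r) (F .s) (F .t) k)
               (trans (cong₂ (λ u v → u + + 2 * k * v + k * k * (+ 4 * F .a * F .c - F .s * F .s)) (F .eα) (F .eτ))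
                 (trans (cong (λ u → + 5 * F .α + + 2 * k * (+ 5 * F .τ) + k * k * u) (F .eβ)) (l1′ (F .α) (F .β) (F .τ) k)))
      ; eβ = F .eβ
      ; eγ = trans (l2 (F .a) (F .b) (F .t) k) (F .eγ)
      ; eρ = trans (l3 (F .a) (F .r) (F .s) (F .t) k) (F .eρ)
      ; eς = trans (l4 (F .a) (F .b) (F .r) (F .s) (F .t) k)
               (trans (cong₂ (λ u v → u - k * v) (F .eς) (F .eρ)) (l4′ (F .ς) (F .ρ) k))
      ; eτ = trans (l5 (F .a) (F .c) (F .r) (F .s) (F .t) k)
               (trans (cong₂ (λ u v → u + k * v) (F .eτ) (F .eβ)) (l5′ (F .τ) (F .β) k))
      ; disc = trans (l6 (F .a) (F .b) (F .c) (F .r) (F .s) (F .t) k) (F .disc)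
      ; x = F .x - k * F .y ; y = F .y ; z = F .z
      ; val = trans (l7 (F .a) (F .b) (F .c) (F .r) (F .s) (F .t) k (F .x) (F .y) (F .z)) (F .val) }
      where
      l1 : ∀ a b c r s t k → + 4 * (b + k * t + k * k * a) * c - (r + k * s) * (r + k * s) ≡ (+ 4 * b * c - r * r) + + 2 * k * (+ 2 * c * t - r * s) + k * k * (+ 4 * a * c - s * s)
      l1 = solve-∀
      l1′ : ∀ α β τ k → + 5 * α + + 2 * k * (+ 5 * τ) + k * k * (+ 5 * β) ≡ + 5 * (α + + 2 * k * τ + k * k * β)
      l1′ = solve-∀
      l2 : ∀ a b t k → + 4 * a * (b + k * t + k * k * a) - (t + + 2 * a * k) * (t + + 2 * a * k) ≡ + 4 * a * b - t * t
      l2 = solve-∀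
      l3 : ∀ a r s t k → + 2 * a * (r + k * s) - s * (t + + 2 * a * k) ≡ + 2 * a * r - s * t
      l3 = solve-∀
      l4 : ∀ a b r s t k → + 2 * (b + k * t + k * k * a) * s - (r + k * s) * (t + + 2 * a * k) ≡ (+ 2 * b * s - r * t) - k * (+ 2 * a * r - s * t)
      l4 = solve-∀
      l4′ : ∀ ς ρ k → + 5 * ς - k * (+ 5 * ρ) ≡ + 5 * (ς - k * ρ)
      l4′ = solve-∀
      l5 : ∀ a c r s t k → + 2 * c * (t + + 2 * a * k) - (r + k * s) * s ≡ (+ 2 * c * t - r * s) + k * (+ 4 * a * c - s * s)
      l5 = solve-∀
      l5′ : ∀ τ β k → + 5 * τ + k * (+ 5 * β) ≡ + 5 * (τ + k * β)
      l5′ = solve-∀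
      l6 : ∀ a b c r s t k → + 4 * a * (b + k * t + k * k * a) * c + (r + k * s) * s * (t + + 2 * a * k) - a * (r + k * s) * (r + k * s) - (b + k * t + k * k * a) * s * s - c * (t + + 2 * a * k) * (t + + 2 * a * k)
           ≡ + 4 * a * b * c + r * s * t - a * r * r - b * s * s - c * t * t
      l6 = solve-∀
      l7 : ∀ a b c r s t k x y z → a * (x - k * y) * (x - k * y) + (b + k * t + k * k * a) * y * y + c * z * z + (r + k * s) * y * z + s * (x - k * y) * z + (t + + 2 * a * k) * (x - k * y) * y ≡ a * x * x + b * y * y + c * z * z + r * y * z + s * x * z + t * x * y
      l7 = solve-∀

    shear₁₃ : ℤ → Form m → Form m
    shear₁₃ k F = swap₂₃ (shear₁₂ k (swap₂₃ F))

    shear₂₃ : ℤ → Form m → Form m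
    shear₂₃ k F = swap₁₂ (shear₁₃ k (swap₁₂ F))

    -- Jacobi's identity: a 2×2 minor of the adjugate is the determinant times an entry. The factor
    -- 25 on both sides, from the discriminant and from the two divisions by 5, cancels.
    minor-det : (F : Form m) → F .β * F .γ - F .ρ * F .ρ ≡ + 4 * F .a
    minor-det F = *-cancelˡ-≡ (+ 25) _ _ (trans (l1 (F .β) (F .γ) (F .ρ))
      (trans (cong₂ (λ u v → u * v - + 5 * F .ρ * (+ 5 * F .ρ)) (sym (F .eβ)) (sym (F .eγ)))
      (trans (cong (λ u → (+ 4 * F .a * F .c - F .s * F .s) * (+ 4 * F .a * F .b - F .t * F .t) - u * u) (sym (F .eρ)))
      (trans (l2 (F .a) (F .b) (F .c) (F .r) (F .s) (F .t)) (trans (cong (λ u → + 4 * F .a * u) (F .disc)) (l3 (F .a)))))))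
      where
      l1 : ∀ β γ ρ → + 25 * (β * γ - ρ * ρ) ≡ + 5 * β * (+ 5 * γ) - + 5 * ρ * (+ 5 * ρ)
      l1 = solve-∀
      l2 : ∀ a b c r s t → (+ 4 * a * c - s * s) * (+ 4 * a * b - t * t) - (+ 2 * a * r - s * t) * (+ 2 * a * r - s * t) ≡ + 4 * a * (+ 4 * a * b * c + r * s * t - a * r * r - b * s * s - c * t * t)
      l2 = solve-∀
      l3 : ∀ a → + 4 * a * + 25 ≡ + 25 * (+ 4 * a)
      l3 = solve-∀

    -- Gauss reduction of the binary form `γu² + 2ρuv + βv²`, which is part of the adjoint form
    -- divided by 5; by `minor-det` its determinant is `4a`.
    record Reduced₂₃ (F : Form m) : Set where
      field
        a≥1 : 0ℤ ≤ F .a - 1ℤ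
        γ≥1 : 0ℤ ≤ F .γ - 1ℤ
        2ρ≤γ : 0ℤ ≤ F .γ - + 2 * F .ρ
        -2ρ≤γ : 0ℤ ≤ F .γ + + 2 * F .ρ
        γ≤β : 0ℤ ≤ F .β - F .γ

    β-pos : (F : Form m) → 0ℤ ≤ F .a - 1ℤ → 0ℤ ≤ F .γ - 1ℤ → 0ℤ ≤ F .β - 1ℤ
    β-pos F pa pγ with pos-dec (F .β)
    ... | inj₁ p = p
    ... | inj₂ p = ⊥-elim (¬0≤neg (0≤+ (0≤+ (0≤* p (0≤+ pγ (0≤ℕ {1}))) (0≤sq (F .ρ))) (0≤* (0≤ℕ {4}) pa))
                    (l (F .a) (F .β) (F .γ) (F .ρ) (minor-det F)))
      where
      l : ∀ a β γ ρ → β * γ - ρ * ρ ≡ + 4 * a → - β * (γ - 1ℤ + 1ℤ) + ρ * ρ + + 4 * (a - 1ℤ) ≡ - + 4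
      l a β γ ρ e = by₁ -1ℤ e (solve (a ∷ β ∷ γ ∷ ρ ∷ []))

    b-pos : (F : Form m) → 0ℤ ≤ F .a - 1ℤ → 0ℤ ≤ F .γ - 1ℤ → 0ℤ ≤ F .b - 1ℤ
    b-pos F pa pγ with pos-dec (F .b)
    ... | inj₁ p = p
    ... | inj₂ p = ⊥-elim (¬0≤neg (0≤+ (0≤+ (0≤* (0≤* (0≤ℕ {4}) (0≤+ pa (0≤ℕ {1}))) p) (0≤sq (F .t))) (0≤* (0≤ℕ {5}) pγ))
                    (l (F .a) (F .b) (F .t) (F .γ) (F .eγ)))
      where
      l : ∀ a b t γ → + 4 * a * b - t * t ≡ + 5 * γ → + 4 * (a - 1ℤ + 1ℤ) * - b + t * t + + 5 * (γ - 1ℤ) ≡ - + 5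
      l a b t γ e = by₁ -1ℤ e (solve (a ∷ b ∷ t ∷ γ ∷ []))

    -- `shear₂₃ k` fixes `a` and `γ` and takes `ρ`, `β` to `ρ + kγ`, `β + 2kρ + k²γ`. So `ρ` can be
    -- centred modulo `γ`, and if `β` is then smaller than `γ`, `swap₂₃` exchanges the two. The fuel
    -- bounds `γ`.
    reduce₂₃ : ∀ n (F : Form m) → 0ℤ ≤ F .a - 1ℤ → 0ℤ ≤ F .γ - 1ℤ → 0ℤ ≤ + n - F .γ →
               Σ (Form m) λ F′ → (F′ .a ≡ F .a) × Reduced₂₃ F′
    reduce₂₃ zero F pa pγ p = ⊥-elim (¬0≤neg (0≤+ pγ p) (l (F .γ)))
      where l : ∀ γ → γ - 1ℤ + (0ℤ - γ) ≡ -1ℤ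
            l = solve-∀
    reduce₂₃ (suc n) F pa pγ p with centre (F .ρ) (F .γ) pγ
    ... | k , q₁ , q₂ with cmp (F .γ) (shear₂₃ k F .β)
    ... | inj₁ h = shear₂₃ k F , refl , record { a≥1 = pa ; γ≥1 = pγ ; 2ρ≤γ = q₁ ; -2ρ≤γ = q₂ ; γ≤β = h }
    ... | inj₂ h = reduce₂₃ n (swap₂₃ (shear₂₃ k F)) pa (β-pos (shear₂₃ k F) pa pγ)
                     (subst (0ℤ ≤_) (l (F .γ) (shear₂₃ k F .β) (+ n)) (0≤+ h p))
      where l : ∀ γ β n → γ - β - 1ℤ + (1ℤ + n - γ) ≡ n - β
            l = solve-∀

    record Reduced (F : Form m) : Set where
      field
        red : Reduced₂₃ F
        t≤a : 0ℤ ≤ F .a - F .t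
        -t≤a : 0ℤ ≤ F .a + F .t
        s≤a : 0ℤ ≤ F .a - F .s
        -s≤a : 0ℤ ≤ F .a + F .s
        a≤b : 0ℤ ≤ F .b - F .a

    -- Gauss's alternation between a form and its adjoint. Once the adjoint part is reduced, shears
    -- along the first basis vector centre `t` and `s` modulo `2a`; they do not touch `β`, `γ`, `ρ`.
    -- If this makes `b` smaller than `a`, the two are exchanged and everything starts again with a
    -- smaller `a`, which the fuel bounds.
    reduce : ∀ n (F : Form m) → 0ℤ ≤ F .a - 1ℤ → 0ℤ ≤ F .γ - 1ℤ → 0ℤ ≤ + n - F .a → Σ (Form m) Reduced
    reduce zero F pa pγ p = ⊥-elim (¬0≤neg (0≤+ pa p) (l (F .a)))
      where l : ∀ γ → γ - 1ℤ + (0ℤ - γ) ≡ -1ℤ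
            l = solve-∀
    reduce (suc n) F pa pγ p with reduce₂₃ ∣ F .γ ∣ F pa pγ (γ≤ (F .γ))
      where γ≤ : ∀ x → 0ℤ ≤ + ∣ x ∣ - x
            γ≤ (+ n) = ≤-reflexive (sym (+-inverseʳ (+ n)))
            γ≤ -[1+ n ] = 0≤ℕ
    ... | F₁ , refl , R with centre (F₁ .t) (+ 2 * F₁ .a) (2a≥1 (F₁ .a) pa) | centre (F₁ .s) (+ 2 * F₁ .a) (2a≥1 (F₁ .a) pa)
      where
      2a≥1 : ∀ a → 0ℤ ≤ a - 1ℤ → 0ℤ ≤ + 2 * a - 1ℤ
      2a≥1 a pa = subst (0ℤ ≤_) (l a) (0≤+ (0≤+ pa pa) (0≤ℕ {1}))
        where l : ∀ a → a - 1ℤ + (a - 1ℤ) + 1ℤ ≡ + 2 * a - 1ℤ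
              l = solve-∀
    ... | k , t₁ , t₂ | k′ , s₁ , s₂ with cmp (F₁ .a) (shear₁₂ k F₁ .b)
    ... | inj₁ a≤b = shear₁₃ k′ (shear₁₂ k F₁) , record
          { red = record { a≥1 = pa ; γ≥1 = γ≥1 ; 2ρ≤γ = 2ρ≤γ ; -2ρ≤γ = -2ρ≤γ ; γ≤β = γ≤β }
          ; t≤a = half _ (subst (0ℤ ≤_) (l1 (F₁ .a) (F₁ .t) k) t₁) ; -t≤a = half _ (subst (0ℤ ≤_) (l2 (F₁ .a) (F₁ .t) k) t₂)
          ; s≤a = half _ (subst (0ℤ ≤_) (l1 (F₁ .a) (F₁ .s) k′) s₁) ; -s≤a = half _ (subst (0ℤ ≤_) (l2 (F₁ .a) (F₁ .s) k′) s₂)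
          ; a≤b = a≤b }
      where
      open Reduced₂₃ R
      l1 : ∀ a t k → + 2 * a - + 2 * (t + k * (+ 2 * a)) ≡ + 2 * (a - (t + + 2 * a * k))
      l1 = solve-∀
      l2 : ∀ a t k → + 2 * a + + 2 * (t + k * (+ 2 * a)) ≡ + 2 * (a + (t + + 2 * a * k))
      l2 = solve-∀
    ... | inj₂ b<a = reduce n (swap₁₂ (shear₁₂ k F₁)) (b-pos (shear₁₂ k F₁) pa (Reduced₂₃.γ≥1 R)) (Reduced₂₃.γ≥1 R)
                       (subst (0ℤ ≤_) (l (F₁ .a) (shear₁₂ k F₁ .b) (+ n)) (0≤+ b<a p))
      where l : ∀ γ β n → γ - β - 1ℤ + (1ℤ + n - γ) ≡ n - β
            l = solve-∀

  -- Uniqueness of the reduced form of discriminant 25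

  ints : ℤ → ℕ → List ℤ
  ints lo n = map (λ i → lo + + i) (upTo n)

  ∈-ints : ∀ lo n x → 0ℤ ≤ x - lo → 0ℤ ≤ lo + + n - x - 1ℤ → x ∈ ints lo n
  ∈-ints lo n x p q = subst (_∈ ints lo n) (trans (cong (λ u → lo + u) e) (l lo x)) (∈-map⁺ (λ i → lo + + i) (∈-upTo⁺ i<n))
    where
    l : ∀ lo x → lo + (x - lo) ≡ x
    l = solve-∀
    e : + ∣ x - lo ∣ ≡ x - lo
    e = 0≤i⇒+∣i∣≡i p
    l′ : ∀ lo n x → lo + n - x - 1ℤ ≡ n - (1ℤ + (x - lo))
    l′ = solve-∀
    i<n : ∣ x - lo ∣ ℕ.< n
    i<n = drop‿+≤+ (0≤i-j⇒j≤i (subst (0ℤ ≤_) (trans (l′ lo (+ n) x) (cong (λ u → + n - (1ℤ + u)) (sym e))) q))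

  data PM : ℤ → Set where
    plus : PM 1ℤ
    minus : PM -1ℤ

  sign? : ∀ z → (z ≡ 1ℤ ⊎ z ≡ -1ℤ) → PM z
  sign? _ (inj₁ refl) = plus
  sign? _ (inj₂ refl) = minus

  module _ {m : ℤ} where
    open Form

    opaque
      -- The divisibility comes from `4ab = 5γ + t²`. By itself it would also admit `a = 1`,
      -- `γ = 3`, `t = ±1`; the inequality removes these.
      aγt : All (λ a → All (λ γ → All (λ t → ¬ (+ 4 * a ∣ + 5 * γ + t * t) ⊎ ¬ (0ℤ ≤ + 16 * a - + 3 * (γ * γ)) ⊎ (a ≡ + 2 × γ ≡ + 3 × (t ≡ 1ℤ ⊎ t ≡ -1ℤ)))
                 (ints (- + 2) 5)) (ints 1ℤ 3)) (ints 1ℤ 2)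
      aγt = toWitness {a? = all? (λ a → all? (λ γ → all? (λ t → ¬? (_ ∣? _) ⊎-dec ¬? (_ ≤? _) ⊎-dec ((a ≟ _) ×-dec (γ ≟ _) ×-dec ((t ≟ _) ⊎-dec (t ≟ _)))) _) _) _} tt

      ρ-case : All (λ ρ → ¬ (+ 3 ∣ + 8 + ρ * ρ) ⊎ (ρ ≡ 1ℤ ⊎ ρ ≡ -1ℤ)) (ints -1ℤ 3)
      ρ-case = toWitness {a? = all? (λ ρ → ¬? (_ ∣? _) ⊎-dec ((ρ ≟ _) ⊎-dec (ρ ≟ _))) _} tt

      s-case : All (λ s → ¬ (+ 8 ∣ + 15 + s * s) ⊎ (s ≡ 1ℤ ⊎ s ≡ -1ℤ)) (ints (- + 2) 5)
      s-case = toWitness {a? = all? (λ s → ¬? (_ ∣? _) ⊎-dec ((s ≟ _) ⊎-dec (s ≟ _))) _} tt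

    -- Reducedness gives `16a = 4βγ - 4ρ² ≥ 3γ²` and `5γ = 4ab - t² ≥ 3a²`. Together `27a⁴ ≤ 400a`,
    -- so `a ≤ 2`, and then `3γ² ≤ 32`.
    small : ∀ a b t γ ρ β → 0ℤ ≤ a - 1ℤ → 0ℤ ≤ γ - 1ℤ → 0ℤ ≤ γ - + 2 * ρ → 0ℤ ≤ γ + + 2 * ρ → 0ℤ ≤ β - γ →
            0ℤ ≤ a - t → 0ℤ ≤ a + t → 0ℤ ≤ b - a → β * γ - ρ * ρ ≡ + 4 * a → + 4 * a * b - t * t ≡ + 5 * γ →
            (0ℤ ≤ + 2 - a) × (0ℤ ≤ + 3 - γ) × (0ℤ ≤ + 16 * a - + 3 * (γ * γ))
    small a b t γ ρ β pa pγ ρ₁ ρ₂ γβ t₁ t₂ ab e₁ e₂ = a≤2 , γ≤3 , I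
      where
      I : 0ℤ ≤ + 16 * a - + 3 * (γ * γ)
      I = subst (0ℤ ≤_) (l e₁) (0≤+ (0≤* (0≤* (0≤ℕ {4}) (0≤+ pγ (0≤ℕ {1}))) γβ) (0≤* ρ₁ ρ₂))
        where
        l : β * γ - ρ * ρ ≡ + 4 * a → + 4 * (γ - 1ℤ + 1ℤ) * (β - γ) + (γ - + 2 * ρ) * (γ + + 2 * ρ) ≡ + 16 * a - + 3 * (γ * γ)
        l e = by₁ (+ 4) e (solve (a ∷ β ∷ γ ∷ ρ ∷ []))
      II : 0ℤ ≤ + 5 * γ - + 3 * (a * a)
      II = subst (0ℤ ≤_) (l e₂) (0≤+ (0≤* (0≤* (0≤ℕ {4}) (0≤+ pa (0≤ℕ {1}))) ab) (0≤* t₁ t₂))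
        where
        l : + 4 * a * b - t * t ≡ + 5 * γ → + 4 * (a - 1ℤ + 1ℤ) * (b - a) + (a - t) * (a + t) ≡ + 5 * γ - + 3 * (a * a)
        l e = by₁ 1ℤ e (solve (a ∷ b ∷ t ∷ γ ∷ []))
      a≤2 : 0ℤ ≤ + 2 - a
      a≤2 with cmp a (+ 2)
      ... | inj₁ p = p
      ... | inj₂ a≥3 with cmp γ (+ 5)
      ... | inj₁ γ≤5 = ⊥-elim (¬0≤neg (0≤+ (0≤+ (0≤+ II (0≤* (0≤* (0≤ℕ {3}) (0≤+ pa (0≤ℕ {1}))) a≥3)) (0≤* (0≤ℕ {5}) γ≤5)) (0≤* (0≤ℕ {9}) a≥3)) (l a γ))
        where
        l : ∀ a γ → + 5 * γ - + 3 * (a * a) + + 3 * (a - 1ℤ + 1ℤ) * (a - + 2 - 1ℤ) + + 5 * (+ 5 - γ) + + 9 * (a - + 2 - 1ℤ) ≡ - + 2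
        l = solve-∀
      ... | inj₂ γ≥6 = ⊥-elim (¬0≤neg (0≤+ (0≤+ (0≤+ (0≤* (0≤ℕ {9}) I) (0≤* (0≤ℕ {16}) (0≤+ II (0≤* (0≤* (0≤ℕ {3}) (0≤+ pa (0≤ℕ {1}))) a≥3))))
                                 (0≤* (0≤* (0≤ℕ {27}) (0≤+ pγ (0≤ℕ {1}))) γ≥6)) (0≤* (0≤ℕ {82}) pγ)) (l a γ))
        where
        l : ∀ a γ → + 9 * (+ 16 * a - + 3 * (γ * γ)) + + 16 * (+ 5 * γ - + 3 * (a * a) + + 3 * (a - 1ℤ + 1ℤ) * (a - + 2 - 1ℤ))
              + + 27 * (γ - 1ℤ + 1ℤ) * (γ - + 5 - 1ℤ) + + 82 * (γ - 1ℤ) ≡ - + 82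
        l = solve-∀
      γ≤3 : 0ℤ ≤ + 3 - γ
      γ≤3 with cmp γ (+ 3)
      ... | inj₁ p = p
      ... | inj₂ γ≥4 = ⊥-elim (¬0≤neg (0≤+ (0≤+ I (0≤* (0≤ℕ {16}) a≤2)) (0≤* (0≤* (0≤ℕ {3}) γ≥4) (0≤+ pγ (0≤ℕ {5})))) (l a γ))
        where
        l : ∀ a γ → + 16 * a - + 3 * (γ * γ) + + 16 * (+ 2 - a) + + 3 * (γ - + 3 - 1ℤ) * (γ - 1ℤ + + 5) ≡ - + 16
        l = solve-∀

    private
      ∣-from : ∀ p q x y → p * q - x ≡ y → p ∣ y + x
      ∣-from p q x y e = divides q (by₁ -1ℤ e (solve (p ∷ q ∷ x ∷ y ∷ [])))

      -- Modulo 4 the relation `4r = st + 5ρ` forces `ρ = -st`, which rules out half of the cases,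
      -- and then `r = -st`. Changing signs of variables turns all three mixed coefficients into -1,
      -- which is `G`.
      finish : ∀ {s t ρ} → PM s → PM t → PM ρ → ∀ r x y z → + 4 * r - s * t ≡ + 5 * ρ →
               ∃[ X ] ∃[ Y ] ∃[ Z ] G X Y Z ≡ tern (+ 2) (+ 2) (+ 2) r s t x y z
      finish plus plus plus r x y z e = ⊥-elim (from-no (+ 4 ∣? + 6) (∣-from (+ 4) r 1ℤ (+ 5) e))
      finish plus plus minus r x y z e with *-cancelˡ-≡ (+ 4) r -1ℤ (+-cancelʳ -1ℤ (+ 4 * r) (+ 4 * -1ℤ) e)
      ... | refl = x , - y , - z , l x y z
        where
        l : ∀ x y z → + 2 * (x * x + - y * - y + - z * - z) - x * - y - - y * - z - - z * x
              ≡ + 2 * x * x + + 2 * y * y + + 2 * z * z + -1ℤ * y * z + 1ℤ * x * z + 1ℤ * x * y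
        l = solve-∀
      finish plus minus plus r x y z e with *-cancelˡ-≡ (+ 4) r 1ℤ (+-cancelʳ 1ℤ (+ 4 * r) (+ 4 * 1ℤ) e)
      ... | refl = x , y , - z , l x y z
        where
        l : ∀ x y z → + 2 * (x * x + y * y + - z * - z) - x * y - y * - z - - z * x
              ≡ + 2 * x * x + + 2 * y * y + + 2 * z * z + 1ℤ * y * z + 1ℤ * x * z + -1ℤ * x * y
        l = solve-∀
      finish plus minus minus r x y z e = ⊥-elim (from-no (+ 4 ∣? - + 6) (∣-from (+ 4) r -1ℤ (- + 5) e))
      finish minus plus plus r x y z e with *-cancelˡ-≡ (+ 4) r 1ℤ (+-cancelʳ 1ℤ (+ 4 * r) (+ 4 * 1ℤ) e)
      ... | refl = x , - y , z , l x y z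
        where
        l : ∀ x y z → + 2 * (x * x + - y * - y + z * z) - x * - y - - y * z - z * x
              ≡ + 2 * x * x + + 2 * y * y + + 2 * z * z + 1ℤ * y * z + -1ℤ * x * z + 1ℤ * x * y
        l = solve-∀
      finish minus plus minus r x y z e = ⊥-elim (from-no (+ 4 ∣? - + 6) (∣-from (+ 4) r -1ℤ (- + 5) e))
      finish minus minus plus r x y z e = ⊥-elim (from-no (+ 4 ∣? + 6) (∣-from (+ 4) r 1ℤ (+ 5) e))
      finish minus minus minus r x y z e with *-cancelˡ-≡ (+ 4) r -1ℤ (+-cancelʳ -1ℤ (+ 4 * r) (+ 4 * -1ℤ) e)
      ... | refl = x , y , z , l x y z
        where
        l : ∀ x y z → + 2 * (x * x + y * y + z * z) - x * y - y * z - z * x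
              ≡ + 2 * x * x + + 2 * y * y + + 2 * z * z + -1ℤ * y * z + -1ℤ * x * z + -1ℤ * x * y
        l = solve-∀

      ρ-range : ∀ ρ → 0ℤ ≤ + 3 - + 2 * ρ → 0ℤ ≤ + 3 + + 2 * ρ → ρ ∈ ints -1ℤ 3
      ρ-range (+ 0) _ _ = there (here refl)
      ρ-range (+ 1) _ _ = there (there (here refl))
      ρ-range -[1+ 0 ] _ _ = here refl
      ρ-range (+ suc (suc n)) h _ = ⊥-elim (¬0≤neg (0≤+ h (0≤* (0≤ℕ {2}) (0≤ℕ {n}))) (l (+ n)))
        where
        l : ∀ n → + 3 - + 2 * (+ 2 + n) + + 2 * n ≡ - 1ℤ
        l = solve-∀
      ρ-range -[1+ suc n ] _ h = ⊥-elim (¬0≤neg (0≤+ h (0≤* (0≤ℕ {2}) (0≤ℕ {n}))) (l -[1+ suc n ] (+ n) refl))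
        where
        l : ∀ r n → r ≡ - (+ 2 + n) → + 3 + + 2 * r + + 2 * n ≡ - 1ℤ
        l r n refl = solve (n ∷ [])

      -- Everything but the signs of r, s, t is forced: a = b = c = 2, β = γ = 3, and then rst = -1.
      b≡2 : ∀ {t} → PM t → ∀ b → + 8 * b - t * t ≡ + 15 → b ≡ + 2
      b≡2 plus b e = *-cancelˡ-≡ (+ 8) b (+ 2) (+-cancelʳ -1ℤ (+ 8 * b) (+ 8 * + 2) e)
      b≡2 minus b e = *-cancelˡ-≡ (+ 8) b (+ 2) (+-cancelʳ -1ℤ (+ 8 * b) (+ 8 * + 2) e)

      β≡3 : ∀ {ρ} → PM ρ → ∀ β → β * + 3 - ρ * ρ ≡ + 8 → β ≡ + 3
      β≡3 plus β e = *-cancelʳ-≡ β (+ 3) (+ 3) (+-cancelʳ -1ℤ (β * + 3) (+ 3 * + 3) e)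
      β≡3 minus β e = *-cancelʳ-≡ β (+ 3) (+ 3) (+-cancelʳ -1ℤ (β * + 3) (+ 3 * + 3) e)

      ρ-sign : ∀ β ρ → ρ ∈ ints -1ℤ 3 → β * + 3 - ρ * ρ ≡ + 8 → PM ρ
      ρ-sign β ρ ρ∈ e with All.lookup ρ-case ρ∈
      ... | inj₁ n = ⊥-elim (n (∣-from (+ 3) β (ρ * ρ) (+ 8) (trans (cong (λ u → u - ρ * ρ) (*-comm (+ 3) β)) e)))
      ... | inj₂ p = sign? ρ p

      s-sign : ∀ c s → s ∈ ints (- + 2) 5 → + 8 * c - s * s ≡ + 15 → PM s
      s-sign c s s∈ e with All.lookup s-case s∈
      ... | inj₁ n = ⊥-elim (n (∣-from (+ 8) c (s * s) (+ 15) e))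
      ... | inj₂ p = sign? s p

      aγt-forced : ∀ a b t γ → a ∈ ints 1ℤ 2 → γ ∈ ints 1ℤ 3 → t ∈ ints (- + 2) 5 → 0ℤ ≤ + 16 * a - + 3 * (γ * γ) →
        + 4 * a * b - t * t ≡ + 5 * γ → a ≡ + 2 × γ ≡ + 3 × PM t
      aγt-forced a b t γ a∈ γ∈ t∈ I e = elim (All.lookup (All.lookup (All.lookup aγt a∈) γ∈) t∈)
        where
        elim : ¬ (+ 4 * a ∣ + 5 * γ + t * t) ⊎ ¬ (0ℤ ≤ + 16 * a - + 3 * (γ * γ)) ⊎ (a ≡ + 2 × γ ≡ + 3 × (t ≡ 1ℤ ⊎ t ≡ -1ℤ)) →
               a ≡ + 2 × γ ≡ + 3 × PM t
        elim (inj₁ n) = ⊥-elim (n (∣-from (+ 4 * a) b (t * t) (+ 5 * γ) e))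
        elim (inj₂ (inj₁ n)) = ⊥-elim (n I)
        elim (inj₂ (inj₂ (p , q , t±))) = p , q , sign? t t±

      classify′ : ∀ s t ρ b c r x y z → PM s → PM t → PM ρ → b ≡ + 2 → c ≡ + 2 → + 4 * r - s * t ≡ + 5 * ρ →
        ∃[ X ] ∃[ Y ] ∃[ Z ] G X Y Z ≡ tern (+ 2) b c r s t x y z
      classify′ s t ρ _ _ r x y z ps pt pρ refl refl e = finish {s} {t} {ρ} ps pt pρ r x y z e

      classify : ∀ a b c r s t β γ ρ x y z → a ≡ + 2 → γ ≡ + 3 → PM t → s ∈ ints (- + 2) 5 →
        0ℤ ≤ γ - + 2 * ρ → 0ℤ ≤ γ + + 2 * ρ →
        + 4 * a * c - s * s ≡ + 5 * β → + 4 * a * b - t * t ≡ + 5 * γ → + 2 * a * r - s * t ≡ + 5 * ρ → β * γ - ρ * ρ ≡ + 4 * a →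
        ∃[ X ] ∃[ Y ] ∃[ Z ] G X Y Z ≡ tern a b c r s t x y z
      classify _ b c r s t β _ ρ x y z refl refl pt s∈ ρ₁ ρ₂ eβ eγ eρ eδ =
        classify′ s t ρ b c r x y z ps pt pρ (b≡2 {t} pt b eγ) (b≡2 {s} ps c eβ′) eρ
        where
        pρ : PM ρ
        pρ = ρ-sign β ρ (ρ-range ρ ρ₁ ρ₂) eδ
        eβ′ : + 8 * c - s * s ≡ + 15
        eβ′ = trans eβ (cong (+ 5 *_) (β≡3 {ρ} pρ β eδ))
        ps : PM s
        ps = s-sign c s s∈ eβ′

    private
      represents : (F : Form m) → Reduced F → ∃[ X ] ∃[ Y ] ∃[ Z ] G X Y Z ≡ tern (F .a) (F .b) (F .c) (F .r) (F .s) (F .t) (F .x) (F .y) (F .z)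
      represents F R =
        let a≤2 , γ≤3 , I = small (F .a) (F .b) (F .t) (F .γ) (F .ρ) (F .β) a≥1 γ≥1 2ρ≤γ -2ρ≤γ γ≤β t≤a -t≤a a≤b (minor-det F) (F .eγ)
            a≡ , γ≡ , pt = aγt-forced (F .a) (F .b) (F .t) (F .γ) (∈-ints 1ℤ 2 (F .a) a≥1 (subst (0ℤ ≤_) (l2 (F .a)) a≤2))
                             (∈-ints 1ℤ 3 (F .γ) γ≥1 (subst (0ℤ ≤_) (l3 (F .γ)) γ≤3)) (abs≤2 (F .a) (F .t) a≤2 t≤a -t≤a) I (F .eγ)
        in classify (F .a) (F .b) (F .c) (F .r) (F .s) (F .t) (F .β) (F .γ) (F .ρ) (F .x) (F .y) (F .z)
             a≡ γ≡ pt (abs≤2 (F .a) (F .s) a≤2 s≤a -s≤a) 2ρ≤γ -2ρ≤γ (F .eβ) (F .eγ) (F .eρ) (minor-det F)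
        where
        open Reduced R
        open Reduced₂₃ red
        l2 : ∀ a → + 2 - a ≡ 1ℤ + + 2 - a - 1ℤ
        l2 = solve-∀
        l3 : ∀ a → + 3 - a ≡ 1ℤ + + 3 - a - 1ℤ
        l3 = solve-∀
        abs≤2 : ∀ a t → 0ℤ ≤ + 2 - a → 0ℤ ≤ a - t → 0ℤ ≤ a + t → t ∈ ints (- + 2) 5
        abs≤2 a t p q q′ = ∈-ints (- + 2) 5 t (subst (0ℤ ≤_) (h a t) (0≤+ p q′)) (subst (0ℤ ≤_) (h′ a t) (0≤+ p q))
          where
          h : ∀ a t → + 2 - a + (a + t) ≡ t - - + 2
          h = solve-∀
          h′ : ∀ a t → + 2 - a + (a - t) ≡ - + 2 + + 5 - t - 1ℤ
          h′ = solve-∀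

    G-represents : (F : Form m) → 0ℤ ≤ F .a - 1ℤ → 0ℤ ≤ F .γ - 1ℤ → ∃[ X ] ∃[ Y ] ∃[ Z ] G X Y Z ≡ m
    G-represents F₀ pa pγ =
      let F , R = reduce ∣ F₀ .a ∣ F₀ pa pγ (≤∣∣ (F₀ .a))
          X , Y , Z , e = represents F R
      in X , Y , Z , trans e (F .val)
      where
      ≤∣∣ : ∀ x → 0ℤ ≤ + ∣ x ∣ - x
      ≤∣∣ (+ n) = ≤-reflexive (sym (+-inverseʳ (+ n)))
      ≤∣∣ -[1+ n ] = 0≤ℕ

  -- The hypotheses say that `(mx + uy + vz)² + 5(Ay² + Byz + Cz²)` is divisible by `m`
  -- coefficientwise. The quotient `F` takes the value `m` at (1, 0, 0), and its discriminant is 25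
  -- because `4AC - B² = m`.
  module _ (m A B C u v b c r k : ℤ) (m≥1 : 0ℤ ≤ m - 1ℤ) (A≥1 : 0ℤ ≤ A - 1ℤ)
           (hΔ : + 4 * A * C - B * B ≡ m) (hb : u * u + + 5 * A ≡ m * b) (hr : + 2 * u * v + + 5 * B ≡ m * r)
           (hc : v * v + + 5 * C ≡ m * c) (h5 : m * m + 1ℤ ≡ + 5 * k) where

    private
      -- `m²` is invertible modulo 5, being `5k - 1`. The minors that do not contain the coefficient
      -- `m` become visible multiples of 5 only after multiplication by `m²`.
      div5 : ∀ W K → m * m * W ≡ + 5 * K → W ≡ + 5 * (k * W - K)
      div5 W K e = l m k W K h5 e
        where
        l : ∀ m k W K → m * m + 1ℤ ≡ + 5 * k → m * m * W ≡ + 5 * K → W ≡ + 5 * (k * W - K)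
        l m k W K h e = by₂ W -1ℤ h e (i m k W K)
          where
          i : ∀ m k W K → W - + 5 * (k * W - K) ≡ W * (m * m + 1ℤ - + 5 * k) + -1ℤ * (m * m * W - + 5 * K)
          i = solve-∀

      sq-nz : 0ℤ ≤ m - 1ℤ → ∀ x → + 4 * m * x ≡ + 4 * m * + 25 → x ≡ + 25
      sq-nz p x e = pos-case m p e
        where
        pos-case : ∀ m → 0ℤ ≤ m - 1ℤ → + 4 * m * x ≡ + 4 * m * + 25 → x ≡ + 25
        pos-case (+ suc n) _ e = *-cancelˡ-≡ (+ 4 * (+ suc n)) x (+ 25) e
        pos-case +0 p = ⊥-elim (¬0≤neg p refl)
        pos-case -[1+ n ] p = ⊥-elim (¬0≤neg p refl)

      K = + 4 * (u * u) * C + + 4 * A * (v * v) - + 4 * u * v * B + + 20 * A * C - + 5 * (B * B)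

      W≡K : m * m * (+ 4 * b * c - r * r) ≡ + 5 * K
      W≡K = trans (i m b c r) (trans (cong₂ (λ p q → + 4 * p * (m * c) - q * q) (sym hb) (sym hr))
              (trans (cong (λ p → + 4 * (u * u + + 5 * A) * p - (+ 2 * u * v + + 5 * B) * (+ 2 * u * v + + 5 * B)) (sym hc)) (j A B C u v)))
        where
        i : ∀ m b c r → m * m * (+ 4 * b * c - r * r) ≡ + 4 * (m * b) * (m * c) - m * r * (m * r)
        i = solve-∀
        j : ∀ A B C u v → + 4 * (u * u + + 5 * A) * (v * v + + 5 * C) - (+ 2 * u * v + + 5 * B) * (+ 2 * u * v + + 5 * B)
              ≡ + 5 * (+ 4 * (u * u) * C + + 4 * A * (v * v) - + 4 * u * v * B + + 20 * A * C - + 5 * (B * B))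
        j = solve-∀

    m-represented : ∃[ X ] ∃[ Y ] ∃[ Z ] G X Y Z ≡ m
    m-represented = G-represents F m≥1 (subst (0ℤ ≤_) (l A) (0≤+ (0≤* (0≤ℕ {4}) A≥1) (0≤ℕ {3})))
      where
      l : ∀ A → + 4 * (A - 1ℤ) + + 3 ≡ + 4 * A - 1ℤ
      l = solve-∀
      eβ′ : ∀ u A b → u * u + + 5 * A ≡ m * b → + 4 * m * b - + 2 * u * (+ 2 * u) ≡ + 5 * (+ 4 * A)
      eβ′ u A b h = i m b u A h
        where
        i : ∀ m b u A → u * u + + 5 * A ≡ m * b → + 4 * m * b - + 2 * u * (+ 2 * u) ≡ + 5 * (+ 4 * A)
        i m b u A h = by₁ (- + 4) h (j m b u A)
          where
          j : ∀ m b u A → + 4 * m * b - + 2 * u * (+ 2 * u) - + 5 * (+ 4 * A) ≡ - + 4 * (u * u + + 5 * A - m * b)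
          j = solve-∀
      eρ′ : + 2 * m * r - + 2 * v * (+ 2 * u) ≡ + 5 * (+ 2 * B)
      eρ′ = by₁ (- + 2) hr (i m r u v B)
        where
        i : ∀ m r u v B → + 2 * m * r - + 2 * v * (+ 2 * u) - + 5 * (+ 2 * B) ≡ - + 2 * (+ 2 * u * v + + 5 * B - m * r)
        i = solve-∀
      ς′ : m * m * (+ 2 * b * (+ 2 * v) - r * (+ 2 * u)) ≡ + 5 * (m * (+ 4 * A * v - + 2 * u * B))
      ς′ = by₂ (- (+ 4 * m * v)) (+ 2 * m * u) hb hr (i m r u v A B b)
        where
        i : ∀ m r u v A B b → m * m * (+ 2 * b * (+ 2 * v) - r * (+ 2 * u)) - + 5 * (m * (+ 4 * A * v - + 2 * u * B))
              ≡ - (+ 4 * m * v) * (u * u + + 5 * A - m * b) + + 2 * m * u * (+ 2 * u * v + + 5 * B - m * r)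
        i = solve-∀
      τ′ : m * m * (+ 2 * c * (+ 2 * u) - r * (+ 2 * v)) ≡ + 5 * (m * (+ 4 * C * u - + 2 * v * B))
      τ′ = by₂ (- (+ 4 * m * u)) (+ 2 * m * v) hc hr (i m r u v C B c)
        where
        i : ∀ m r u v A B b → m * m * (+ 2 * b * (+ 2 * u) - r * (+ 2 * v)) - + 5 * (m * (+ 4 * A * u - + 2 * v * B))
              ≡ - (+ 4 * m * u) * (v * v + + 5 * A - m * b) + + 2 * m * v * (+ 2 * u * v + + 5 * B - m * r)
        i = solve-∀
      disc′ : + 4 * m * b * c + r * (+ 2 * v) * (+ 2 * u) - m * r * r - b * (+ 2 * v) * (+ 2 * v) - c * (+ 2 * u) * (+ 2 * u) ≡ + 25
      disc′ = sq-nz m≥1 _ (trans (i m b c r u v)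
         (trans (cong₂ (λ p q → p * q - (+ 2 * m * r - + 2 * v * (+ 2 * u)) * (+ 2 * m * r - + 2 * v * (+ 2 * u))) (eβ′ v C c hc) (eβ′ u A b hb))
         (trans (cong (λ p → + 5 * (+ 4 * C) * (+ 5 * (+ 4 * A)) - p * p) eρ′) (by₁ (+ 100) hΔ (j m A B C)))))
        where
        i : ∀ m b c r u v → + 4 * m * (+ 4 * m * b * c + r * (+ 2 * v) * (+ 2 * u) - m * r * r - b * (+ 2 * v) * (+ 2 * v) - c * (+ 2 * u) * (+ 2 * u))
             ≡ (+ 4 * m * c - + 2 * v * (+ 2 * v)) * (+ 4 * m * b - + 2 * u * (+ 2 * u)) - (+ 2 * m * r - + 2 * v * (+ 2 * u)) * (+ 2 * m * r - + 2 * v * (+ 2 * u))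
        i = solve-∀
        j : ∀ m A B C → + 5 * (+ 4 * C) * (+ 5 * (+ 4 * A)) - + 5 * (+ 2 * B) * (+ 5 * (+ 2 * B)) - + 4 * m * + 25 ≡ + 100 * (+ 4 * A * C - B * B - m)
        j = solve-∀
      val′ : ∀ m b c r s t → m * 1ℤ * 1ℤ + b * 0ℤ * 0ℤ + c * 0ℤ * 0ℤ + r * 0ℤ * 0ℤ + s * 1ℤ * 0ℤ + t * 1ℤ * 0ℤ ≡ m
      val′ = solve-∀
      F : Form m
      F = record
        { a = m ; b = b ; c = c ; r = r ; s = + 2 * v ; t = + 2 * u
        ; α = _ ; β = + 4 * C ; γ = + 4 * A ; ρ = + 2 * B ; ς = _ ; τ = _
        ; eα = div5 (+ 4 * b * c - r * r) K W≡K
        ; eβ = eβ′ v C c hc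
        ; eγ = eβ′ u A b hb
        ; eρ = eρ′
        ; eς = div5 _ _ ς′
        ; eτ = div5 _ _ τ′
        ; disc = disc′
        ; x = 1ℤ ; y = 0ℤ ; z = 0ℤ
        ; val = val′ m b c r (+ 2 * v) (+ 2 * u)
        }

-- The Legendre symbol and Gauss's lemma

module LegendreSymbol where

  open Folds
  open TernaryForms using (by₁)
  open import Data.Nat as ℕ using (ℕ; zero; suc; ⌊_/2⌋; z≤n; s≤s)
  import Data.Nat.Properties as ℕ
  import Data.Nat.Divisibility as ℕ
  open import Data.Nat.Primality using (Prime; euclidsLemma; prime⇒nonZero; prime⇒nonTrivial)
  open import Data.Integer using (ℤ; +_; 0ℤ; 1ℤ; -1ℤ; _+_; _-_; _*_; _^_; -_; ∣_∣; _≟_)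
  open import Data.Integer.Properties
  open import Data.Integer.DivMod using (_/ℕ_; _%ℕ_; a≡a%ℕn+[a/ℕn]*n; n%ℕd<d)
  open import Data.Integer.Divisibility.Signed using (_∣_; divides; _∣?_; ∣⇒∣ᵤ; ∣ᵤ⇒∣; ∣m∣n⇒∣m+n; ∣m∣n⇒∣m-n; ∣m⇒∣-m; ∣n⇒∣m*n; ∣m⇒∣m*n)
  open import Data.Integer.Tactic.RingSolver using (solve-∀)
  open import Data.Vec using (Vec; []; _∷_; replicate)

  open BigOp *-1-isCommutativeMonoid public using () renaming
    (fold to ∏; fold-cong to ∏-cong; fold-ε to ∏-1; fold-merge to ∏-merge; fold-swap to ∏-swap; fold-single to ∏-single; fold-perm to ∏-perm)

  record OddPrime (p : ℕ) : Set where
    constructor oddPrime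
    field
      prime : Prime p
      odd : p ≡ suc (⌊ p /2⌋ ℕ.+ ⌊ p /2⌋)

  data Tri : ℤ → Set where
    zer : Tri 0ℤ
    one : Tri 1ℤ
    min : Tri -1ℤ

  ±1⇒tri : ∀ {z} → z ≡ 1ℤ ⊎ z ≡ -1ℤ → Tri z
  ±1⇒tri (inj₁ refl) = one
  ±1⇒tri (inj₂ refl) = min

  tri-* : ∀ {x y} → Tri x → Tri y → Tri (x * y)
  tri-* zer _ = zer
  tri-* one zer = zer
  tri-* one one = one
  tri-* one min = min
  tri-* min zer = zer
  tri-* min one = min
  tri-* min min = one

  module Mod (n : ℤ) where
    infix 4 _≈_
    record _≈_ (x y : ℤ) : Set where
      constructor mod
      field div : n ∣ x - y
    open _≈_ public

    ≈-refl : ∀ {x} → x ≈ x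
    ≈-refl {x} = mod (divides 0ℤ (+-inverseʳ x))

    ≡⇒≈ : ∀ {x y} → x ≡ y → x ≈ y
    ≡⇒≈ refl = ≈-refl

    ≈-sym : ∀ {x y} → x ≈ y → y ≈ x
    ≈-sym {x} {y} (mod h) = mod (subst (n ∣_) (l x y) (∣m⇒∣-m h))
      where l : ∀ x y → - (x - y) ≡ y - x
            l = solve-∀

    ≈-trans : ∀ {x y z} → x ≈ y → y ≈ z → x ≈ z
    ≈-trans {x} {y} {z} (mod h) (mod k) = mod (subst (n ∣_) (l x y z) (∣m∣n⇒∣m+n h k))
      where l : ∀ x y z → x - y + (y - z) ≡ x - z
            l = solve-∀

    ≈-* : ∀ {x y u v} → x ≈ y → u ≈ v → x * u ≈ y * v
    ≈-* {x} {y} {u} {v} (mod h) (mod k) = mod (subst (n ∣_) (l x y u v) (∣m∣n⇒∣m+n (∣m⇒∣m*n u h) (∣n⇒∣m*n y k)))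
      where l : ∀ x y u v → (x - y) * u + y * (u - v) ≡ x * u - y * v
            l = solve-∀

    ≈-^ : ∀ {x y} k → x ≈ y → x ^ k ≈ y ^ k
    ≈-^ zero h = ≈-refl
    ≈-^ (suc k) h = ≈-* h (≈-^ k h)

    ≈-∏ : ∀ k (f g : ℕ → ℤ) → (∀ i → i ℕ.< k → f i ≈ g i) → ∏ k f ≈ ∏ k g
    ≈-∏ zero f g h = ≈-refl
    ≈-∏ (suc k) f g h = ≈-* (≈-∏ k f g (λ i p → h i (ℕ.m<n⇒m<1+n p))) (h k ℕ.≤-refl)

    ≈0 : ∀ {x} → n ∣ x → x ≈ 0ℤ
    ≈0 {x} d = mod (subst (n ∣_) (sym (+-identityʳ x)) d)

    ≈0⁻ : ∀ {x} → x ≈ 0ℤ → n ∣ x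
    ≈0⁻ {x} (mod d) = subst (n ∣_) (+-identityʳ x) d

  ∏-const : ∀ n a → ∏ n (λ _ → a) ≡ a ^ n
  ∏-const zero a = refl
  ∏-const (suc n) a = trans (cong (_* a) (∏-const n a)) (*-comm (a ^ n) a)

  ^-distribˡ-* : ∀ n a b → (a * b) ^ n ≡ a ^ n * b ^ n
  ^-distribˡ-* zero a b = refl
  ^-distribˡ-* (suc n) a b = trans (cong (a * b *_) (^-distribˡ-* n a b)) (l a b (a ^ n) (b ^ n))
    where l : ∀ a b x y → a * b * (x * y) ≡ a * x * (b * y)
          l = solve-∀

  -- Monic polynomials over ℤ, given by their lower coefficients (constant term first).
  eval : ∀ {n} → Vec ℤ n → ℤ → ℤ
  eval [] x = 1ℤ
  eval (c ∷ cs) x = c + x * eval cs x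

  factor : ∀ {n} (P : Vec ℤ (suc n)) r → Σ (Vec ℤ n) λ Q → ∀ x → eval P x - eval P r ≡ (x - r) * eval Q x
  factor (c ∷ []) r = [] , λ x → l c x r
    where l : ∀ c x r → c + x * 1ℤ - (c + r * 1ℤ) ≡ (x - r) * 1ℤ
          l = solve-∀
  factor (c ∷ P@(_ ∷ _)) r =
    let Q , h = factor P r in
    (eval P r ∷ Q) , λ x → l c x r (eval P x) (eval P r) (eval Q x) (h x)
    where
    l : ∀ c x r u v w → u - v ≡ (x - r) * w → c + x * u - (c + r * v) ≡ (x - r) * (v + x * w)
    l c x r u v w h = by₁ x h (i c x r u v w)
      where
      i : ∀ c x r u v w → c + x * u - (c + r * v) - (x - r) * (v + x * w) ≡ x * (u - v - (x - r) * w)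
      i = solve-∀

  prime∤1 : ∀ {p} → Prime p → ¬ (+ p ∣ 1ℤ)
  prime∤1 {p} pr d = ℕ.<⇒≱ (ℕ.nonTrivial⇒n>1 p {{prime⇒nonTrivial pr}}) (ℕ.∣⇒≤ (∣⇒∣ᵤ d))

  euclid : ∀ {p} → Prime p → ∀ x y → + p ∣ x * y → (+ p ∣ x) ⊎ (+ p ∣ y)
  euclid {p} pr x y d with euclidsLemma ∣ x ∣ ∣ y ∣ pr (subst (p ℕ.∣_) (abs-* x y) (∣⇒∣ᵤ d))
  ... | inj₁ h = inj₁ (∣ᵤ⇒∣ h)
  ... | inj₂ h = inj₂ (∣ᵤ⇒∣ h)

  -- A monic polynomial of degree `n` has at most `n` roots modulo a prime: splitting off the linear
  -- factor of one root leaves the others as roots of the quotient, by Euclid's lemma.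
  lagrange : ∀ {p} → Prime p → ∀ n (P : Vec ℤ n) (ρ : ℕ → ℤ) → (∀ i → i ℕ.≤ n → + p ∣ eval P (ρ i)) →
             (∀ i j → i ℕ.≤ n → j ℕ.< i → ¬ (+ p ∣ ρ j - ρ i)) → ⊥
  lagrange pr zero [] ρ root dist = prime∤1 pr (root 0 z≤n)
  lagrange {p} pr (suc n) P ρ root dist =
    let Q , h = factor P (ρ (suc n)) in
    lagrange pr n Q ρ (λ i i≤n → rootQ Q h i (s≤s i≤n)) (λ i j p → dist i j (ℕ.m≤n⇒m≤1+n p))
    where
    rootQ : ∀ Q → (∀ x → eval P x - eval P (ρ (suc n)) ≡ (x - ρ (suc n)) * eval Q x) → ∀ i → i ℕ.< suc n → + p ∣ eval Q (ρ i)
    rootQ Q h i i<n with euclid pr (ρ i - ρ (suc n)) (eval Q (ρ i))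
                           (subst (+ p ∣_) (h (ρ i)) (∣m∣n⇒∣m-n (root i (ℕ.<⇒≤ i<n)) (root (suc n) ℕ.≤-refl)))
    ... | inj₁ d = ⊥-elim (dist (suc n) i ℕ.≤-refl i<n d)
    ... | inj₂ d = d

  eval-Xⁿ : ∀ n x → eval (replicate n 0ℤ) x ≡ x ^ n
  eval-Xⁿ zero x = refl
  eval-Xⁿ (suc n) x = trans (+-identityˡ _) (cong (x *_) (eval-Xⁿ n x))

  opaque
    -- Euler's criterion serves as the definition, so that the symbol is computable; the link with
    -- squares is `sqrt` and `χ-sq`.
    χ : ℕ → ℤ → ℤ
    χ p a with + p ∣? a | + p ∣? (a ^ ⌊ p /2⌋ - 1ℤ)
    ... | yes _ | _ = 0ℤ
    ... | no _ | yes _ = 1ℤ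
    ... | no _ | no _ = -1ℤ

    χ-tri : ∀ p a → Tri (χ p a)
    χ-tri p a with + p ∣? a | + p ∣? (a ^ ⌊ p /2⌋ - 1ℤ)
    ... | yes _ | _ = zer
    ... | no _ | yes _ = one
    ... | no _ | no _ = min

  ∣small⇒≡0 : ∀ {p} x → p ℕ.∣ x → x ℕ.< p → x ≡ 0
  ∣small⇒≡0 zero d lt = refl
  ∣small⇒≡0 (suc x) d lt = ⊥-elim (ℕ.<⇒≱ lt (ℕ.∣⇒≤ d))

  module Symbol {p : ℕ} (op : OddPrime p) where
    open OddPrime op
    open Mod (+ p)

    h : ℕ
    h = ⌊ p /2⌋

    private
      instance
        p-nz : ℕ.NonZero p
        p-nz = prime⇒nonZero prime

    h>0 : 0 ℕ.< h
    h>0 = is-pos h odd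
      where
      is-pos : ∀ h → p ≡ suc (h ℕ.+ h) → 0 ℕ.< h
      is-pos zero e = ⊥-elim (ℕ.<-irrefl (sym e) (ℕ.nonTrivial⇒n>1 p {{prime⇒nonTrivial prime}}))
      is-pos (suc h) e = s≤s z≤n

    p>2 : 2 ℕ.< p
    p>2 = subst (2 ℕ.<_) (sym odd) (s≤s (ℕ.+-mono-≤ h>0 h>0))

    h<p : h ℕ.< p
    h<p = subst (h ℕ.<_) (sym odd) (s≤s (ℕ.m≤m+n h h))

    -- Two different elements of {0, 1, -1} differ by 1 or 2, and `p > 2`. All identities between
    -- symbols are proved as congruences and become equalities through this.
    tri-unique : ∀ {x y} → Tri x → Tri y → x ≈ y → x ≡ y
    tri-unique x y (mod d) = go x y (∣⇒∣ᵤ d)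
      where
      p∤1 : ¬ (p ℕ.∣ 1)
      p∤1 d = ℕ.<⇒≱ p>2 (ℕ.m≤n⇒m≤1+n (ℕ.∣⇒≤ d))
      p∤2 : ¬ (p ℕ.∣ 2)
      p∤2 d = ℕ.<⇒≱ p>2 (ℕ.∣⇒≤ d)
      go : ∀ {x y} → Tri x → Tri y → p ℕ.∣ ∣ x - y ∣ → x ≡ y
      go zer zer _ = refl
      go zer one d = ⊥-elim (p∤1 d)
      go zer min d = ⊥-elim (p∤1 d)
      go one zer d = ⊥-elim (p∤1 d)
      go one one _ = refl
      go one min d = ⊥-elim (p∤2 d)
      go min zer d = ⊥-elim (p∤1 d)
      go min one d = ⊥-elim (p∤2 d)
      go min min _ = refl

    -- The representative of r of least absolute value is sgn r · (red r + 1).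
    sgn : ℕ → ℤ
    sgn r with r ℕ.≤? h
    ... | yes _ = 1ℤ
    ... | no _ = -1ℤ

    red : ℕ → ℕ
    red r with r ℕ.≤? h
    ... | yes _ = ℕ.pred r
    ... | no _ = ℕ.pred (p ℕ.∸ r)

    sgn-±1 : ∀ r → sgn r ≡ 1ℤ ⊎ sgn r ≡ -1ℤ
    sgn-±1 r with r ℕ.≤? h
    ... | yes _ = inj₁ refl
    ... | no _ = inj₂ refl

    red-< : ∀ r → 0 ℕ.< r → r ℕ.< p → red r ℕ.< h
    red-< r r>0 r<p with r ℕ.≤? h
    ... | yes r≤h = subst (ℕ._≤ h) (sym (ℕ.suc-pred r {{ℕ.>-nonZero r>0}})) r≤h
    ... | no r≰h = subst (ℕ._≤ h) (sym (ℕ.suc-pred (p ℕ.∸ r) {{ℕ.>-nonZero (ℕ.m<n⇒0<n∸m r<p)}}))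
          (ℕ.≤-trans (ℕ.∸-monoʳ-≤ p (ℕ.≰⇒> r≰h)) (ℕ.≤-reflexive (trans (cong (ℕ._∸ suc h) odd) (ℕ.m+n∸m≡n h h))))

    sgn-red : ∀ r → 0 ℕ.< r → r ℕ.< p → + r ≈ sgn r * + suc (red r)
    sgn-red r r>0 r<p with r ℕ.≤? h
    ... | yes r≤h = ≡⇒≈ (trans (cong +_ (sym (ℕ.suc-pred r {{ℕ.>-nonZero r>0}}))) (sym (*-identityˡ _)))
    ... | no r≰h = mod (divides 1ℤ (trans (cong (λ u → + r - -1ℤ * + u) (ℕ.suc-pred (p ℕ.∸ r) {{ℕ.>-nonZero (ℕ.m<n⇒0<n∸m r<p)}}))
                     (trans (l (+ r) (+ (p ℕ.∸ r))) (trans (cong +_ (ℕ.m+[n∸m]≡n (ℕ.<⇒≤ r<p))) (sym (*-identityˡ (+ p)))))))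
      where
      l : ∀ a b → a - -1ℤ * b ≡ a + b
      l = solve-∀

    suc-inj : ∀ k l → k ℕ.≤ l → l ℕ.< p → + suc k ≈ + suc l → k ≡ l
    suc-inj k l k≤l l<p d = ℕ.≤-antisym k≤l (ℕ.m∸n≡0⇒m≤n (∣small⇒≡0 (l ℕ.∸ k) (∣⇒∣ᵤ d′) (ℕ.≤-<-trans (ℕ.m∸n≤m l k) l<p)))
      where
      i : ∀ l k → + 1 + l - (+ 1 + k) ≡ l - k
      i = solve-∀
      d′ : + p ∣ + (l ℕ.∸ k)
      d′ = subst (+ p ∣_) (trans (i (+ l) (+ k)) (trans (m-n≡m⊖n l k) (⊖-≥ k≤l))) (div (≈-sym d))

    F : ℤ
    F = ∏ h (λ k → + suc k)

    p∤suc : ∀ k → k ℕ.< h → ¬ (+ p ∣ + suc k)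
    p∤suc k k<h d = ℕ.<⇒≱ (ℕ.<-≤-trans h<p (ℕ.∣⇒≤ (∣⇒∣ᵤ d))) k<h

    p∤∏ : ∀ n → n ℕ.≤ h → ¬ (+ p ∣ ∏ n (λ k → + suc k))
    p∤∏ zero _ = prime∤1 prime
    p∤∏ (suc n) n<h d with euclid prime (∏ n (λ k → + suc k)) (+ suc n) d
    ... | inj₁ e = p∤∏ n (ℕ.<⇒≤ n<h) e
    ... | inj₂ e = p∤suc n n<h e

    module _ (a : ℤ) (p∤a : ¬ (+ p ∣ a)) where
      r : ℕ → ℕ
      r k = (a * + suc k) %ℕ p

      r≈ : ∀ k → a * + suc k ≈ + r k
      r≈ k = mod (divides ((a * + suc k) /ℕ p) (l (a * + suc k) (+ r k) _ (a≡a%ℕn+[a/ℕn]*n (a * + suc k) p)))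
        where
        l : ∀ x y z → x ≡ y + z → x - y ≡ z
        l x y z refl = i y z
          where i : ∀ y z → y + z - y ≡ z
                i = solve-∀

      r<p : ∀ k → r k ℕ.< p
      r<p k = n%ℕd<d (a * + suc k) p

      r>0 : ∀ k → k ℕ.< h → 0 ℕ.< r k
      r>0 k k<h = is-pos (r k) refl
        where
        is-pos : ∀ x → r k ≡ x → 0 ℕ.< x
        is-pos (suc x) _ = s≤s z≤n
        is-pos zero e with euclid prime a (+ suc k) (≈0⁻ (subst (λ x → a * + suc k ≈ + x) e (r≈ k)))
        ... | inj₁ d = ⊥-elim (p∤a d)
        ... | inj₂ d = ⊥-elim (p∤suc k k<h d)

      j : ℕ → ℕ
      j k = red (r k)

      sj : ∀ k → k ℕ.< h → a * + suc k ≈ sgn (r k) * + suc (j k)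
      sj k k<h = ≈-trans (r≈ k) (sgn-red (r k) (r>0 k k<h) (r<p k))

      cancel-a : ∀ x y → a * x ≈ a * y → x ≈ y
      cancel-a x y (mod d) = pick (euclid prime a (x - y) (subst (+ p ∣_) (l a x y) d))
        where
        l : ∀ a x y → a * x - a * y ≡ a * (x - y)
        l = solve-∀
        pick : (+ p ∣ a) ⊎ (+ p ∣ x - y) → x ≈ y
        pick (inj₁ e) = ⊥-elim (p∤a e)
        pick (inj₂ e) = mod e

      j-inj : ∀ k l → k ℕ.< h → l ℕ.< h → j k ≡ j l → k ≡ l
      j-inj k l k<h l<h e = by (sgn-±1 (r k)) (sgn-±1 (r l))
        where
        same : ∀ s → sgn (r k) ≡ s → sgn (r l) ≡ s → k ≡ l
        same s e₁ e₂ = fin (cancel-a _ _ (≈-trans (sj k k<h) (≈-trans (≡⇒≈ (cong₂ (λ x y → x * + suc y) (trans e₁ (sym e₂)) e)) (≈-sym (sj l l<h)))))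
          where
          fin : + suc k ≈ + suc l → k ≡ l
          fin d with ℕ.≤-total k l
          ... | inj₁ q = suc-inj k l q (ℕ.<-trans l<h h<p) d
          ... | inj₂ q = sym (suc-inj l k q (ℕ.<-trans k<h h<p) (≈-sym d))
        -- With opposite signs `p` would divide `(k + 1) + (l + 1)`, which is at most `2h < p`.
        opp : sgn (r k) ≡ - sgn (r l) → k ≡ l
        opp e₁ = ⊥-elim (ℕ.<⇒≱ (subst (suc k ℕ.+ suc l ℕ.<_) (sym odd) (s≤s (ℕ.+-mono-≤ k<h l<h))) (ℕ.∣⇒≤ (∣⇒∣ᵤ d₂)))
          where
          d₁ : a * + suc k ≈ a * - + suc l
          d₁ = ≈-trans (sj k k<h) (≈-trans (≡⇒≈ (trans (cong₂ (λ x y → x * + suc y) e₁ e) (l₁ (sgn (r l)) (+ suc (j l)))))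
                 (≈-trans (≈-* (≈-refl { -1ℤ}) (≈-sym (sj l l<h))) (≡⇒≈ (l₂ a (+ suc l)))))
            where
            l₁ : ∀ s x → - s * x ≡ -1ℤ * (s * x)
            l₁ = solve-∀
            l₂ : ∀ a x → -1ℤ * (a * x) ≡ a * - x
            l₂ = solve-∀
          d₂ : + p ∣ + (suc k ℕ.+ suc l)
          d₂ = subst (+ p ∣_) (cong (λ u → + suc k + u) (neg-involutive (+ suc l))) (div (cancel-a (+ suc k) (- + suc l) d₁))
        by : sgn (r k) ≡ 1ℤ ⊎ sgn (r k) ≡ -1ℤ → sgn (r l) ≡ 1ℤ ⊎ sgn (r l) ≡ -1ℤ → k ≡ l
        by (inj₁ x) (inj₁ y) = same 1ℤ x y
        by (inj₁ x) (inj₂ y) = opp (trans x (cong -_ (sym y)))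
        by (inj₂ x) (inj₁ y) = opp (trans x (cong -_ (sym y)))
        by (inj₂ x) (inj₂ y) = same -1ℤ x y

      gauss : ℤ
      gauss = ∏ h (λ k → sgn (r k))

      -- Multiply the congruences `sj` over all `k < h`: by `j-inj` the absolute values run through
      -- 1, ..., h again, so `h!` stands on both sides and cancels.
      gauss-lemma : a ^ h ≈ gauss
      gauss-lemma = pick (euclid prime (a ^ h - gauss) F (subst (+ p ∣_) (l (a ^ h) gauss F) (div d)))
        where
        l : ∀ x y F → x * F - y * F ≡ (x - y) * F
        l = solve-∀
        lhs : ∏ h (λ k → a * + suc k) ≡ a ^ h * F
        lhs = trans (∏-merge h (λ _ → a) (λ k → + suc k)) (cong (_* F) (∏-const h a))
        rhs : ∏ h (λ k → sgn (r k) * + suc (j k)) ≡ gauss * F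
        rhs = trans (∏-merge h (λ k → sgn (r k)) (λ k → + suc (j k)))
          (cong (gauss *_) (∏-perm h j (λ k → + suc k) (λ k k<h → red-< (r k) (r>0 k k<h) (r<p k)) j-inj))
        d : a ^ h * F ≈ gauss * F
        d = subst₂ _≈_ lhs rhs (≈-∏ h (λ k → a * + suc k) (λ k → sgn (r k) * + suc (j k)) sj)
        pick : (+ p ∣ a ^ h - gauss) ⊎ (+ p ∣ F) → a ^ h ≈ gauss
        pick (inj₁ e) = mod e
        pick (inj₂ e) = ⊥-elim (p∤∏ h ℕ.≤-refl e)

      ∏-±1 : ∀ n (f : ℕ → ℤ) → (∀ i → f i ≡ 1ℤ ⊎ f i ≡ -1ℤ) → ∏ n f ≡ 1ℤ ⊎ ∏ n f ≡ -1ℤ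
      ∏-±1 zero f h = inj₁ refl
      ∏-±1 (suc n) f h with ∏ n f | ∏-±1 n f h | f n | h n
      ... | _ | inj₁ refl | _ | inj₁ refl = inj₁ refl
      ... | _ | inj₁ refl | _ | inj₂ refl = inj₂ refl
      ... | _ | inj₂ refl | _ | inj₁ refl = inj₂ refl
      ... | _ | inj₂ refl | _ | inj₂ refl = inj₁ refl

      gauss-±1 : gauss ≡ 1ℤ ⊎ gauss ≡ -1ℤ
      gauss-±1 = ∏-±1 h _ (λ k → sgn-±1 (r k))

      gauss-tri : Tri gauss
      gauss-tri = ±1⇒tri gauss-±1

    opaque
      unfolding χ

      -- When neither test in the definition of `χ` succeeds, the power must be shown to be -1.
      -- Gauss's lemma gives that it is ±1, which takes the place of Fermat's little theorem.
      euler : ∀ a → a ^ h ≈ χ p a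
      euler a with + p ∣? a | + p ∣? (a ^ ⌊ p /2⌋ - 1ℤ)
      ... | yes d | _ = ≈0 (pow h h>0)
        where
        pow : ∀ n → 0 ℕ.< n → + p ∣ a ^ n
        pow (suc n) _ = ∣m⇒∣m*n (a ^ n) d
      ... | no nd | yes e = mod e
      ... | no nd | no ne = cases (gauss-±1 a nd) (gauss-lemma a nd)
        where
        cases : ∀ {g} → g ≡ 1ℤ ⊎ g ≡ -1ℤ → a ^ h ≈ g → a ^ h ≈ -1ℤ
        cases (inj₁ refl) (mod g) = ⊥-elim (ne g)
        cases (inj₂ refl) g = g

      χ-∣ : ∀ {a} → + p ∣ a → χ p a ≡ 0ℤ
      χ-∣ {a} d with + p ∣? a
      ... | yes _ = refl
      ... | no nd = ⊥-elim (nd d)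

    χ-unique : ∀ a {z} → Tri z → a ^ h ≈ z → χ p a ≡ z
    χ-unique a t e = tri-unique (χ-tri p a) t (≈-trans (≈-sym (euler a)) e)

    χ-gauss : ∀ a (nd : ¬ (+ p ∣ a)) → χ p a ≡ gauss a nd
    χ-gauss a nd = χ-unique a (gauss-tri a nd) (gauss-lemma a nd)

    χ-* : ∀ a b → χ p (a * b) ≡ χ p a * χ p b
    χ-* a b = χ-unique (a * b) (tri-* (χ-tri p a) (χ-tri p b)) (≈-trans (≡⇒≈ (^-distribˡ-* h a b)) (≈-* (euler a) (euler b)))

    χ-cong : ∀ {a b} → a ≈ b → χ p a ≡ χ p b
    χ-cong {a} {b} d = χ-unique a (χ-tri p b) (≈-trans (≈-^ h d) (euler b))

    χ-1 : χ p 1ℤ ≡ 1ℤ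
    χ-1 = χ-unique 1ℤ one (≡⇒≈ (one^ h))
      where
      one^ : ∀ n → 1ℤ ^ n ≡ 1ℤ
      one^ zero = refl
      one^ (suc n) = trans (*-identityˡ _) (one^ n)

    χ-∤ : ∀ {a} → ¬ (+ p ∣ a) → χ p a ≡ 1ℤ ⊎ χ p a ≡ -1ℤ
    χ-∤ {a} nd = subst (λ z → z ≡ 1ℤ ⊎ z ≡ -1ℤ) (sym (χ-gauss a nd)) (gauss-±1 a nd)

    χ-neg1 : χ p -1ℤ ≡ -1ℤ ^ h
    χ-neg1 = χ-unique -1ℤ (pw h) ≈-refl
      where
      pw : ∀ n → Tri (-1ℤ ^ n)
      pw zero = one
      pw (suc n) = tri-* min (pw n)

    χ-sq : ∀ x → ¬ (+ p ∣ x) → χ p (x * x) ≡ 1ℤ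
    χ-sq x nd = trans (χ-* x x) (sq {χ p x} (χ-∤ {x} nd))
      where
      sq : ∀ {z} → z ≡ 1ℤ ⊎ z ≡ -1ℤ → z * z ≡ 1ℤ
      sq (inj₁ refl) = refl
      sq (inj₂ refl) = refl

    private
      -- Xʰ - 1 would have more than h roots modulo p.
      too-many-roots : (ρ : ℕ → ℤ) → (∀ i → i ℕ.≤ h → χ p (ρ i) ≡ 1ℤ) → (∀ i j → i ℕ.≤ h → j ℕ.< i → ¬ (ρ j ≈ ρ i)) → ⊥
      too-many-roots ρ root dist = go h h>0 (λ i i≤h → subst (λ z → + p ∣ ρ i ^ h - z) (root i i≤h) (div (euler (ρ i)))) dist
        where
        go : ∀ n → 0 ℕ.< n → (∀ i → i ℕ.≤ n → + p ∣ ρ i ^ n - 1ℤ) → (∀ i j → i ℕ.≤ n → j ℕ.< i → ¬ (ρ j ≈ ρ i)) → ⊥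
        go (suc n) _ root dist = lagrange prime (suc n) (-1ℤ ∷ replicate n 0ℤ) ρ
          (λ i i≤ → subst (+ p ∣_) (trans (+-comm (ρ i ^ suc n) -1ℤ) (cong (λ u → -1ℤ + ρ i * u) (sym (eval-Xⁿ n (ρ i))))) (root i i≤)) (λ i j i≤ j< d → dist i j i≤ j< (mod d))

    -- Otherwise 1, ..., h + 1 would all be roots of `Xʰ - 1`.
    nonresidue : ∃[ g ] χ p (+ g) ≡ -1ℤ
    nonresidue = pick (search (λ i → χ p (+ suc i) ≟ -1ℤ) (suc h))
      where
      i<p : ∀ i → i ℕ.≤ h → suc i ℕ.< p
      i<p i i≤h = subst (suc i ℕ.<_) (sym odd) (s≤s (ℕ.≤-trans (s≤s i≤h) (ℕ.+-monoˡ-≤ h h>0)))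
      one-there : (∀ i → i ℕ.< suc h → ¬ (χ p (+ suc i) ≡ -1ℤ)) → ∀ i → i ℕ.≤ h → χ p (+ suc i) ≡ 1ℤ
      one-there none i i≤h = fst (χ-∤ {+ suc i} (λ d → ℕ.<⇒≱ (i<p i i≤h) (ℕ.∣⇒≤ (∣⇒∣ᵤ d))))
        where
        fst : χ p (+ suc i) ≡ 1ℤ ⊎ χ p (+ suc i) ≡ -1ℤ → χ p (+ suc i) ≡ 1ℤ
        fst (inj₁ e) = e
        fst (inj₂ e) = ⊥-elim (none i (s≤s i≤h) e)
      distinct : ∀ i j → i ℕ.≤ h → j ℕ.< i → ¬ (+ suc j ≈ + suc i)
      distinct i j i≤h j<i d = ℕ.<⇒≢ j<i (suc-inj j i (ℕ.<⇒≤ j<i) (ℕ.≤-<-trans i≤h h<p) d)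
      pick : (∃[ i ] i ℕ.< suc h × χ p (+ suc i) ≡ -1ℤ) ⊎ (∀ i → i ℕ.< suc h → ¬ (χ p (+ suc i) ≡ -1ℤ)) → ∃[ g ] χ p (+ g) ≡ -1ℤ
      pick (inj₁ (i , _ , e)) = suc i , e
      pick (inj₂ none) = ⊥-elim (too-many-roots (λ i → + suc i) (one-there none) distinct)

    -- The squares of 1, ..., h are `h` distinct roots of `Xʰ - 1`; if `a` were none of them, it
    -- would be one root too many.
    sqrt : ∀ a → χ p a ≡ 1ℤ → ∃[ x ] (x * x ≈ a)
    sqrt a e = pick (search (λ i → + p ∣? (+ suc i * + suc i - a)) h)
      where
      ρ : ℕ → ℤ
      ρ zero = a
      ρ (suc i) = + suc i * + suc i
      root : ∀ i → i ℕ.≤ h → χ p (ρ i) ≡ 1ℤ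
      root zero _ = e
      root (suc i) i<h = χ-sq (+ suc i) (p∤suc i i<h)
      distinct : (∀ i → i ℕ.< h → ¬ (+ p ∣ + suc i * + suc i - a)) → ∀ i j → i ℕ.≤ h → j ℕ.< i → ¬ (ρ j ≈ ρ i)
      distinct none (suc i) zero i<h _ d = none i i<h (div (≈-sym d))
      distinct none (suc i) (suc j) i<h (s≤s j<i) d =
        case (euclid prime (+ suc i - + suc j) (+ suc i + + suc j) (subst (+ p ∣_) (l (+ suc i) (+ suc j)) (div (≈-sym d))))
        where
        l : ∀ x y → x * x - y * y ≡ (x - y) * (x + y)
        l = solve-∀
        case : (+ p ∣ + suc i - + suc j) ⊎ (+ p ∣ + suc i + + suc j) → ⊥
        case (inj₁ d₁) = ℕ.<⇒≢ j<i (suc-inj j i (ℕ.<⇒≤ j<i) (ℕ.<-trans i<h h<p) (≈-sym (mod d₁)))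
        case (inj₂ d₂) = ℕ.<⇒≱ (subst (suc i ℕ.+ suc j ℕ.<_) (sym odd) (s≤s (ℕ.+-mono-≤ i<h (ℕ.<-trans j<i i<h)))) (ℕ.∣⇒≤ (∣⇒∣ᵤ d₂))
      pick : (∃[ i ] i ℕ.< h × (+ p ∣ + suc i * + suc i - a)) ⊎ (∀ i → i ℕ.< h → ¬ (+ p ∣ + suc i * + suc i - a)) → ∃[ x ] (x * x ≈ a)
      pick (inj₁ (i , _ , d)) = + suc i , mod d
      pick (inj₂ none) = ⊥-elim (too-many-roots ρ root (distinct none))

-- Quadratic reciprocity by counting lattice points

module QuadraticReciprocity where

  open LegendreSymbol
  open import Data.Nat as ℕ using (ℕ; suc; ⌊_/2⌋; z≤n; s≤s; _<_; _≤_; _+_; _*_; _∸_; _%_; _/_)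
  open import Data.Nat.Properties
  open import Data.Nat.DivMod using (m≡m%n+[m/n]*n; m%n<n)
  import Data.Nat.Divisibility as ℕ
  open import Data.Nat.Primality using (Prime; euclidsLemma; prime⇒nonZero; prime⇒irreducible; ¬prime[1])
  open import Data.Nat.Tactic.RingSolver using (solve-∀)
  open import Data.Integer as ℤ using (ℤ; +_; 1ℤ; -1ℤ)
  import Data.Integer.Properties as ℤ
  open import Data.Integer.DivMod using (_%ℕ_)
  open import Data.Integer.Divisibility.Signed using (∣⇒∣ᵤ)
  open import Relation.Binary using (tri<; tri≈; tri>) renaming (Tri to Tri<)

  ι : ∀ {P : Set} → Dec P → ℤ
  ι (yes _) = -1ℤ
  ι (no _) = 1ℤ

  ι-yes : ∀ {P : Set} (d : Dec P) → P → ι d ≡ -1ℤ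
  ι-yes (yes _) _ = refl
  ι-yes (no n) p = ⊥-elim (n p)

  ι-no : ∀ {P : Set} (d : Dec P) → ¬ P → ι d ≡ 1ℤ
  ι-no (yes p) n = ⊥-elim (n p)
  ι-no (no _) _ = refl

  ι-cong : ∀ {P Q : Set} (d : Dec P) (e : Dec Q) → (P → Q) → (Q → P) → ι d ≡ ι e
  ι-cong (yes p) e f g = sym (ι-yes e (f p))
  ι-cong (no n) e f g = sym (ι-no e (λ q → n (g q)))

  -- Used with `A = 2q(x + 1)` and `B = 2p(y + 1)`: the doubling replaces the half-width `p/2` of
  -- the strip along the diagonal by the integer `p`. `within` marks the strip, `beyond` the corner
  -- on its far side.
  within : ℕ → ℕ → ℕ → ℤ
  within A B c = ι (A <? B ×-dec B <? (A + c))

  beyond : ℕ → ℕ → ℕ → ℤ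
  beyond A B c = ι ((A + c) <? B)

  -- Two half-strips and two corners partition the lattice points, so exactly one of the four
  -- factors is -1. The hypotheses keep points off the boundary lines.
  quad : ∀ A B p q → A ≢ B → A + p ≢ B → B + q ≢ A →
         (within A B p ℤ.* within B A q) ℤ.* (beyond A B p ℤ.* beyond B A q) ≡ -1ℤ
  quad A B p q A≢B A+p≢B B+q≢A with <-cmp A B
  ... | tri≈ _ e _ = ⊥-elim (A≢B e)
  ... | tri< A<B _ B≮A with B <? (A + p)
  ... | yes r = cong₂ ℤ._*_ (cong₂ ℤ._*_ (ι-yes (A <? B ×-dec yes r) (A<B , r)) (ι-no (B <? A ×-dec A <? (B + q)) (λ h → B≮A (proj₁ h))))
                            (cong₂ ℤ._*_ (ι-no ((A + p) <? B) (<-asym r)) (ι-no ((B + q) <? A) (λ h → B≮A (≤-<-trans (m≤m+n B q) h))))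
  ... | no r = cong₂ ℤ._*_ (cong₂ ℤ._*_ (ι-no (A <? B ×-dec no r) (λ h → r (proj₂ h))) (ι-no (B <? A ×-dec A <? (B + q)) (λ h → B≮A (proj₁ h))))
                            (cong₂ ℤ._*_ (ι-yes ((A + p) <? B) (≤∧≢⇒< (≮⇒≥ r) A+p≢B)) (ι-no ((B + q) <? A) (λ h → B≮A (≤-<-trans (m≤m+n B q) h))))
  quad A B p q A≢B A+p≢B B+q≢A | tri> A≮B _ B<A with A <? (B + q)
  ... | yes r = cong₂ ℤ._*_ (cong₂ ℤ._*_ (ι-no (A <? B ×-dec B <? (A + p)) (λ h → A≮B (proj₁ h))) (ι-yes (B <? A ×-dec yes r) (B<A , r)))
                            (cong₂ ℤ._*_ (ι-no ((A + p) <? B) (λ h → A≮B (≤-<-trans (m≤m+n A p) h))) (ι-no ((B + q) <? A) (<-asym r)))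
  ... | no r = cong₂ ℤ._*_ (cong₂ ℤ._*_ (ι-no (A <? B ×-dec B <? (A + p)) (λ h → A≮B (proj₁ h))) (ι-no (B <? A ×-dec no r) (λ h → r (proj₂ h))))
                            (cong₂ ℤ._*_ (ι-no ((A + p) <? B) (λ h → A≮B (≤-<-trans (m≤m+n A p) h))) (ι-yes ((B + q) <? A) (≤∧≢⇒< (≮⇒≥ r) B+q≢A)))

  -- Gauss's sign of q(x+1) modulo p, read off from the lattice points (x+1, y+1) close to the diagonal.
  module Row {p q : ℕ} (op : OddPrime p) (oq : OddPrime q) (x : ℕ) (x<h : x < ⌊ p /2⌋) where
    module P = Symbol op
    open OddPrime op using (prime) renaming (odd to p-odd)
    open OddPrime oq using () renaming (odd to q-odd)
    private
      instance
        p-nz : ℕ.NonZero p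
        p-nz = prime⇒nonZero prime
      h = ⌊ p /2⌋
      h′ = ⌊ q /2⌋
      N = q * suc x
      r = N % p
      Q = N / p
      A = 2 * N
      N≡ : N ≡ r + Q * p
      N≡ = m≡m%n+[m/n]*n N p
      r<p : r < p
      r<p = m%n<n N p
      Qp≤N : Q * p ≤ N
      Qp≤N = subst (Q * p ≤_) (sym N≡) (m≤n+m (Q * p) r)

      B : ℕ → ℕ
      B y = 2 * (p * suc y)

      below : ∀ y → y < Q → ¬ (A < B y)
      below y y<Q = ≤⇒≯ (*-monoʳ-≤ 2 (≤-trans (≤-trans (*-monoʳ-≤ p y<Q) (≤-reflexive (*-comm p Q))) Qp≤N))

      A≡ : A ≡ 2 * r + 2 * (p * Q)
      A≡ = trans (cong (2 *_) N≡) (l r Q p)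
        where l : ∀ r Q p → 2 * (r + Q * p) ≡ 2 * r + 2 * (p * Q)
              l = solve-∀

      above : ∀ y → Q < y → ¬ (B y < A + p)
      above y Q<y = ≤⇒≯ (begin
        A + p                     ≡⟨ cong (_+ p) A≡ ⟩
        2 * r + 2 * (p * Q) + p   ≤⟨ +-monoˡ-≤ p (+-monoˡ-≤ (2 * (p * Q)) (*-monoʳ-≤ 2 (<⇒≤ r<p))) ⟩
        2 * p + 2 * (p * Q) + p   ≤⟨ m≤m+n _ p ⟩
        2 * p + 2 * (p * Q) + p + p ≡⟨ l p Q ⟩
        2 * (p * suc (suc Q))     ≤⟨ *-monoʳ-≤ 2 (*-monoʳ-≤ p (s≤s Q<y)) ⟩
        B y ∎)
        where
        open ≤-Reasoning
        l : ∀ p Q → 2 * p + 2 * (p * Q) + p + p ≡ 2 * (p * suc (suc Q))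
        l = solve-∀

      low : r ≤ h → ¬ (B Q < A + p)
      low r≤h = ≤⇒≯ (begin
        A + p                     ≡⟨ cong (_+ p) A≡ ⟩
        2 * r + 2 * (p * Q) + p   ≤⟨ +-monoˡ-≤ p (+-monoˡ-≤ (2 * (p * Q)) 2r≤p) ⟩
        p + 2 * (p * Q) + p       ≡⟨ l p Q ⟩
        B Q ∎)
        where
        open ≤-Reasoning
        l : ∀ p Q → p + 2 * (p * Q) + p ≡ 2 * (p * suc Q)
        l = solve-∀
        2r≤p : 2 * r ≤ p
        2r≤p = ≤-trans (*-monoʳ-≤ 2 r≤h) (subst (2 * h ≤_) (sym p-odd) (m≤n⇒m≤1+n (≤-reflexive (cong (λ u → h + u) (+-identityʳ h)))))

      module High (r>h : h < r) where
        p<2r : p < 2 * r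
        p<2r = subst (_< 2 * r) (sym p-odd) (≤-trans (≤-reflexive (l h)) (*-monoʳ-≤ 2 r>h))
          where l : ∀ h → suc (suc (h + h)) ≡ 2 * suc h
                l = solve-∀

        A<BQ : A < B Q
        A<BQ = *-monoʳ-< 2 (subst₂ _<_ (sym N≡) (l p Q) (+-monoˡ-< (Q * p) r<p))
          where l : ∀ p Q → p + Q * p ≡ p * suc Q
                l = solve-∀

        BQ<A+p : B Q < A + p
        BQ<A+p = subst₂ _<_ (l p Q) (cong (_+ p) (sym A≡)) (+-monoˡ-< p (+-monoˡ-< (2 * (p * Q)) p<2r))
          where l : ∀ p Q → p + 2 * (p * Q) + p ≡ 2 * (p * suc Q)
                l = solve-∀

        -- `p(2Q + 1) < 2r + 2pQ = 2N ≤ 2qh < pq`, hence `2Q + 1 < q`: the column that carries the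
        -- sign is inside the range of the product.
        Q<h′ : Q < h′
        Q<h′ = ≰⇒> λ h′≤Q → <⇒≱ (begin-strict
          p * (2 * Q + 1)         ≡⟨ l₁ p Q ⟩
          p + 2 * (p * Q)         <⟨ +-monoˡ-< (2 * (p * Q)) p<2r ⟩
          2 * r + 2 * (p * Q)     ≡⟨ sym A≡ ⟩
          2 * N                   ≤⟨ *-monoʳ-≤ 2 (*-monoʳ-≤ q x<h) ⟩
          2 * (q * h)             ≡⟨ l₂ q h ⟩
          (h + h) * q             ≤⟨ *-monoˡ-≤ q (n≤1+n (h + h)) ⟩
          suc (h + h) * q         ≡⟨ cong (_* q) (sym p-odd) ⟩
          p * q                   ∎) (*-monoʳ-≤ p (begin
          q                       ≡⟨ q-odd ⟩
          suc (h′ + h′)           ≤⟨ s≤s (+-mono-≤ h′≤Q h′≤Q) ⟩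
          suc (Q + Q)             ≡⟨ l₃ Q ⟩
          2 * Q + 1               ∎))
          where
          open ≤-Reasoning
          l₁ : ∀ p Q → p * (2 * Q + 1) ≡ p + 2 * (p * Q)
          l₁ = solve-∀
          l₂ : ∀ q h → 2 * (q * h) ≡ (h + h) * q
          l₂ = solve-∀
          l₃ : ∀ Q → suc (Q + Q) ≡ 2 * Q + 1
          l₃ = solve-∀

    -- Only `y = Q`, the quotient of `q(x + 1)` by `p`, can lie in the strip, and it does so exactly
    -- when the remainder exceeds `p/2`, that is when Gauss's sign is -1.
    row : P.sgn (q * suc x % p) ≡ ∏ ⌊ q /2⌋ (λ y → within (2 * (q * suc x)) (2 * (p * suc y)) p)
    row with r ≤? h
    ... | yes r≤h = sym (trans (∏-cong h′ (λ y _ → none y)) (∏-1 h′))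
      where
      none : ∀ y → within A (B y) p ≡ 1ℤ
      none y = ι-no (A <? B y ×-dec B y <? (A + p)) (λ (u , v) → case y u v (<-cmp y Q))
        where
        case : ∀ y → A < B y → B y < A + p → Tri< (y < Q) (y ≡ Q) (Q < y) → ⊥
        case y u v (tri< y<Q _ _) = below y y<Q u
        case .Q u v (tri≈ _ refl _) = low r≤h v
        case y u v (tri> _ _ Q<y) = above y Q<y v
    ... | no r≰h = sym (trans (∏-single h′ Q (λ y → within A (B y) p) Q<h′ other)
                         (ι-yes (A <? B Q ×-dec B Q <? (A + p)) (A<BQ , BQ<A+p)))
      where
      open High (≰⇒> r≰h)
      other : ∀ y → y < h′ → y ≢ Q → within A (B y) p ≡ 1ℤ
      other y _ y≢Q = ι-no (A <? B y ×-dec B y <? (A + p)) (λ (u , v) → case u v (<-cmp y Q))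
        where
        case : A < B y → B y < A + p → Tri< (y < Q) (y ≡ Q) (Q < y) → ⊥
        case u v (tri< y<Q _ _) = below y y<Q u
        case u v (tri≈ _ e _) = y≢Q e
        case u v (tri> _ _ Q<y) = above y Q<y v

  prime∤prime : ∀ {p q} → Prime p → Prime q → p ≢ q → ¬ (p ℕ.∣ q)
  prime∤prime pp pq ne d with prime⇒irreducible pq d
  ... | inj₁ refl = ¬prime[1] pp
  ... | inj₂ e = ne e

  rev : ℕ → ℕ → ℕ
  rev n i = n ∸ suc i

  rev-+ : ∀ {n i} → i < n → suc i + suc (rev n i) ≡ suc n
  rev-+ {n} {i} p = trans (+-suc (suc i) (rev n i)) (cong suc (m+[n∸m]≡n p))

  rev-< : ∀ n i → i < n → rev n i < n
  rev-< n i p = ∸-monoʳ-< {n} (s≤s z≤n) p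

  rev-inj : ∀ n i j → i < n → j < n → rev n i ≡ rev n j → i ≡ j
  rev-inj n i j p q e = suc-injective (∸-cancelˡ-≡ p q e)

  module Reciprocity {p q : ℕ} (op : OddPrime p) (oq : OddPrime q) (p≢q : p ≢ q) where
    private
      module P = Symbol op
      module Q = Symbol oq
      pp = OddPrime.prime op
      pq = OddPrime.prime oq
      h = ⌊ p /2⌋
      h′ = ⌊ q /2⌋
      A B : ℕ → ℕ
      A x = 2 * (q * suc x)
      B y = 2 * (p * suc y)
      p∤q : ¬ (+ p Data.Integer.Divisibility.Signed.∣ + q)
      p∤q d = prime∤prime pp pq p≢q (∣⇒∣ᵤ d)
      q∤p : ¬ (+ q Data.Integer.Divisibility.Signed.∣ + p)
      q∤p d = prime∤prime pq pp (≢-sym p≢q) (∣⇒∣ᵤ d)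
      instance
        p-nz : ℕ.NonZero p
        p-nz = prime⇒nonZero pp
        q-nz : ℕ.NonZero q
        q-nz = prime⇒nonZero pq

      χpq : χ p (+ q) ≡ ∏ h (λ x → ∏ h′ (λ y → within (A x) (B y) p))
      χpq = trans (P.χ-gauss (+ q) p∤q) (∏-cong h (λ x x<h →
        trans (cong (λ z → P.sgn (z %ℕ p)) (sym (ℤ.pos-* q (suc x)))) (Row.row op oq x x<h)))

      χqp : χ q (+ p) ≡ ∏ h (λ x → ∏ h′ (λ y → within (B y) (A x) q))
      χqp = trans (Q.χ-gauss (+ p) q∤p) (trans (∏-cong h′ (λ y y<h →
        trans (cong (λ z → Q.sgn (z %ℕ q)) (sym (ℤ.pos-* p (suc y)))) (Row.row oq op y y<h)))
        (∏-swap h′ h (λ y x → within (B y) (A x) q)))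

      odd-even : ∀ {n} → OddPrime n → ∀ u v → 2 * u + n ≢ 2 * v
      odd-even {n} on u v e = even≢odd v (u + ⌊ n /2⌋) (trans (sym e) (trans (cong (λ z → 2 * u + z) (OddPrime.odd on)) (l u ⌊ n /2⌋)))
        where l : ∀ u k → 2 * u + suc (k + k) ≡ suc (2 * (u + k))
              l = solve-∀

      A≢B : ∀ x y → x < h → A x ≢ B y
      A≢B x y x<h e with euclidsLemma q (suc x) pp (ℕ.divides (suc y) (trans (*-cancelˡ-≡ _ _ 2 e) (*-comm p (suc y))))
      ... | inj₁ d = prime∤prime pp pq p≢q d
      ... | inj₂ d = <⇒≱ (≤-<-trans x<h P.h<p) (ℕ.∣⇒≤ d)

      U V : ℕ → ℕ → ℤ
      U x y = beyond (A x) (B y) p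
      V x y = beyond (B y) (A x) q

      sumA : ∀ x → x < h → A x + A (rev h x) ≡ p * q + q
      sumA x x<h = trans (l₁ q (suc x) (suc (rev h x))) (trans (cong (λ u → 2 * (q * u)) (rev-+ x<h))
                     (trans (l₂ q h) (cong (λ u → u * q + q) (sym (OddPrime.odd op)))))
        where
        l₁ : ∀ q a b → 2 * (q * a) + 2 * (q * b) ≡ 2 * (q * (a + b))
        l₁ = solve-∀
        l₂ : ∀ q h → 2 * (q * suc h) ≡ suc (h + h) * q + q
        l₂ = solve-∀

      sumB : ∀ y → y < h′ → B y + B (rev h′ y) ≡ p * q + p
      sumB y y<h = trans (l₁ p (suc y) (suc (rev h′ y))) (trans (cong (λ u → 2 * (p * u)) (rev-+ y<h))
                     (trans (l₂ p h′) (cong (λ u → p * u + p) (sym (OddPrime.odd oq)))))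
        where
        l₁ : ∀ q a b → 2 * (q * a) + 2 * (q * b) ≡ 2 * (q * (a + b))
        l₁ = solve-∀
        l₂ : ∀ p h → 2 * (p * suc h) ≡ p * suc (h + h) + p
        l₂ = solve-∀

      reflect : ∀ a a′ b b′ → a + a′ ≡ p * q + q → b + b′ ≡ p * q + p → b + q < a → a′ + p < b′
      reflect a a′ b b′ e₁ e₂ lt = +-cancelˡ-< a (a′ + p) b′ (begin-strict
        a + (a′ + p)      ≡⟨ sym (+-assoc a a′ p) ⟩
        a + a′ + p        ≡⟨ cong (_+ p) e₁ ⟩
        p * q + q + p     ≡⟨ l (p * q) q p ⟩
        p * q + p + q     ≡⟨ cong (_+ q) (sym e₂) ⟩
        b + b′ + q        ≡⟨ l b b′ q ⟩
        b + q + b′        <⟨ +-monoˡ-< b′ lt ⟩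
        a + b′            ∎)
        where
        open ≤-Reasoning
        l : ∀ x y z → x + y + z ≡ x + z + y
        l = solve-∀

      reflect⁻ : ∀ a a′ b b′ → a + a′ ≡ p * q + q → b + b′ ≡ p * q + p → a′ + p < b′ → b + q < a
      reflect⁻ a a′ b b′ e₁ e₂ lt = +-cancelˡ-< b′ (b + q) a (begin-strict
        b′ + (b + q)      ≡⟨ l₁ b′ b q ⟩
        b + b′ + q        ≡⟨ cong (_+ q) e₂ ⟩
        p * q + p + q     ≡⟨ l (p * q) p q ⟩
        p * q + q + p     ≡⟨ cong (_+ p) (sym e₁) ⟩
        a + a′ + p        ≡⟨ l₂ a a′ p ⟩
        a′ + p + a        <⟨ +-monoˡ-< a lt ⟩
        b′ + a            ∎)
        where
        open ≤-Reasoning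
        l : ∀ x y z → x + y + z ≡ x + z + y
        l = solve-∀
        l₁ : ∀ x y z → x + (y + z) ≡ y + x + z
        l₁ = solve-∀
        l₂ : ∀ x y z → x + y + z ≡ y + z + x
        l₂ = solve-∀

      -- The central symmetry of the rectangle takes `A` to `pq + q - A` and `B` to `pq + p - B`,
      -- and so exchanges the two corners.
      V≡U : ∀ x y → x < h → y < h′ → V x y ≡ U (rev h x) (rev h′ y)
      V≡U x y x<h y<h′ = ι-cong ((B y + q) <? A x) ((A (rev h x) + p) <? B (rev h′ y))
        (reflect (A x) (A (rev h x)) (B y) (B (rev h′ y)) (sumA x x<h) (sumB y y<h′))
        (reflect⁻ (A x) (A (rev h x)) (B y) (B (rev h′ y)) (sumA x x<h) (sumB y y<h′))

      ∏∏ : (ℕ → ℕ → ℤ) → ℤ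
      ∏∏ f = ∏ h (λ x → ∏ h′ (f x))

      ∏∏-cong : ∀ f g → (∀ x y → x < h → y < h′ → f x y ≡ g x y) → ∏∏ f ≡ ∏∏ g
      ∏∏-cong f g e = ∏-cong h (λ x x<h → ∏-cong h′ (λ y y<h → e x y x<h y<h))

      ∏∏-merge : ∀ f g → ∏∏ (λ x y → f x y ℤ.* g x y) ≡ ∏∏ f ℤ.* ∏∏ g
      ∏∏-merge f g = trans (∏-cong h (λ x _ → ∏-merge h′ (f x) (g x))) (∏-merge h (λ x → ∏ h′ (f x)) (λ x → ∏ h′ (g x)))

      ∏∏V≡∏∏U : ∏∏ V ≡ ∏∏ U
      ∏∏V≡∏∏U = trans (∏∏-cong V (λ x y → U (rev h x) (rev h′ y)) V≡U)
        (trans (∏-cong h (λ x _ → ∏-perm h′ (rev h′) (U (rev h x)) (rev-< h′) (rev-inj h′)))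
               (∏-perm h (rev h) (λ x → ∏ h′ (U x)) (rev-< h) (rev-inj h)))

      ι-sq : ∀ {P : Set} (d : Dec P) → ι d ℤ.* ι d ≡ 1ℤ
      ι-sq (yes _) = refl
      ι-sq (no _) = refl

      ∏∏UV : ∏∏ (λ x y → U x y ℤ.* V x y) ≡ 1ℤ
      ∏∏UV = trans (∏∏-merge U V) (trans (cong (∏∏ U ℤ.*_) ∏∏V≡∏∏U) (trans (sym (∏∏-merge U U))
        (trans (∏∏-cong (λ x y → U x y ℤ.* U x y) (λ _ _ → 1ℤ) (λ x y _ _ → ι-sq ((A x + p) <? B y)))
          (trans (∏-cong h (λ _ _ → ∏-1 h′)) (∏-1 h)))))

      E₁ E₂ : ℕ → ℕ → ℤ
      E₁ x y = within (A x) (B y) p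
      E₂ x y = within (B y) (A x) q

    -- By `row` the left side is the product of signs over both half-strips. The corners contribute
    -- 1, since by symmetry they contain equally many points, so multiplying them in changes
    -- nothing; then `quad` makes every one of the `h·h′` points count -1.
    reciprocity : χ p (+ q) ℤ.* χ q (+ p) ≡ (-1ℤ ℤ.^ ⌊ q /2⌋) ℤ.^ ⌊ p /2⌋
    reciprocity = trans (cong₂ ℤ._*_ χpq χqp) (trans (sym (∏∏-merge E₁ E₂))
      (trans (sym (ℤ.*-identityʳ _)) (trans (cong (∏∏ (λ x y → E₁ x y ℤ.* E₂ x y) ℤ.*_) (sym ∏∏UV))
      (trans (sym (∏∏-merge (λ x y → E₁ x y ℤ.* E₂ x y) (λ x y → U x y ℤ.* V x y)))
      (trans (∏∏-cong _ (λ _ _ → -1ℤ) (λ x y x<h y<h → quad (A x) (B y) p q (A≢B x y x<h)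
                (odd-even op (q * suc x) (p * suc y)) (odd-even oq (p * suc y) (q * suc x))))
      (trans (∏-cong h (λ _ _ → ∏-const h′ -1ℤ)) (∏-const h (-1ℤ ℤ.^ h′))))))))

-- Real Dirichlet characters

module Characters where

  open Folds
  open LegendreSymbol
  open import Data.Nat as ℕ using (ℕ; zero; suc; z≤n; s≤s)
  import Data.Nat.Properties as ℕ
  import Data.Nat.Divisibility as ℕ
  open import Data.Nat.DivMod using (m≡m%n+[m/n]*n; m%n<n; _%_; _/_)
  open import Data.Nat.Coprimality using (Coprime; coprime-Bézout; coprime-divisor) renaming (sym to coprime-sym)
  open import Data.Nat.GCD using (module Bézout)
  open import Data.Nat.Primality using (Prime; prime⇒irreducible)
  open import Data.Nat.Tactic.RingSolver renaming (solve-∀ to ℕ-solve-∀)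
  open import Data.Integer using (ℤ; +_; 0ℤ; 1ℤ; -1ℤ; _+_; _-_; _*_; -_; ∣_∣)
  open import Data.Integer.Properties
  open import Data.Integer.Divisibility.Signed using (_∣_; divides; ∣ᵤ⇒∣)
  open import Data.Integer.Tactic.RingSolver using (solve-∀)

  module Sum = BigOp +-0-isCommutativeMonoid
  open Sum public using () renaming
    (fold to ∑; fold-cong to ∑-cong; fold-ε to ∑-0; fold-merge to ∑-+; fold-swap to ∑-swap; fold-single to ∑-single; fold-perm to ∑-perm; fold-+ to ∑-split)

  ∑-scale : ∀ n c (f : ℕ → ℤ) → ∑ n (λ i → c * f i) ≡ c * ∑ n f
  ∑-scale zero c f = sym (*-zeroʳ c)
  ∑-scale (suc n) c f = trans (cong (_+ c * f n) (∑-scale n c f)) (sym (*-distribˡ-+ c (∑ n f) (f n)))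

  ∑-bound : ∀ n C (f : ℕ → ℤ) → (∀ i → i ℕ.< n → ∣ f i ∣ ℕ.≤ C) → ∣ ∑ n f ∣ ℕ.≤ n ℕ.* C
  ∑-bound zero C f h = z≤n
  ∑-bound (suc n) C f h = ℕ.≤-trans (∣i+j∣≤∣i∣+∣j∣ (∑ n f) (f n))
    (ℕ.≤-trans (ℕ.+-mono-≤ (∑-bound n C f (λ i p → h i (ℕ.m<n⇒m<1+n p))) (h n ℕ.≤-refl)) (ℕ.≤-reflexive (ℕ.+-comm (n ℕ.* C) C)))

  ∣tri∣≤1 : ∀ {z} → Tri z → ∣ z ∣ ℕ.≤ 1
  ∣tri∣≤1 zer = z≤n
  ∣tri∣≤1 one = ℕ.≤-refl
  ∣tri∣≤1 min = ℕ.≤-refl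

  infixl 7 _⊙_
  _⊙_ : (ℕ → ℤ) → (ℕ → ℤ) → ℕ → ℤ
  (α ⊙ β) x = α x * β x

  -- A real character modulo `M`, principal ones such as `odd` and `χ²` included. `support` is
  -- stated as an implication towards coprimality, the direction in which nonzero values give
  -- invertible residues.
  record Char (M : ℕ) (α : ℕ → ℤ) : Set where
    field
      mult : ∀ x y → α (x ℕ.* y) ≡ α x * α y
      per : ∀ x → α (x ℕ.+ M) ≡ α x
      tri : ∀ x → Tri (α x)
      unit : α 1 ≡ 1ℤ
      support : ∀ x → α x ≢ 0ℤ → Coprime x M

    periodic : ∀ x k → α (x ℕ.+ k ℕ.* M) ≡ α x
    periodic x zero = cong α (ℕ.+-identityʳ x)
    periodic x (suc k) = trans (cong α (l x M (k ℕ.* M))) (trans (per (x ℕ.+ k ℕ.* M)) (periodic x k))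
      where l : ∀ x M K → x ℕ.+ (M ℕ.+ K) ≡ x ℕ.+ K ℕ.+ M
            l = ℕ-solve-∀

  -- For values in {0, 1, -1} being nonprincipal amounts to taking the value -1; the witness is what
  -- `period-sum` works with.
  NonPrincipal : (ℕ → ℤ) → Set
  NonPrincipal α = ∃[ g ] α g ≡ -1ℤ

  coprime-* : ∀ {x M N} → Coprime x M → Coprime x N → Coprime x (M ℕ.* N)
  coprime-* {x} {M} {N} c c′ {d} (d∣x , d∣MN) =
    c′ (d∣x , coprime-divisor {d} {M} {N} (λ { {e} (e∣d , e∣M) → c (ℕ.∣-trans e∣d d∣x , e∣M) }) d∣MN)

  prime∤⇒coprime : ∀ {p x} → Prime p → ¬ (p ℕ.∣ x) → Coprime x p
  prime∤⇒coprime pp nd (d∣x , d∣p) with prime⇒irreducible pp d∣p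
  ... | inj₁ e = e
  ... | inj₂ refl = ⊥-elim (nd d∣x)

  odd : ℕ → ℤ
  odd 0 = 0ℤ
  odd 1 = 1ℤ
  odd (suc (suc n)) = odd n

  odd-+ : ∀ x y → odd y ≡ 0ℤ → odd (y ℕ.+ x) ≡ odd x
  odd-+ x 0 _ = refl
  odd-+ x (suc (suc y)) e = odd-+ x y e

  odd-2* : ∀ x → odd (x ℕ.+ x) ≡ 0ℤ
  odd-2* zero = refl
  odd-2* (suc x) = trans (cong odd (cong suc (ℕ.+-suc x x))) (odd-2* x)

  odd-char : Char 2 odd
  odd-char = record { mult = mult ; per = λ x → cong odd (ℕ.+-comm x 2) ; tri = tri ; unit = refl ; support = supp }
    where
    mult : ∀ x y → odd (x ℕ.* y) ≡ odd x * odd y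
    mult 0 y = refl
    mult 1 y = trans (cong odd (ℕ.+-identityʳ y)) (sym (*-identityˡ (odd y)))
    mult (suc (suc x)) y = trans (cong odd (sym (ℕ.+-assoc y y (x ℕ.* y)))) (trans (odd-+ (x ℕ.* y) (y ℕ.+ y) (odd-2* y)) (mult x y))
    tri : ∀ x → Tri (odd x)
    tri 0 = zer
    tri 1 = one
    tri (suc (suc x)) = tri x
    even : ∀ x → 2 ℕ.∣ x → odd x ≡ 0ℤ
    even x (ℕ.divides q refl) = trans (cong odd (trans (ℕ.*-comm q 2) (cong (q ℕ.+_) (ℕ.+-identityʳ q)))) (odd-2* q)
    supp : ∀ x → odd x ≢ 0ℤ → Coprime x 2
    supp x nz {d} (d∣x , d∣2) = go d (ℕ.∣⇒≤ d∣2) d∣x d∣2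
      where
      go : ∀ d → d ℕ.≤ 2 → d ℕ.∣ x → d ℕ.∣ 2 → d ≡ 1
      go 0 _ _ d∣2 = ⊥-elim (ℕ.1+n≢0 (ℕ.0∣⇒≡0 d∣2))
      go 1 _ _ _ = refl
      go 2 _ d∣x _ = ⊥-elim (nz (even x d∣x))
      go (suc (suc (suc d))) (s≤s (s≤s ())) _ _

  χℕ : ℕ → ℕ → ℤ
  χℕ p x = χ p (+ x)

  χ² : ℕ → ℕ → ℤ
  χ² p x = χℕ p x * χℕ p x

  module _ {p : ℕ} (op : OddPrime p) where
    open Symbol op
    open Mod (+ p)
    χ-char : Char p (χℕ p)
    χ-char = record
      { mult = λ x y → trans (cong (χ p) (pos-* x y)) (χ-* (+ x) (+ y))
      ; per = λ x → χ-cong (mod (divides 1ℤ (l (+ x) (+ p))))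
      ; tri = λ x → χ-tri p (+ x) ; unit = χ-1
      ; support = λ x nz → prime∤⇒coprime (OddPrime.prime op) (λ d → nz (χ-∣ (∣ᵤ⇒∣ d))) }
      where
      l : ∀ x p → x + p - x ≡ 1ℤ * p
      l = solve-∀

    χ²-char : Char p (χ² p)
    χ²-char = record
      { mult = λ x y → trans (cong₂ _*_ (mult x y) (mult x y)) (l (χℕ p x) (χℕ p y))
      ; per = λ x → cong₂ _*_ (per x) (per x)
      ; tri = λ x → tri-* (tri x) (tri x) ; unit = cong₂ _*_ unit unit
      ; support = λ x nz → support x (λ e → nz (trans (cong (_* χℕ p x) e) refl)) }
      where
      open Char χ-char
      l : ∀ x y → x * y * (x * y) ≡ x * x * (y * y)
      l = solve-∀

  ⊙-char : ∀ {M N α β} → Char M α → Char N β → Char (M ℕ.* N) (α ⊙ β)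
  ⊙-char {M} {N} {α} {β} A B = record
    { mult = λ x y → trans (cong₂ _*_ (A.mult x y) (B.mult x y)) (l (α x) (α y) (β x) (β y))
    ; per = λ x → cong₂ _*_ (trans (cong (λ u → α (x ℕ.+ u)) (ℕ.*-comm M N)) (A.periodic x N)) (B.periodic x M)
    ; tri = λ x → tri-* (A.tri x) (B.tri x) ; unit = cong₂ _*_ A.unit B.unit
    ; support = λ x nz → coprime-* (A.support x (λ e → nz (cong (_* β x) e)))
                                   (B.support x (λ e → nz (trans (cong (α x *_) e) (*-zeroʳ (α x))))) }
    where
    module A = Char A
    module B = Char B
    l : ∀ a b c d → a * b * (c * d) ≡ a * c * (b * d)
    l = solve-∀

  inverse-mod : ∀ {M N} → .{{ℕ.NonZero M}} → Coprime M N → ∃[ u ] ∃[ y ] u ℕ.* M ≡ 1 ℕ.+ y ℕ.* N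
  inverse-mod {M} {N} c with coprime-Bézout c
  ... | Bézout.+- x y eq = x , y , sym eq
  ... | Bézout.-+ x y eq = go (x ℕ.* M) refl
    where
    open ≡-Reasoning
    sq : ∀ s → suc s ℕ.* suc s ≡ 1 ℕ.+ s ℕ.* (1 ℕ.+ suc s)
    sq = ℕ-solve-∀
    -- t = xM ≡ -1, so t² ≡ 1.
    go : ∀ t → x ℕ.* M ≡ t → ∃[ u ] ∃[ z ] u ℕ.* M ≡ 1 ℕ.+ z ℕ.* N
    go zero e = 1 , ℕ.pred M , (begin
      1 ℕ.* M                 ≡⟨ ℕ.*-identityˡ M ⟩
      M                       ≡⟨ sym (ℕ.suc-pred M) ⟩
      suc (ℕ.pred M)          ≡⟨ cong suc (sym (ℕ.*-identityʳ (ℕ.pred M))) ⟩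
      1 ℕ.+ ℕ.pred M ℕ.* 1    ≡⟨ cong (λ n → 1 ℕ.+ ℕ.pred M ℕ.* n) (sym N≡1) ⟩
      1 ℕ.+ ℕ.pred M ℕ.* N    ∎)
      where
      N≡1 : N ≡ 1
      N≡1 = ℕ.∣1⇒≡1 (ℕ.divides y (trans (cong suc (sym e)) eq))
    go (suc t) e = x ℕ.* M ℕ.* x , t ℕ.* y , (begin
      x ℕ.* M ℕ.* x ℕ.* M     ≡⟨ ℕ.*-assoc (x ℕ.* M) x M ⟩
      x ℕ.* M ℕ.* (x ℕ.* M)   ≡⟨ cong₂ ℕ._*_ e e ⟩
      suc t ℕ.* suc t         ≡⟨ sq t ⟩
      1 ℕ.+ t ℕ.* (1 ℕ.+ suc t)  ≡⟨ cong (λ u → 1 ℕ.+ t ℕ.* (1 ℕ.+ u)) (sym e) ⟩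
      1 ℕ.+ t ℕ.* (1 ℕ.+ x ℕ.* M)  ≡⟨ cong (λ u → 1 ℕ.+ t ℕ.* u) eq ⟩
      1 ℕ.+ t ℕ.* (y ℕ.* N)   ≡⟨ cong suc (sym (ℕ.*-assoc t y N)) ⟩
      1 ℕ.+ t ℕ.* y ℕ.* N     ∎)

  crt : ∀ {M N} → .{{ℕ.NonZero M}} → .{{ℕ.NonZero N}} → Coprime M N → ∀ a b → ∃[ g ] (∃[ k ] g ≡ a ℕ.+ k ℕ.* M) × (∃[ l ] g ≡ b ℕ.+ l ℕ.* N)
  crt {M} {suc n} c a b with inverse-mod c
  ... | u , y , eq = a ℕ.+ w ℕ.* u ℕ.* M , (w ℕ.* u , refl) , (a ℕ.+ y ℕ.* w , trans (cong (a ℕ.+_) (trans (ℕ.*-assoc w u M) (cong (w ℕ.*_) eq))) (l a b n y))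
    where
    -- `n` is -1 modulo `suc n`, so `w` stands for `b - a` without a subtraction.
    w = b ℕ.+ n ℕ.* a
    l : ∀ a b n y → a ℕ.+ (b ℕ.+ n ℕ.* a) ℕ.* (1 ℕ.+ y ℕ.* (1 ℕ.+ n)) ≡ b ℕ.+ (a ℕ.+ y ℕ.* (b ℕ.+ n ℕ.* a)) ℕ.* (1 ℕ.+ n)
    l = ℕ-solve-∀

  -- By the Chinese remainder theorem the two factors take their values independently; with one
  -- argument equal to 1, a product is nonprincipal as soon as one factor is.
  ⊙-attains : ∀ {M N α β} → .{{ℕ.NonZero M}} → .{{ℕ.NonZero N}} → Coprime M N → Char M α → Char N β →
    ∀ x y → ∃[ g ] (α ⊙ β) g ≡ α x * β y
  ⊙-attains {α = α} {β} c A B x y with crt c x y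
  ... | g , (k , e) , (l , f) = g , cong₂ _*_ (trans (cong α e) (Char.periodic A x k)) (trans (cong β f) (Char.periodic B y l))

  np-⊙ˡ : ∀ {M N α β} → .{{ℕ.NonZero M}} → .{{ℕ.NonZero N}} → Coprime M N → Char M α → Char N β → NonPrincipal α → NonPrincipal (α ⊙ β)
  np-⊙ˡ c A B (x , e) with ⊙-attains c A B x 1
  ... | g , h = g , trans h (cong₂ _*_ e (Char.unit B))

  np-⊙ʳ : ∀ {M N α β} → .{{ℕ.NonZero M}} → .{{ℕ.NonZero N}} → Coprime M N → Char M α → Char N β → NonPrincipal β → NonPrincipal (α ⊙ β)
  np-⊙ʳ c A B (y , e) with ⊙-attains c A B 1 y
  ... | g , h = g , trans h (cong₂ _*_ (Char.unit A) e)

  χ-np : ∀ {p} → OddPrime p → NonPrincipal (χℕ p)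
  χ-np op = Symbol.nonresidue op

  module _ {M α} {{_ : ℕ.NonZero M}} (A : Char M α) (np : NonPrincipal α) where
    open Char A

    private
      g = proj₁ np
      αg = proj₂ np

      %-per : ∀ x → α (x % M) ≡ α x
      %-per x = trans (sym (periodic (x % M) (x / M))) (cong α (sym (m≡m%n+[m/n]*n x M)))

      g⊥M : Coprime g M
      g⊥M = support g (λ e → contra (trans (sym αg) e))
        where contra : -1ℤ ≢ 0ℤ
              contra ()

      f : ℕ → ℕ
      f x = (g ℕ.* x) % M

      inj-≤ : ∀ x y → x ℕ.≤ y → y ℕ.< M → f x ≡ f y → x ≡ y
      inj-≤ x y x≤y y<M e = ℕ.≤-antisym x≤y (ℕ.m∸n≡0⇒m≤n (∣small⇒≡0 (y ℕ.∸ x) d (ℕ.≤-<-trans (ℕ.m∸n≤m y x) y<M)))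
        where
        a = (g ℕ.* x) / M
        b = (g ℕ.* y) / M
        e₁ : g ℕ.* x ≡ f y ℕ.+ a ℕ.* M
        e₁ = trans (m≡m%n+[m/n]*n (g ℕ.* x) M) (cong (ℕ._+ a ℕ.* M) e)
        e₂ : g ℕ.* y ≡ f y ℕ.+ b ℕ.* M
        e₂ = m≡m%n+[m/n]*n (g ℕ.* y) M
        d : M ℕ.∣ y ℕ.∸ x
        d = coprime-divisor {M} {g} (coprime-sym g⊥M) (ℕ.divides (b ℕ.∸ a) (begin
          g ℕ.* (y ℕ.∸ x)                            ≡⟨ ℕ.*-distribˡ-∸ g y x ⟩
          g ℕ.* y ℕ.∸ g ℕ.* x                        ≡⟨ cong₂ ℕ._∸_ e₂ e₁ ⟩
          (f y ℕ.+ b ℕ.* M) ℕ.∸ (f y ℕ.+ a ℕ.* M)    ≡⟨ ℕ.[m+n]∸[m+o]≡n∸o (f y) (b ℕ.* M) (a ℕ.* M) ⟩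
          b ℕ.* M ℕ.∸ a ℕ.* M                        ≡⟨ sym (ℕ.*-distribʳ-∸ M b a) ⟩
          (b ℕ.∸ a) ℕ.* M                            ∎))
          where open ≡-Reasoning

      f-inj : ∀ x y → x ℕ.< M → y ℕ.< M → f x ≡ f y → x ≡ y
      f-inj x y x< y< e with ℕ.≤-total x y
      ... | inj₁ p = inj-≤ x y p y< e
      ... | inj₂ p = sym (inj-≤ y x p x< (sym e))

    -- Multiplication by a `g` with `α g = -1` permutes the residues, so the sum equals its own
    -- negative.
    period-sum : ∑ M α ≡ 0ℤ
    period-sum = zero-of (∑ M α) (trans (sym (∑-perm M f α (λ x _ → m%n<n (g ℕ.* x) M) f-inj))
      (trans (∑-cong M (λ x _ → trans (%-per (g ℕ.* x)) (trans (mult g x) (cong (_* α x) αg)))) (∑-scale M -1ℤ α)))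
      where
      zero-of : ∀ z → z ≡ -1ℤ * z → z ≡ 0ℤ
      zero-of (+ 0) _ = refl
      zero-of (+ suc n) ()
      zero-of Data.Integer.-[1+ n ] ()

    partial-sum : ∀ c → ∣ ∑ c α ∣ ℕ.≤ M
    partial-sum c = subst (λ u → ∣ ∑ u α ∣ ℕ.≤ M) (sym (trans (m≡m%n+[m/n]*n c M) (ℕ.+-comm (c % M) _)))
      (subst (λ u → ∣ u ∣ ℕ.≤ M) (sym (drop (c / M) (c % M)))
        (ℕ.≤-trans (∑-bound (c % M) 1 α (λ i _ → ∣tri∣≤1 (tri i))) (subst (ℕ._≤ M) (sym (ℕ.*-identityʳ (c % M))) (ℕ.<⇒≤ (m%n<n c M)))))
      where
      drop : ∀ q r → ∑ (q ℕ.* M ℕ.+ r) α ≡ ∑ r α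
      drop zero r = refl
      drop (suc q) r = trans (cong (λ u → ∑ u α) (ℕ.+-assoc M (q ℕ.* M) r)) (trans (∑-split M (q ℕ.* M ℕ.+ r) α)
        (trans (cong₂ _+_ period-sum (∑-cong (q ℕ.* M ℕ.+ r) (λ i _ → trans (cong α (ℕ.+-comm M i)) (per i))))
        (trans (+-identityˡ _) (drop q r))))

-- The hyperbola method and the expansion of the product

module CharacterSums where

  open LegendreSymbol
  open Characters
  open import Data.Nat as ℕ using (ℕ; zero; suc; z≤n; s≤s)
  import Data.Nat.Properties as ℕ
  open import Data.Nat.Coprimality using (Coprime)
  open import Data.Nat.Primality using (prime⇒nonZero)
  open import Data.Nat.Tactic.RingSolver renaming (solve-∀ to ℕ-solve-∀)
  open import Data.Integer using (ℤ; +_; 0ℤ; 1ℤ; _+_; _-_; _*_; -_; ∣_∣)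
  open import Data.Integer.Properties
  open import Data.Integer.Tactic.RingSolver using (solve-∀)
  open import Data.List using (List; []; _∷_; length)
  open import Data.List.Relation.Unary.All using (All; []; _∷_)
  open import Data.List.Relation.Unary.AllPairs using (AllPairs; []; _∷_)

  𝟙 : ∀ {P : Set} → Dec P → ℤ
  𝟙 (yes _) = 1ℤ
  𝟙 (no _) = 0ℤ

  𝟙-yes : ∀ {P : Set} (d : Dec P) → P → 𝟙 d ≡ 1ℤ
  𝟙-yes (yes _) _ = refl
  𝟙-yes (no n) p = ⊥-elim (n p)

  𝟙-no : ∀ {P : Set} (d : Dec P) → ¬ P → 𝟙 d ≡ 0ℤ
  𝟙-no (yes p) n = ⊥-elim (n p)
  𝟙-no (no _) _ = refl

  ∣-∣-scale : ∀ {x} → Tri x → ∀ y C → ∣ y ∣ ℕ.≤ C → ∣ x * y ∣ ℕ.≤ C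
  ∣-∣-scale {x} t y C h = subst (ℕ._≤ C) (sym (abs-* x y)) (ℕ.≤-trans (ℕ.*-monoˡ-≤ ∣ y ∣ (∣tri∣≤1 t)) (ℕ.≤-trans (ℕ.≤-reflexive (ℕ.*-identityˡ ∣ y ∣)) h))

  -- The indices i with g i ≤ N form an initial segment.
  ∑-truncate : ∀ N (g : ℕ → ℕ) → (∀ {i j} → i ℕ.≤ j → g i ℕ.≤ g j) → ∀ C (f : ℕ → ℤ) → (∀ c → ∣ ∑ c f ∣ ℕ.≤ C) →
    ∀ L → ∣ ∑ L (λ i → 𝟙 (g i ℕ.≤? N) * f i) ∣ ℕ.≤ C
  ∑-truncate N g mono C f h zero = z≤n
  ∑-truncate N g mono C f h (suc L) = pick (g L ℕ.≤? N)
    where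
    F : ℕ → ℤ
    F i = 𝟙 (g i ℕ.≤? N) * f i
    pick : Dec (g L ℕ.≤ N) → ∣ ∑ (suc L) F ∣ ℕ.≤ C
    pick (yes p) = subst (λ u → ∣ u ∣ ℕ.≤ C) (sym (∑-cong (suc L) (λ i i<L →
      trans (cong (_* f i) (𝟙-yes (g i ℕ.≤? N) (ℕ.≤-trans (mono (ℕ.≤-pred i<L)) p))) (*-identityˡ (f i))))) (h (suc L))
    pick (no n) = subst (λ u → ∣ u ∣ ℕ.≤ C) (sym (trans (cong (λ u → ∑ L F + u) (cong (_* f L) (𝟙-no (g L ℕ.≤? N) n))) (+-identityʳ (∑ L F))))
      (∑-truncate N g mono C f h L)

  module Hyperbola (X : ℕ) where
    N = X ℕ.* X
    L = suc N

    Tot : (ℕ → ℕ → ℤ) → ℤ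
    Tot w = ∑ L (λ a → ∑ L (λ b → 𝟙 (a ℕ.* b ℕ.≤? N) * w a b))

    Tot-cong : ∀ {v w} → (∀ a b → v a b ≡ w a b) → Tot v ≡ Tot w
    Tot-cong e = ∑-cong L (λ a _ → ∑-cong L (λ b _ → cong (𝟙 (a ℕ.* b ℕ.≤? N) *_) (e a b)))

    Tot-lin : ∀ c v w → Tot (λ a b → v a b + c * w a b) ≡ Tot v + c * Tot w
    Tot-lin c v w = trans (∑-cong L (λ a _ → row a)) (trans (∑-+ L (rv v) (λ a → c * rv w a)) (cong (λ u → Tot v + u) (∑-scale L c (rv w))))
      where
      rv : (ℕ → ℕ → ℤ) → ℕ → ℤ
      rv u a = ∑ L (λ b → 𝟙 (a ℕ.* b ℕ.≤? N) * u a b)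
      l : ∀ i v c w → i * (v + c * w) ≡ i * v + c * (i * w)
      l = solve-∀
      row : ∀ a → ∑ L (λ b → 𝟙 (a ℕ.* b ℕ.≤? N) * (v a b + c * w a b)) ≡ rv v a + c * rv w a
      row a = trans (∑-cong L (λ b _ → l (𝟙 (a ℕ.* b ℕ.≤? N)) (v a b) c (w a b)))
        (trans (∑-+ L (λ b → 𝟙 (a ℕ.* b ℕ.≤? N) * v a b) (λ b → c * (𝟙 (a ℕ.* b ℕ.≤? N) * w a b)))
               (cong (λ u → rv v a + u) (∑-scale L c (λ b → 𝟙 (a ℕ.* b ℕ.≤? N) * w a b))))

    Tot-swap : ∀ (α β : ℕ → ℤ) → Tot (λ a b → α a * β b) ≡ Tot (λ a b → β a * α b)
    Tot-swap α β = trans (∑-swap L L (λ a b → 𝟙 (a ℕ.* b ℕ.≤? N) * (α a * β b)))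
      (∑-cong L (λ b _ → ∑-cong L (λ a _ → cong₂ _*_ (cong (λ n → 𝟙 (n ℕ.≤? N)) (ℕ.*-comm a b)) (*-comm (α a) (β b)))))

    -- For each `a ≤ X` the sum over `b` is a partial sum of `β`, bounded by `M`. The pairs with
    -- `a > X` have `b ≤ X`; for each such `b` the sum over `a` is a difference of two partial sums
    -- of `α`, bounded by `2M`.
    hyperbola : ∀ M (α β : ℕ → ℤ) → (∀ x → Tri (α x)) → (∀ x → Tri (β x)) → (∀ c → ∣ ∑ c α ∣ ℕ.≤ M) → (∀ c → ∣ ∑ c β ∣ ℕ.≤ M) →
      ∣ Tot (λ a b → α a * β b) ∣ ℕ.≤ 3 ℕ.* M ℕ.* suc X
    hyperbola M α β tα tβ hα hβ = subst (λ u → ∣ u ∣ ℕ.≤ 3 ℕ.* M ℕ.* suc X) (sym split)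
      (ℕ.≤-trans (∣i+j∣≤∣i∣+∣j∣ (∑ (suc X) row) (∑ K (λ i → row (suc X ℕ.+ i))))
      (ℕ.≤-trans (ℕ.+-mono-≤ part₁ part₂) (ℕ.≤-reflexive (l M X))))
      where
      l : ∀ M X → suc X ℕ.* M ℕ.+ suc X ℕ.* (M ℕ.+ M) ≡ 3 ℕ.* M ℕ.* suc X
      l = ℕ-solve-∀
      row : ℕ → ℤ
      row a = ∑ L (λ b → 𝟙 (a ℕ.* b ℕ.≤? N) * (α a * β b))
      X≤N : X ℕ.≤ N
      X≤N = go X
        where go : ∀ X → X ℕ.≤ X ℕ.* X
              go zero = z≤n
              go (suc X) = ℕ.m≤m*n (suc X) (suc X)
      K = L ℕ.∸ suc X
      L≡ : suc X ℕ.+ K ≡ L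
      L≡ = ℕ.m+[n∸m]≡n (s≤s X≤N)
      split : Tot (λ a b → α a * β b) ≡ ∑ (suc X) row + ∑ K (λ i → row (suc X ℕ.+ i))
      split = trans (cong (λ u → ∑ u row) (sym L≡)) (∑-split (suc X) K row)
      r₁ : ∀ i x y → i * (x * y) ≡ x * (i * y)
      r₁ = solve-∀
      r₂ : ∀ i x y → i * (x * y) ≡ y * (i * x)
      r₂ = solve-∀
      part₁ : ∣ ∑ (suc X) row ∣ ℕ.≤ suc X ℕ.* M
      part₁ = ∑-bound (suc X) M row (λ a _ → subst (λ u → ∣ u ∣ ℕ.≤ M)
        (sym (trans (∑-cong L (λ b _ → r₁ (𝟙 (a ℕ.* b ℕ.≤? N)) (α a) (β b))) (∑-scale L (α a) (λ b → 𝟙 (a ℕ.* b ℕ.≤? N) * β b))))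
        (∣-∣-scale (tα a) _ M (∑-truncate N (a ℕ.*_) (ℕ.*-monoʳ-≤ a) M β hβ L)))
      αs : ℕ → ℤ
      αs i = α (suc X ℕ.+ i)
      hαs : ∀ c → ∣ ∑ c αs ∣ ℕ.≤ M ℕ.+ M
      hαs c = subst (λ u → ∣ u ∣ ℕ.≤ M ℕ.+ M) (sym diff)
        (ℕ.≤-trans (∣i+j∣≤∣i∣+∣j∣ (∑ (suc X ℕ.+ c) α) (- ∑ (suc X) α)) (ℕ.+-mono-≤ (hα (suc X ℕ.+ c)) (subst (ℕ._≤ M) (sym (∣-i∣≡∣i∣ (∑ (suc X) α))) (hα (suc X)))))
        where
        r : ∀ x y → y ≡ x + y - x
        r = solve-∀
        diff : ∑ c αs ≡ ∑ (suc X ℕ.+ c) α - ∑ (suc X) α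
        diff = trans (r (∑ (suc X) α) (∑ c αs)) (cong (_- ∑ (suc X) α) (sym (∑-split (suc X) c α)))
      col : ℕ → ℤ
      col b = ∑ K (λ i → 𝟙 ((suc X ℕ.+ i) ℕ.* b ℕ.≤? N) * (αs i * β b))
      col-0 : ∀ b → suc X ℕ.≤ b → col b ≡ 0ℤ
      col-0 b X<b = trans (∑-cong K (λ i _ → cong (_* (αs i * β b)) (𝟙-no ((suc X ℕ.+ i) ℕ.* b ℕ.≤? N)
        (ℕ.<⇒≱ (ℕ.≤-trans (ℕ.≤-trans (s≤s (ℕ.m≤n+m N (X ℕ.+ X))) (ℕ.≤-reflexive (r X))) (ℕ.*-mono-≤ (ℕ.m≤m+n (suc X) i) X<b)))))) (∑-0 K)
        where r : ∀ X → suc (X ℕ.+ X ℕ.+ X ℕ.* X) ≡ suc X ℕ.* suc X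
              r = ℕ-solve-∀
      col-bound : ∀ b → ∣ col b ∣ ℕ.≤ M ℕ.+ M
      col-bound b = subst (λ u → ∣ u ∣ ℕ.≤ M ℕ.+ M)
        (sym (trans (∑-cong K (λ i _ → r₂ (𝟙 ((suc X ℕ.+ i) ℕ.* b ℕ.≤? N)) (αs i) (β b))) (∑-scale K (β b) (λ i → 𝟙 ((suc X ℕ.+ i) ℕ.* b ℕ.≤? N) * αs i))))
        (∣-∣-scale (tβ b) _ (M ℕ.+ M) (∑-truncate N (λ i → (suc X ℕ.+ i) ℕ.* b) (λ i≤j → ℕ.*-monoˡ-≤ b (ℕ.+-monoʳ-≤ (suc X) i≤j)) (M ℕ.+ M) αs hαs K))
      cols : ∑ K (λ i → row (suc X ℕ.+ i)) ≡ ∑ (suc X) col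
      cols = trans (∑-swap K L (λ i b → 𝟙 ((suc X ℕ.+ i) ℕ.* b ℕ.≤? N) * (αs i * β b)))
        (trans (cong (λ u → ∑ u col) (sym L≡)) (trans (∑-split (suc X) K col)
        (trans (cong (λ u → ∑ (suc X) col + u) (trans (∑-cong K (λ i _ → col-0 (suc X ℕ.+ i) (ℕ.m≤m+n (suc X) i))) (∑-0 K))) (+-identityʳ _))))
      part₂ : ∣ ∑ K (λ i → row (suc X ℕ.+ i)) ∣ ℕ.≤ suc X ℕ.* (M ℕ.+ M)
      part₂ = subst (λ u → ∣ u ∣ ℕ.≤ suc X ℕ.* (M ℕ.+ M)) (sym cols) (∑-bound (suc X) (M ℕ.+ M) col (λ b _ → col-bound b))

  ∏ₗ : List ℕ → ℕ
  ∏ₗ [] = 1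
  ∏ₗ (p ∷ ps) = p ℕ.* ∏ₗ ps

  module Expand (X : ℕ) (ε : ℕ → ℤ) (ε-tri : ∀ p → Tri (ε p)) where
    open Hyperbola X

    twist : List ℕ → (ℕ → ℕ → ℤ) → (ℕ → ℤ) → ℕ → ℤ
    twist [] c α = α
    twist (p ∷ ps) c α = twist ps c (α ⊙ c p)

    -- The squares `χ²` are principal characters modulo `p`. They turn each summand into a character
    -- in `a` times a character in `b`, so that expanding one prime multiplies both moduli by `p`.
    T : List ℕ → ℕ → ℕ → ℤ
    T [] a b = 1ℤ
    T (p ∷ ps) a b = (χ² p a * χℕ p b + ε p * (χℕ p a * χ² p b)) * T ps a b

    W : List ℕ → (ℕ → ℤ) → (ℕ → ℤ) → ℤ
    W ps α β = Tot (λ a b → α a * β b * T ps a b)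

    E : List ℕ → ℤ
    E [] = 1ℤ
    E (p ∷ ps) = ε p * E ps

    Pure : (ℕ → ℤ) → (ℕ → ℤ) → ℤ
    Pure α β = Tot (λ a b → α a * β b)

    W-[] : ∀ α β → W [] α β ≡ Pure α β
    W-[] α β = Tot-cong (λ a b → *-identityʳ (α a * β b))

    W-∷ : ∀ p ps α β → W (p ∷ ps) α β ≡ W ps (α ⊙ χ² p) (β ⊙ χℕ p) + ε p * W ps (α ⊙ χℕ p) (β ⊙ χ² p)
    W-∷ p ps α β = trans (Tot-cong (λ a b → l (α a) (β b) (χ² p a) (χℕ p b) (ε p) (χℕ p a) (χ² p b) (T ps a b)))
      (Tot-lin (ε p) (λ a b → α a * χ² p a * (β b * χℕ p b) * T ps a b) (λ a b → α a * χℕ p a * (β b * χ² p b) * T ps a b))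
      where
      l : ∀ x y u v e u′ v′ t → x * y * ((u * v + e * (u′ * v′)) * t) ≡ x * u * (y * v) * t + e * (x * u′ * (y * v′) * t)
      l = solve-∀

    bound : ℕ → List ℕ → ℕ
    bound M ps = 2 ℕ.^ length ps ℕ.* (3 ℕ.* (M ℕ.* ∏ₗ ps) ℕ.* suc X)

    private
      bound-∷ : ∀ M p ps → bound (M ℕ.* p) ps ℕ.+ bound (M ℕ.* p) ps ≡ bound M (p ∷ ps)
      bound-∷ M p ps = l (2 ℕ.^ length ps) M p (∏ₗ ps) X
        where l : ∀ t M p P X → t ℕ.* (3 ℕ.* (M ℕ.* p ℕ.* P) ℕ.* suc X) ℕ.+ t ℕ.* (3 ℕ.* (M ℕ.* p ℕ.* P) ℕ.* suc X) ≡ 2 ℕ.* t ℕ.* (3 ℕ.* (M ℕ.* (p ℕ.* P)) ℕ.* suc X)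
              l = ℕ-solve-∀

      add : ∀ {e B C} x y → Tri e → ∣ x ∣ ℕ.≤ B → ∣ y ∣ ℕ.≤ B → B ℕ.+ B ≡ C → ∣ x + e * y ∣ ℕ.≤ C
      add {e} x y te hx hy refl = ℕ.≤-trans (∣i+j∣≤∣i∣+∣j∣ x (e * y)) (ℕ.+-mono-≤ hx (∣-∣-scale te y _ hy))

    Admissible : ℕ → List ℕ → Set
    Admissible M ps = ℕ.NonZero M × All OddPrime ps × All (Coprime M) ps × AllPairs Coprime ps

    private
      nz : ∀ {p} → OddPrime p → ℕ.NonZero p
      nz op = prime⇒nonZero (OddPrime.prime op)

      step : ∀ {M p ps} → Admissible M (p ∷ ps) → Admissible (M ℕ.* p) ps
      step {M} {p} (n , op ∷ ops , c ∷ cs , u ∷ us) = ℕ.m*n≢0 M p {{n}} {{nz op}} , ops , go cs u , us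
        where
        go : ∀ {qs} → All (Coprime M) qs → All (Coprime p) qs → All (Coprime (M ℕ.* p)) qs
        go [] [] = []
        go (x ∷ xs) (y ∷ ys) = (λ {d} (a , b) → coprime-* (λ (u , v) → x (v , u)) (λ (u , v) → y (v , u)) (b , a)) ∷ go xs ys

      head-prime : ∀ {M p ps} → Admissible M (p ∷ ps) → OddPrime p
      head-prime (_ , op ∷ _ , _) = op

      head-coprime : ∀ {M p ps} → Admissible M (p ∷ ps) → Coprime M p
      head-coprime (_ , _ , c ∷ _ , _) = c

    module _ {M p ps} (ad : Admissible M (p ∷ ps)) where
      private
        op = head-prime ad
        instance
          M-nz : ℕ.NonZero M
          M-nz = proj₁ ad
          p-nz : ℕ.NonZero p
          p-nz = nz op
        c : Coprime M p
        c = head-coprime ad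

      ext : ∀ {α} → Char M α → Char (M ℕ.* p) (α ⊙ χℕ p)
      ext A = ⊙-char A (χ-char op)
      ext² : ∀ {α} → Char M α → Char (M ℕ.* p) (α ⊙ χ² p)
      ext² A = ⊙-char A (χ²-char op)
      np-new : ∀ {α} → Char M α → NonPrincipal (α ⊙ χℕ p)
      np-new A = np-⊙ʳ c A (χ-char op) (χ-np op)
      np-ext : ∀ {α} → Char M α → NonPrincipal α → NonPrincipal (α ⊙ χℕ p)
      np-ext A = np-⊙ˡ c A (χ-char op)
      np-ext² : ∀ {α} → Char M α → NonPrincipal α → NonPrincipal (α ⊙ χ² p)
      np-ext² A = np-⊙ˡ c A (χ²-char op)

    -- Nonprincipality survives multiplication by characters of coprime moduli, so each of the
    -- `2 ^ length ps` terms falls under the hyperbola bound.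
    mixed : ∀ ps {M α β} → Admissible M ps → Char M α → NonPrincipal α → Char M β → NonPrincipal β → ∣ W ps α β ∣ ℕ.≤ bound M ps
    mixed [] {M} {α} {β} (n , _) A na B nb = subst (λ u → ∣ u ∣ ℕ.≤ bound M []) (sym (W-[] α β))
      (ℕ.≤-trans (hyperbola M α β (Char.tri A) (Char.tri B) (partial-sum {{n}} A na) (partial-sum {{n}} B nb)) (ℕ.≤-reflexive (l M X)))
      where l : ∀ M X → 3 ℕ.* M ℕ.* suc X ≡ 1 ℕ.* (3 ℕ.* (M ℕ.* 1) ℕ.* suc X)
            l = ℕ-solve-∀
    mixed (p ∷ ps) {M} {α} {β} ad A na B nb = subst (λ u → ∣ u ∣ ℕ.≤ bound M (p ∷ ps)) (sym (W-∷ p ps α β))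
      (add (W ps (α ⊙ χ² p) (β ⊙ χℕ p)) (W ps (α ⊙ χℕ p) (β ⊙ χ² p)) (ε-tri p)
        (mixed ps (step ad) (ext² ad A) (np-ext² ad A na) (ext ad B) (np-ext ad B nb))
        (mixed ps (step ad) (ext ad A) (np-ext ad A na) (ext² ad B) (np-ext² ad B nb)) (bound-∷ M p ps))

    -- With `α` nonprincipal, a term escapes `mixed` only if the second character stays principal to
    -- the end, so `χ²` must fall to `β` at every prime. That single term has the coefficient
    -- `E ps`. `halfʳ` is the mirror image, with coefficient 1.
    halfˡ : ∀ ps {M α β} → Admissible M ps → Char M α → NonPrincipal α → Char M β →
      ∣ W ps α β - E ps * Pure (twist ps χℕ α) (twist ps χ² β) ∣ ℕ.≤ bound M ps
    halfˡ [] {M} {α} {β} ad A na B = subst (λ u → ∣ u ∣ ℕ.≤ bound M [])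
      (sym (trans (cong₂ _-_ (W-[] α β) (*-identityˡ (Pure α β))) (+-inverseʳ (Pure α β)))) z≤n
    halfˡ (p ∷ ps) {M} {α} {β} ad A na B = subst (λ u → ∣ u ∣ ℕ.≤ bound M (p ∷ ps))
      (sym (trans (cong (_- E (p ∷ ps) * P) (W-∷ p ps α β)) (l (W ps (α ⊙ χ² p) (β ⊙ χℕ p)) (ε p) (W ps (α ⊙ χℕ p) (β ⊙ χ² p)) (E ps) P)))
      (add (W ps (α ⊙ χ² p) (β ⊙ χℕ p)) (W ps (α ⊙ χℕ p) (β ⊙ χ² p) - E ps * P) (ε-tri p)
        (mixed ps (step ad) (ext² ad A) (np-ext² ad A na) (ext ad B) (np-new ad B))
        (halfˡ ps (step ad) (ext ad A) (np-ext ad A na) (ext² ad B)) (bound-∷ M p ps))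
      where
      P = Pure (twist ps χℕ (α ⊙ χℕ p)) (twist ps χ² (β ⊙ χ² p))
      l : ∀ x e y E P → x + e * y - e * E * P ≡ x + e * (y - E * P)
      l = solve-∀

    halfʳ : ∀ ps {M α β} → Admissible M ps → Char M α → Char M β → NonPrincipal β →
      ∣ W ps α β - Pure (twist ps χ² α) (twist ps χℕ β) ∣ ℕ.≤ bound M ps
    halfʳ [] {M} {α} {β} ad A B nb = subst (λ u → ∣ u ∣ ℕ.≤ bound M [])
      (sym (trans (cong (_- Pure α β) (W-[] α β)) (+-inverseʳ (Pure α β)))) z≤n
    halfʳ (p ∷ ps) {M} {α} {β} ad A B nb = subst (λ u → ∣ u ∣ ℕ.≤ bound M (p ∷ ps))
      (sym (trans (cong (_- P) (W-∷ p ps α β)) (l (W ps (α ⊙ χ² p) (β ⊙ χℕ p)) (ε p) (W ps (α ⊙ χℕ p) (β ⊙ χ² p)) P)))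
      (add (W ps (α ⊙ χ² p) (β ⊙ χℕ p) - P) (W ps (α ⊙ χℕ p) (β ⊙ χ² p)) (ε-tri p)
        (halfʳ ps (step ad) (ext² ad A) (ext ad B) (np-ext ad B nb))
        (mixed ps (step ad) (ext ad A) (np-new ad A) (ext² ad B) (np-ext² ad B nb)) (bound-∷ M p ps))
      where
      P = Pure (twist ps χ² (α ⊙ χ² p)) (twist ps χℕ (β ⊙ χℕ p))
      l : ∀ x e y P → x + e * y - P ≡ x - P + e * y
      l = solve-∀

    -- The choice at the first prime makes one of the two characters nonprincipal, so one term
    -- survives on each side. They are equal by the symmetry in `a` and `b`; with `E` equal to 1
    -- they add up instead of cancelling, which is where the sign condition is used.
    full : ∀ p ps {M α} → Admissible M (p ∷ ps) → Char M α → E (p ∷ ps) ≡ 1ℤ →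
      ∣ W (p ∷ ps) α α - + 2 * Pure (twist (p ∷ ps) χ² α) (twist (p ∷ ps) χℕ α) ∣ ℕ.≤ bound M (p ∷ ps)
    full p ps {M} {α} ad A E≡1 = subst (λ u → ∣ u ∣ ℕ.≤ bound M (p ∷ ps)) (sym eq)
      (add (x - P) (y - E ps * P′) (ε-tri p)
        (halfʳ ps (step ad) (ext² ad A) (ext ad A) (np-new ad A))
        (halfˡ ps (step ad) (ext ad A) (np-new ad A) (ext² ad A)) (bound-∷ M p ps))
      where
      x = W ps (α ⊙ χ² p) (α ⊙ χℕ p)
      y = W ps (α ⊙ χℕ p) (α ⊙ χ² p)
      P = Pure (twist (p ∷ ps) χ² α) (twist (p ∷ ps) χℕ α)
      P′ = Pure (twist (p ∷ ps) χℕ α) (twist (p ∷ ps) χ² α)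
      l : ∀ x e y E P → x - P + e * (y - E * P) ≡ x + e * y - (1ℤ + e * E) * P
      l = solve-∀
      eq : W (p ∷ ps) α α - + 2 * P ≡ x - P + ε p * (y - E ps * P′)
      eq = trans (cong (_- + 2 * P) (W-∷ p ps α α)) (sym (trans (cong (λ u → x - P + ε p * (y - E ps * u)) (Tot-swap (twist (p ∷ ps) χℕ α) (twist (p ∷ ps) χ² α)))
        (trans (l x (ε p) y (E ps) P) (cong (λ u → x + ε p * y - (1ℤ + u) * P) E≡1))))

-- Divisor sums of a character, counting ideals

module DivisorSums where

  open Folds
  open LegendreSymbol using (Tri; zer; one; min)
  open Characters
  open CharacterSums using (𝟙; 𝟙-yes; 𝟙-no; ∏ₗ)
  open TernaryForms using (0≤+)
  open import Data.Nat as ℕ using (ℕ; zero; suc; z≤n; s≤s) renaming (_*_ to _·_)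
  import Data.Nat.Properties as ℕ
  open import Data.Nat.Divisibility using (_∣_; _∣?_; divides; ∣⇒≤; ∣-trans; *-monoʳ-∣; *-cancelˡ-∣; n∣m*n; ∣1⇒≡1; ∣-refl)
  open import Data.Nat.Coprimality using (coprime-divisor)
  open import Data.Nat.Primality using (Prime; prime?; prime⇒nonZero; prime⇒nonTrivial)
  open import Data.Nat.Primality.Factorisation using (factorise)
  open import Data.Nat.Tactic.RingSolver renaming (solve-∀ to ℕ-solve-∀)
  open import Data.Integer using (ℤ; +_; 0ℤ; 1ℤ; -1ℤ; _+_; _-_; _*_; -_; _≤_; _≟_; +≤+)
  open import Data.Integer.Properties hiding (_≟_)
  open import Data.Integer.Tactic.RingSolver using (solve-∀)
  open import Data.List using ([]; _∷_)
  open import Data.List.Relation.Unary.All as All using (All; []; _∷_)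
  open import Data.List.Relation.Unary.AllPairs using (AllPairs; []; _∷_)

  𝟙-cong : ∀ {P Q : Set} (d : Dec P) (e : Dec Q) → (P → Q) → (Q → P) → 𝟙 d ≡ 𝟙 e
  𝟙-cong (yes p) e f g = sym (𝟙-yes e (f p))
  𝟙-cong (no n) e f g = sym (𝟙-no e (λ q → n (g q)))

  prime-factor : ∀ n → 2 ℕ.≤ n → ∃[ ℓ ] ∃[ k ] Prime ℓ × n ≡ ℓ · k
  prime-factor (suc n) 2≤n with factorise (suc n)
  ... | record { factors = [] ; isFactorisation = e } = ⊥-elim (ℕ.<-irrefl (sym e) 2≤n)
  ... | record { factors = ℓ ∷ qs ; isFactorisation = e ; factorsPrime = pℓ ∷ _ } = ℓ , _ , pℓ , e

  cofactor : ∀ {n ℓ k} → 1 ℕ.≤ n → Prime ℓ → n ≡ ℓ · k → 1 ℕ.≤ k × k ℕ.< n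
  cofactor {n} {ℓ} {zero} 1≤n pℓ e = ⊥-elim (ℕ.m<n⇒n≢0 1≤n (trans e (ℕ.*-zeroʳ ℓ)))
  cofactor {n} {ℓ} {suc k} 1≤n pℓ refl = s≤s z≤n , subst (suc k ℕ.<_) (ℕ.*-comm (suc k) ℓ) (ℕ.m<m*n (suc k) ℓ (ℕ.nonTrivial⇒n>1 ℓ {{prime⇒nonTrivial pℓ}}))

  extract : ∀ ℓ qs → All Prime qs → AllPairs _≢_ qs →
    (∃[ qs′ ] ∏ₗ qs ≡ ℓ · ∏ₗ qs′ × All Prime qs′ × AllPairs _≢_ qs′ × (∀ {P : ℕ → Set} → All P qs → All P qs′)) ⊎ All (ℓ ≢_) qs
  extract ℓ [] _ _ = inj₂ []
  extract ℓ (q ∷ qs) (pq ∷ pqs) (u ∷ us) with ℓ ℕ.≟ q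
  ... | yes refl = inj₁ (qs , refl , pqs , us , λ { (_ ∷ h) → h })
  ... | no ne with extract ℓ qs pqs us
  ... | inj₂ h = inj₂ (ne ∷ h)
  ... | inj₁ (qs′ , e , pqs′ , us′ , sub) = inj₁ (q ∷ qs′ , trans (cong (q ·_) e) (l q ℓ (∏ₗ qs′)) , pq ∷ pqs′ , sub u ∷ us′ , λ { (x ∷ h) → x ∷ sub h })
    where l : ∀ q ℓ P → q · (ℓ · P) ≡ ℓ · (q · P)
          l = ℕ-solve-∀

  -- Prime by prime: a prime new to the list is added to it, one already there leaves the list and
  -- enters the square.
  squarefree-part : ∀ n → 1 ℕ.≤ n → ∃[ qs ] ∃[ f ] n ≡ ∏ₗ qs · (f · f) × All Prime qs × AllPairs _≢_ qs × All (_∣ n) qs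
  squarefree-part n = go n n ℕ.≤-refl
    where
    go : ∀ fuel n → n ℕ.≤ fuel → 1 ℕ.≤ n → ∃[ qs ] ∃[ f ] n ≡ ∏ₗ qs · (f · f) × All Prime qs × AllPairs _≢_ qs × All (_∣ n) qs
    go zero n n≤0 1≤n = ⊥-elim (ℕ.<⇒≱ 1≤n n≤0)
    go (suc fuel) 1 _ _ = [] , 1 , refl , [] , [] , []
    go (suc fuel) n@(suc (suc _)) n≤ 1≤n with prime-factor n (s≤s (s≤s z≤n))
    ... | ℓ , k , pℓ , e with go fuel k (ℕ.≤-pred (ℕ.≤-trans (proj₂ (cofactor 1≤n pℓ e)) n≤)) (proj₁ (cofactor 1≤n pℓ e))
    ... | qs , f , ek , pqs , us , ds with extract ℓ qs pqs us
    ... | inj₂ new = ℓ ∷ qs , f , trans e (trans (cong (ℓ ·_) ek) (sym (ℕ.*-assoc ℓ (∏ₗ qs) (f · f)))) , pℓ ∷ pqs , new ∷ us ,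
                     divides k (trans e (ℕ.*-comm ℓ k)) ∷ All.map (λ d → ∣-trans d (divides ℓ e)) ds
    ... | inj₁ (qs′ , eq , pqs′ , us′ , sub) = qs′ , ℓ · f , trans e (trans (cong (ℓ ·_) (trans ek (cong (_· (f · f)) eq))) (l ℓ (∏ₗ qs′) f)) ,
                     pqs′ , us′ , All.map (λ d → ∣-trans d (divides ℓ e)) (sub ds)
      where l : ∀ ℓ P f → ℓ · (ℓ · P · (f · f)) ≡ P · (ℓ · f · (ℓ · f))
            l = ℕ-solve-∀

  module DivSum (L : ℕ) (c : ℕ → ℤ) (c-mult : ∀ x y → c (x · y) ≡ c x * c y) (c-tri : ∀ x → Tri (c x)) (c-unit : c 1 ≡ 1ℤ) where

    dvd : ℕ → ℕ → ℤ
    dvd d n = 𝟙 (d ∣? n)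

    -- For the character of a quadratic field this is the number of ideals of norm `n`. The range
    -- `d < L` includes all divisors as long as `1 ≤ n < L`.
    R : ℕ → ℤ
    R n = ∑ L (λ d → dvd d n * c d)

    P : ℕ → ℕ → ℤ
    P ℓ n = ∑ L (λ d → dvd d n * (1ℤ - dvd ℓ d) * c d)

    -- On the right `ℓ · e` may exceed the range on the left; the vanishing of `f` from `L` on
    -- absorbs this.
    reindex : ∀ ℓ → 1 ℕ.≤ ℓ → (f : ℕ → ℤ) → (∀ d → L ℕ.≤ d → f d ≡ 0ℤ) → ∑ L (λ d → dvd ℓ d * f d) ≡ ∑ L (λ e → f (ℓ · e))
    reindex ℓ@(suc _) _ f f0 = trans (∑-cong L outer) (trans (∑-swap L L (λ d e → 𝟙 (d ℕ.≟ ℓ · e) * f d)) (∑-cong L (λ e _ → inner e)))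
      where
      outer : ∀ d → d ℕ.< L → dvd ℓ d * f d ≡ ∑ L (λ e → 𝟙 (d ℕ.≟ ℓ · e) * f d)
      outer d d<L = pick (ℓ ∣? d)
        where
        pick : Dec (ℓ ∣ d) → dvd ℓ d * f d ≡ ∑ L (λ e → 𝟙 (d ℕ.≟ ℓ · e) * f d)
        pick (yes (divides q e)) = trans (cong (_* f d) (trans (𝟙-yes (ℓ ∣? d) (divides q e)) (sym (𝟙-yes (d ℕ.≟ ℓ · q) d≡))))
            (sym (∑-single L q (λ e → 𝟙 (d ℕ.≟ ℓ · e) * f d) q<L (λ i _ i≢q → cong (_* f d) (𝟙-no (d ℕ.≟ ℓ · i) (λ h → i≢q (ℕ.*-cancelˡ-≡ i q ℓ (trans (sym h) d≡)))))))
          where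
          d≡ : d ≡ ℓ · q
          d≡ = trans e (ℕ.*-comm q ℓ)
          q<L : q ℕ.< L
          q<L = ℕ.≤-<-trans (subst (q ℕ.≤_) (sym d≡) (ℕ.m≤n*m q ℓ)) d<L
        pick (no n) = trans (cong (_* f d) (𝟙-no (ℓ ∣? d) n))
            (sym (trans (∑-cong L (λ e _ → cong (_* f d) (𝟙-no (d ℕ.≟ ℓ · e) (λ h → n (divides e (trans h (ℕ.*-comm ℓ e))))))) (∑-0 L)))
      inner : ∀ e → ∑ L (λ d → 𝟙 (d ℕ.≟ ℓ · e) * f d) ≡ f (ℓ · e)
      inner e = pick (ℓ · e ℕ.<? L)
        where
        pick : Dec (ℓ · e ℕ.< L) → ∑ L (λ d → 𝟙 (d ℕ.≟ ℓ · e) * f d) ≡ f (ℓ · e)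
        pick (yes lt) = trans (∑-single L (ℓ · e) (λ d → 𝟙 (d ℕ.≟ ℓ · e) * f d) lt (λ i _ ne → cong (_* f i) (𝟙-no (i ℕ.≟ ℓ · e) ne)))
                          (trans (cong (_* f (ℓ · e)) (𝟙-yes (ℓ · e ℕ.≟ ℓ · e) refl)) (*-identityˡ _))
        pick (no ge) = trans (trans (∑-cong L (λ i i<L → cong (_* f i) (𝟙-no (i ℕ.≟ ℓ · e) (λ h → ge (subst (ℕ._< L) h i<L))))) (∑-0 L))
                         (sym (f0 (ℓ · e) (ℕ.≮⇒≥ ge)))

    module _ {ℓ : ℕ} (pℓ : Prime ℓ) where
      private
        instance
          ℓ-nz : ℕ.NonZero ℓ
          ℓ-nz = prime⇒nonZero pℓ

      dvd-coprime : ∀ d k → ¬ (ℓ ∣ d) → dvd d (ℓ · k) ≡ dvd d k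
      dvd-coprime d k nd = 𝟙-cong (d ∣? (ℓ · k)) (d ∣? k) (coprime-divisor (prime∤⇒coprime pℓ nd)) (λ h → ∣-trans h (n∣m*n ℓ))

      P-∣ : ∀ k → P ℓ (ℓ · k) ≡ P ℓ k
      P-∣ k = ∑-cong L (λ d _ → pick d (ℓ ∣? d))
        where
        l : ∀ x y c → x * (1ℤ - 1ℤ) * c ≡ y * (1ℤ - 1ℤ) * c
        l = solve-∀
        pick : ∀ d → Dec (ℓ ∣ d) → dvd d (ℓ · k) * (1ℤ - dvd ℓ d) * c d ≡ dvd d k * (1ℤ - dvd ℓ d) * c d
        pick d (yes h) = subst (λ u → dvd d (ℓ · k) * (1ℤ - u) * c d ≡ dvd d k * (1ℤ - u) * c d) (sym (𝟙-yes (ℓ ∣? d) h)) (l (dvd d (ℓ · k)) (dvd d k) (c d))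
        pick d (no n) = cong (λ u → u * (1ℤ - dvd ℓ d) * c d) (dvd-coprime d k n)

      P-∤ : ∀ k → ¬ (ℓ ∣ k) → P ℓ k ≡ R k
      P-∤ k nd = ∑-cong L (λ d _ → cong (_* c d) (pick d (d ∣? k)))
        where
        pick : ∀ d → Dec (d ∣ k) → dvd d k * (1ℤ - dvd ℓ d) ≡ dvd d k
        pick d (yes h) = trans (cong (λ u → dvd d k * (1ℤ - u)) (𝟙-no (ℓ ∣? d) (λ e → nd (∣-trans e h)))) (*-identityʳ (dvd d k))
        pick d (no n) = trans (cong (_* (1ℤ - dvd ℓ d)) (𝟙-no (d ∣? k) n)) (sym (𝟙-no (d ∣? k) n))

      -- Divisors of `ℓk` prime to `ℓ` are divisors of `k` and give `P ℓ k`; the others are `ℓ · e`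
      -- with `e` dividing `k`. This recursion, valid also when `ℓ` divides `k`, replaces
      -- multiplicativity of `R`.
      R-ℓ* : ∀ k → 1 ℕ.≤ k → ℓ · k ℕ.< L → R (ℓ · k) ≡ c ℓ * R k + P ℓ k
      R-ℓ* k 1≤k lt = trans (∑-cong L (λ d _ → pick d (ℓ ∣? d))) (trans (∑-+ L (λ d → dvd ℓ d * f d) (λ d → dvd d k * (1ℤ - dvd ℓ d) * c d))
        (cong (λ u → u + P ℓ k) (trans (reindex ℓ (ℕ.>-nonZero⁻¹ ℓ) f f0) (trans (∑-cong L (λ e _ → scale e)) (∑-scale L (c ℓ) (λ e → dvd e k * c e))))))
        where
        f : ℕ → ℤ
        f d = dvd d (ℓ · k) * c d
        instance
          ℓk-nz : ℕ.NonZero (ℓ · k)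
          ℓk-nz = ℕ.m*n≢0 ℓ k {{ℓ-nz}} {{ℕ.>-nonZero 1≤k}}
        f0 : ∀ d → L ℕ.≤ d → f d ≡ 0ℤ
        f0 d L≤d = cong (_* c d) (𝟙-no (d ∣? (ℓ · k)) (λ h → ℕ.<⇒≱ (ℕ.<-≤-trans lt L≤d) (∣⇒≤ h)))
        r : ∀ x y z → x * (y * z) ≡ y * (x * z)
        r = solve-∀
        scale : ∀ e → f (ℓ · e) ≡ c ℓ * (dvd e k * c e)
        scale e = trans (cong₂ _*_ (𝟙-cong ((ℓ · e) ∣? (ℓ · k)) (e ∣? k) (*-cancelˡ-∣ ℓ) (*-monoʳ-∣ ℓ)) (c-mult ℓ e)) (r (dvd e k) (c ℓ) (c e))
        l₁ : ∀ x y c → x * c ≡ 1ℤ * (x * c) + y * (1ℤ - 1ℤ) * c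
        l₁ = solve-∀
        l₂ : ∀ x y c → y * c ≡ 0ℤ * (x * c) + y * (1ℤ - 0ℤ) * c
        l₂ = solve-∀
        pick : ∀ d → Dec (ℓ ∣ d) → dvd d (ℓ · k) * c d ≡ dvd ℓ d * f d + dvd d k * (1ℤ - dvd ℓ d) * c d
        pick d (yes h) = subst (λ u → dvd d (ℓ · k) * c d ≡ u * f d + dvd d k * (1ℤ - u) * c d) (sym (𝟙-yes (ℓ ∣? d) h)) (l₁ (dvd d (ℓ · k)) (dvd d k) (c d))
        pick d (no n) = subst (λ u → dvd d (ℓ · k) * c d ≡ u * f d + dvd d k * (1ℤ - u) * c d) (sym (𝟙-no (ℓ ∣? d) n))
          (trans (cong (_* c d) (dvd-coprime d k n)) (l₂ (dvd d (ℓ · k)) (dvd d k) (c d)))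

      module Inert (cℓ : c ℓ ≡ -1ℤ) where
        R-inert : ∀ k → 1 ℕ.≤ k → ℓ · k ℕ.< L → ¬ (ℓ ∣ k) → R (ℓ · k) ≡ 0ℤ
        R-inert k 1≤k lt nd = trans (R-ℓ* k 1≤k lt) (trans (cong₂ (λ u v → u * R k + v) cℓ (P-∤ k nd)) (l (R k)))
          where l : ∀ x → -1ℤ * x + x ≡ 0ℤ
                l = solve-∀

        R-inert² : ∀ k → 1 ℕ.≤ k → ℓ · (ℓ · k) ℕ.< L → R (ℓ · (ℓ · k)) ≡ R k
        R-inert² k 1≤k lt = trans (R-ℓ* (ℓ · k) 1≤ℓk lt) (trans (cong₂ (λ u v → c ℓ * u + v) (R-ℓ* k 1≤k lt′) (P-∣ k))
            (trans (cong (λ u → u * (u * R k + P ℓ k) + P ℓ k) cℓ) (l (R k) (P ℓ k))))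
          where
          l : ∀ x p → -1ℤ * (-1ℤ * x + p) + p ≡ x
          l = solve-∀
          1≤ℓk : 1 ℕ.≤ ℓ · k
          1≤ℓk = ℕ.*-mono-≤ (ℕ.>-nonZero⁻¹ ℓ) 1≤k
          lt′ : ℓ · k ℕ.< L
          lt′ = ℕ.≤-<-trans (ℕ.m≤n*m (ℓ · k) ℓ) lt

    R-1 : 1 ℕ.< L → R 1 ≡ 1ℤ
    R-1 lt = trans (∑-single L 1 (λ d → dvd d 1 * c d) lt (λ d _ ne → cong (_* c d) (𝟙-no (d ∣? 1) (λ h → ne (∣1⇒≡1 h)))))
               (trans (cong (_* c 1) (𝟙-yes (1 ∣? 1) ∣-refl)) (trans (*-identityˡ (c 1)) c-unit))

    private
      -- Split and ramified primes keep `R-ℓ*` a sum of nonnegative terms. At an inert prime the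
      -- recursion has a minus sign, but there `R` is 0 or is unchanged by removing `ℓ²`. `P`
      -- reduces to `R` by stripping all factors `ℓ`.
      R≥0′ : ∀ fuel n → n ℕ.≤ fuel → 1 ℕ.≤ n → n ℕ.< L → 0ℤ ≤ R n
      P≥0′ : ∀ fuel {ℓ} → Prime ℓ → ∀ n → n ℕ.≤ fuel → 1 ℕ.≤ n → n ℕ.< L → 0ℤ ≤ P ℓ n
      P≥0′ fuel {ℓ} pℓ n n≤ 1≤n lt with ℓ ∣? n
      P≥0′ fuel {ℓ} pℓ n n≤ 1≤n lt | no nd = subst (0ℤ ≤_) (sym (P-∤ pℓ n nd)) (R≥0′ fuel n n≤ 1≤n lt)
      P≥0′ zero pℓ n n≤ 1≤n lt | yes _ = ⊥-elim (ℕ.<⇒≱ 1≤n n≤)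
      P≥0′ (suc fuel) {ℓ} pℓ n n≤ 1≤n lt | yes (divides k e) =
        let e′ = trans e (ℕ.*-comm k ℓ) ; 1≤k , k<n = cofactor 1≤n pℓ e′ in
        subst (0ℤ ≤_) (sym (trans (cong (P ℓ) e′) (P-∣ pℓ k))) (P≥0′ fuel pℓ k (ℕ.≤-pred (ℕ.≤-trans k<n n≤)) 1≤k (ℕ.<-trans k<n lt))
      R≥0′ zero n n≤ 1≤n lt = ⊥-elim (ℕ.<⇒≱ 1≤n n≤)
      R≥0′ (suc fuel) 1 _ _ lt = subst (0ℤ ≤_) (sym (R-1 lt)) (+≤+ z≤n)
      R≥0′ (suc fuel) n@(suc (suc _)) n≤ 1≤n lt with prime-factor n (s≤s (s≤s z≤n))
      ... | ℓ , k , pℓ , e = subst (λ u → 0ℤ ≤ R u) (sym e) (pick (c ℓ) (c-tri ℓ) refl)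
        where
        1≤k = proj₁ (cofactor 1≤n pℓ e)
        k<n = proj₂ (cofactor 1≤n pℓ e)
        k≤ = ℕ.≤-pred (ℕ.≤-trans k<n n≤)
        k<L = ℕ.<-trans k<n lt
        ℓk<L = subst (ℕ._< L) e lt
        formula : ∀ z → c ℓ ≡ z → R (ℓ · k) ≡ z * R k + P ℓ k
        formula z ez = trans (R-ℓ* pℓ k 1≤k ℓk<L) (cong (λ u → u * R k + P ℓ k) ez)
        Pk = P≥0′ fuel pℓ k k≤ 1≤k k<L
        pick : ∀ z → Tri z → c ℓ ≡ z → 0ℤ ≤ R (ℓ · k)
        pick _ zer ez = subst (0ℤ ≤_) (sym (trans (formula 0ℤ ez) (+-identityˡ (P ℓ k)))) Pk
        pick _ one ez = subst (0ℤ ≤_) (sym (trans (formula 1ℤ ez) (cong (λ u → u + P ℓ k) (*-identityˡ (R k))))) (0≤+ (R≥0′ fuel k k≤ 1≤k k<L) Pk)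
        pick _ min ez with ℓ ∣? k
        ... | no nd = ≤-reflexive (sym (Inert.R-inert pℓ ez k 1≤k ℓk<L nd))
        ... | yes (divides j f) = subst (0ℤ ≤_) (sym (trans (cong (λ u → R (ℓ · u)) f′) (Inert.R-inert² pℓ ez j 1≤j (subst (λ u → ℓ · u ℕ.< L) f′ ℓk<L))))
                                     (R≥0′ fuel j (ℕ.≤-trans (ℕ.<⇒≤ j<k) k≤) 1≤j (ℕ.<-trans j<k k<L))
          where
          f′ = trans f (ℕ.*-comm j ℓ)
          1≤j = proj₁ (cofactor 1≤k pℓ f′)
          j<k = proj₂ (cofactor 1≤k pℓ f′)

    R≥0 : ∀ n → 1 ℕ.≤ n → n ℕ.< L → 0ℤ ≤ R n
    R≥0 n = R≥0′ n n ℕ.≤-refl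

    P≥0 : ∀ {ℓ} → Prime ℓ → ∀ n → 1 ℕ.≤ n → n ℕ.< L → 0ℤ ≤ P ℓ n
    P≥0 pℓ n = P≥0′ n pℓ n ℕ.≤-refl

    R-split : ∀ fuel n → n ℕ.≤ fuel → 1 ℕ.≤ n → n ℕ.< L → (∀ ℓ → Prime ℓ → ℓ ∣ n → c ℓ ≡ 1ℤ) → 1ℤ ≤ R n
    R-split zero n n≤ 1≤n lt h = ⊥-elim (ℕ.<⇒≱ 1≤n n≤)
    R-split (suc fuel) 1 _ _ lt h = ≤-reflexive (sym (R-1 lt))
    R-split (suc fuel) n@(suc (suc _)) n≤ 1≤n lt h with prime-factor n (s≤s (s≤s z≤n))
    ... | ℓ , k , pℓ , e = subst (λ u → 1ℤ ≤ R u) (sym e) (subst (1ℤ ≤_) (sym formula)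
          (+-mono-≤ (R-split fuel k k≤ 1≤k k<L (λ q pq d → h q pq (∣-trans d (divides ℓ e)))) (P≥0 pℓ k 1≤k k<L)))
      where
      1≤k = proj₁ (cofactor 1≤n pℓ e)
      k<n = proj₂ (cofactor 1≤n pℓ e)
      k≤ = ℕ.≤-pred (ℕ.≤-trans k<n n≤)
      k<L = ℕ.<-trans k<n lt
      formula : R (ℓ · k) ≡ R k + P ℓ k
      formula = trans (R-ℓ* pℓ k 1≤k (subst (ℕ._< L) e lt)) (cong (λ u → u + P ℓ k)
        (trans (cong (_* R k) (h ℓ pℓ (divides k (trans e (ℕ.*-comm ℓ k))))) (*-identityˡ (R k))))

    IsInert : ℕ → ℕ → Set
    IsInert n ℓ = Prime ℓ × ℓ ∣ n × c ℓ ≡ -1ℤ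

    inert? : ∀ n → 1 ℕ.≤ n → (∃[ ℓ ] IsInert n ℓ) ⊎ (∀ ℓ → ¬ IsInert n ℓ)
    inert? n 1≤n with search {P = IsInert n} (λ ℓ → prime? ℓ ×-dec (ℓ ∣? n ×-dec c ℓ ≟ -1ℤ)) (suc n)
    ... | inj₁ (ℓ , _ , i) = inj₁ (ℓ , i)
    ... | inj₂ none = inj₂ (λ ℓ i → none ℓ (s≤s (∣⇒≤ {{ℕ.>-nonZero 1≤n}} (proj₁ (proj₂ i)))) i)

    no-inert⇒split : ∀ n → (∀ ℓ → Prime ℓ → ℓ ∣ n → c ℓ ≢ 0ℤ) → (∀ ℓ → ¬ IsInert n ℓ) → ∀ ℓ → Prime ℓ → ℓ ∣ n → c ℓ ≡ 1ℤ
    no-inert⇒split n nz ni ℓ pℓ d = pick (c ℓ) (c-tri ℓ) refl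
      where
      pick : ∀ z → Tri z → c ℓ ≡ z → c ℓ ≡ 1ℤ
      pick _ zer e = ⊥-elim (nz ℓ pℓ d e)
      pick _ one e = e
      pick _ min e = ⊥-elim (ni ℓ (pℓ , d , e))

    module _ (Rep : ℕ → Set) (Rep-nz : ∀ {n} → Rep n → ∀ ℓ → Prime ℓ → ℓ ∣ n → c ℓ ≢ 0ℤ)
             (Rep-inert : ∀ {n} → Rep n → ∀ ℓ → IsInert n ℓ → ∃[ k ] n ≡ ℓ · (ℓ · k) × Rep k) where

      -- For `Rep` closed under removing squares of inert primes: remove them all, and `R-split`
      -- applies to what remains.
      R-rep : ∀ fuel n → n ℕ.≤ fuel → 1 ℕ.≤ n → n ℕ.< L → Rep n → 1ℤ ≤ R n
      R-rep zero n n≤ 1≤n lt rep = ⊥-elim (ℕ.<⇒≱ 1≤n n≤)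
      R-rep (suc fuel) n n≤ 1≤n lt rep with inert? n 1≤n
      ... | inj₂ ni = R-split n n ℕ.≤-refl 1≤n lt (no-inert⇒split n (Rep-nz rep) ni)
      ... | inj₁ (ℓ , i@(pℓ , _ , cℓ)) with Rep-inert rep ℓ i
      ... | k , e , rep′ = subst (1ℤ ≤_) (sym (trans (cong R e) (Inert.R-inert² pℓ cℓ k 1≤k (subst (ℕ._< L) e lt))))
                             (R-rep fuel k (ℕ.≤-pred (ℕ.≤-trans (ℕ.≤-<-trans k≤ℓk ℓk<n) n≤)) 1≤k (ℕ.≤-<-trans k≤ℓk (ℕ.<-trans ℓk<n lt)) rep′)
        where
        1≤ℓk = proj₁ (cofactor 1≤n pℓ e)
        ℓk<n = proj₂ (cofactor 1≤n pℓ e)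
        1≤k = proj₁ (cofactor 1≤ℓk pℓ refl)
        k≤ℓk = ℕ.<⇒≤ (proj₂ (cofactor 1≤ℓk pℓ refl))

    -- An inert prime that divides `n` exactly once would make `R n` vanish. So inert primes come
    -- off in squares, which go into `f`, and the squarefree part has split primes only.
    R≢0⇒split : ∀ fuel n → n ℕ.≤ fuel → 1 ℕ.≤ n → n ℕ.< L → (∀ ℓ → Prime ℓ → ℓ ∣ n → c ℓ ≢ 0ℤ) → R n ≢ 0ℤ →
      ∃[ qs ] ∃[ f ] n ≡ ∏ₗ qs · (f · f) × All Prime qs × AllPairs _≢_ qs × All (λ q → c q ≡ 1ℤ) qs
    R≢0⇒split zero n n≤ 1≤n lt nz R≢0 = ⊥-elim (ℕ.<⇒≱ 1≤n n≤)
    R≢0⇒split (suc fuel) n n≤ 1≤n lt nz R≢0 with inert? n 1≤n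
    ... | inj₂ ni with squarefree-part n 1≤n
    ... | qs , f , e , pqs , us , ds = qs , f , e , pqs , us , All.zipWith (λ { {q} (pq , d) → no-inert⇒split n nz ni q pq d }) (pqs , ds)
    R≢0⇒split (suc fuel) n n≤ 1≤n lt nz R≢0 | inj₁ (ℓ , pℓ , divides k e , cℓ) with ℓ ∣? k
    ... | no nd = ⊥-elim (R≢0 (trans (cong R e′) (Inert.R-inert pℓ cℓ k (proj₁ (cofactor 1≤n pℓ e′)) (subst (ℕ._< L) e′ lt) nd)))
      where e′ = trans e (ℕ.*-comm k ℓ)
    ... | yes (divides j f) with R≢0⇒split fuel j (ℕ.≤-pred (ℕ.≤-trans (ℕ.<-trans j<k k<n) n≤)) 1≤j (ℕ.<-trans j<k (ℕ.<-trans k<n lt))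
                                   (λ q pq d → nz q pq (∣-trans d (∣-trans (divides ℓ f′) (divides ℓ e′)))) (λ h → R≢0 (trans Rn≡ h))
      where
      e′ = trans e (ℕ.*-comm k ℓ)
      f′ = trans f (ℕ.*-comm j ℓ)
      1≤k = proj₁ (cofactor 1≤n pℓ e′)
      k<n = proj₂ (cofactor 1≤n pℓ e′)
      1≤j = proj₁ (cofactor 1≤k pℓ f′)
      j<k = proj₂ (cofactor 1≤k pℓ f′)
      Rn≡ : R n ≡ R j
      Rn≡ = trans (cong R (trans e′ (cong (ℓ ·_) f′))) (Inert.R-inert² pℓ cℓ j 1≤j (subst (ℕ._< L) (trans e′ (cong (ℓ ·_) f′)) lt))
    ... | qs , g , eq , rest = qs , ℓ · g , trans e (trans (ℕ.*-comm k ℓ) (trans (cong (ℓ ·_) (trans f (trans (ℕ.*-comm j ℓ) (cong (ℓ ·_) eq)))) (l ℓ (∏ₗ qs) g))) , rest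
      where l : ∀ ℓ P f → ℓ · (ℓ · (P · (f · f))) ≡ P · (ℓ · f · (ℓ · f))
            l = ℕ-solve-∀

-- The Jacobi symbol and its reciprocity

module JacobiSymbol where

  open LegendreSymbol
  open QuadraticReciprocity
  open Characters
  open CharacterSums using (∏ₗ)
  open import Data.Nat as ℕ using (ℕ; zero; suc; ⌊_/2⌋)
  import Data.Nat.Properties as ℕ
  open import Data.Nat.DivMod using (_%_; [m+kn]%n≡m%n)
  open import Data.Nat.Primality using (prime?)
  open import Data.Nat.Tactic.RingSolver renaming (solve-∀ to ℕ-solve-∀)
  open import Data.Integer using (ℤ; +_; 0ℤ; 1ℤ; -1ℤ; _+_; _-_; _*_; -_; _^_)
  open import Data.Integer.Properties
  open import Data.Integer.Divisibility.Signed using (_∣_; divides; ∣⇒∣ᵤ)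
  open import Data.Integer.Tactic.RingSolver using (solve-∀)
  open import Data.List using (List; []; _∷_)
  open import Data.List.Relation.Unary.All as All using (All; []; _∷_)

  Jac : List ℕ → ℤ → ℤ
  Jac [] a = 1ℤ
  Jac (p ∷ ps) a = χ p a * Jac ps a

  Jac-* : ∀ {ps} → All OddPrime ps → ∀ a b → Jac ps (a * b) ≡ Jac ps a * Jac ps b
  Jac-* [] a b = refl
  Jac-* {p ∷ ps} (op ∷ ops) a b = trans (cong₂ _*_ (Symbol.χ-* op a b) (Jac-* ops a b)) (l (χ p a) (χ p b) (Jac ps a) (Jac ps b))
    where l : ∀ a b c d → a * b * (c * d) ≡ a * c * (b * d)
          l = solve-∀

  -- The symbol of -1 over the product of the list, equal to ±1 according to the class of that
  -- product modulo 4.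
  κ : List ℕ → ℤ
  κ [] = 1ℤ
  κ (p ∷ ps) = -1ℤ ^ ⌊ p /2⌋ * κ ps

  Jac-neg1 : ∀ {ps} → All OddPrime ps → Jac ps -1ℤ ≡ κ ps
  Jac-neg1 [] = refl
  Jac-neg1 (op ∷ ops) = cong₂ _*_ (Symbol.χ-neg1 op) (Jac-neg1 ops)

  parity : ∀ n → (∃[ j ] n ≡ j ℕ.+ j × -1ℤ ^ n ≡ 1ℤ) ⊎ (∃[ j ] n ≡ suc (j ℕ.+ j) × -1ℤ ^ n ≡ -1ℤ)
  parity zero = inj₁ (0 , refl , refl)
  parity (suc n) with parity n
  ... | inj₁ (j , e , f) = inj₂ (j , cong suc e , cong (-1ℤ *_) f)
  ... | inj₂ (j , e , f) = inj₁ (suc j , trans (cong suc e) (cong suc (sym (ℕ.+-suc j j))) , cong (-1ℤ *_) f)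

  κ-mod4 : ∀ {ps} → All OddPrime ps → (κ ps ≡ 1ℤ × ∃[ k ] ∏ₗ ps ≡ 1 ℕ.+ k ℕ.* 4) ⊎ (κ ps ≡ -1ℤ × ∃[ k ] ∏ₗ ps ≡ 3 ℕ.+ k ℕ.* 4)
  κ-mod4 [] = inj₁ (refl , 0 , refl)
  κ-mod4 {p ∷ ps} (op ∷ ops) with parity ⌊ p /2⌋ | κ-mod4 ops
  ... | inj₁ (j , e , f) | inj₁ (g , k , q) = inj₁ (cong₂ _*_ f g , j ℕ.+ k ℕ.+ 4 ℕ.* (j ℕ.* k) , trans (cong₂ ℕ._*_ (trans (OddPrime.odd op) (cong (λ h → suc (h ℕ.+ h)) e)) q) (l j k))
    where l : ∀ j k → suc (j ℕ.+ j ℕ.+ (j ℕ.+ j)) ℕ.* (1 ℕ.+ k ℕ.* 4) ≡ 1 ℕ.+ (j ℕ.+ k ℕ.+ 4 ℕ.* (j ℕ.* k)) ℕ.* 4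
          l = ℕ-solve-∀
  ... | inj₁ (j , e , f) | inj₂ (g , k , q) = inj₂ (cong₂ _*_ f g , 3 ℕ.* j ℕ.+ k ℕ.+ 4 ℕ.* (j ℕ.* k) , trans (cong₂ ℕ._*_ (trans (OddPrime.odd op) (cong (λ h → suc (h ℕ.+ h)) e)) q) (l j k))
    where l : ∀ j k → suc (j ℕ.+ j ℕ.+ (j ℕ.+ j)) ℕ.* (3 ℕ.+ k ℕ.* 4) ≡ 3 ℕ.+ (3 ℕ.* j ℕ.+ k ℕ.+ 4 ℕ.* (j ℕ.* k)) ℕ.* 4
          l = ℕ-solve-∀
  ... | inj₂ (j , e , f) | inj₁ (g , k , q) = inj₂ (cong₂ _*_ f g , j ℕ.+ 3 ℕ.* k ℕ.+ 4 ℕ.* (j ℕ.* k) , trans (cong₂ ℕ._*_ (trans (OddPrime.odd op) (cong (λ h → suc (h ℕ.+ h)) e)) q) (l j k))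
    where l : ∀ j k → suc (suc (j ℕ.+ j) ℕ.+ suc (j ℕ.+ j)) ℕ.* (1 ℕ.+ k ℕ.* 4) ≡ 3 ℕ.+ (j ℕ.+ 3 ℕ.* k ℕ.+ 4 ℕ.* (j ℕ.* k)) ℕ.* 4
          l = ℕ-solve-∀
  ... | inj₂ (j , e , f) | inj₂ (g , k , q) = inj₁ (cong₂ _*_ f g , 2 ℕ.+ 3 ℕ.* j ℕ.+ 3 ℕ.* k ℕ.+ 4 ℕ.* (j ℕ.* k) , trans (cong₂ ℕ._*_ (trans (OddPrime.odd op) (cong (λ h → suc (h ℕ.+ h)) e)) q) (l j k))
    where l : ∀ j k → suc (suc (j ℕ.+ j) ℕ.+ suc (j ℕ.+ j)) ℕ.* (3 ℕ.+ k ℕ.* 4) ≡ 1 ℕ.+ (2 ℕ.+ 3 ℕ.* j ℕ.+ 3 ℕ.* k ℕ.+ 4 ℕ.* (j ℕ.* k)) ℕ.* 4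
          l = ℕ-solve-∀

  κ≡-1 : ∀ {ps k} → All OddPrime ps → ∏ₗ ps ≡ 3 ℕ.+ k ℕ.* 4 → κ ps ≡ -1ℤ
  κ≡-1 {ps} {k} ops e with κ-mod4 ops
  ... | inj₂ (g , _) = g
  ... | inj₁ (_ , j , f) = ⊥-elim (absurd (trans (sym ([m+kn]%n≡m%n 1 j 4)) (trans (cong (_% 4) (trans (sym f) e)) ([m+kn]%n≡m%n 3 k 4))))
    where absurd : 1 ≢ 3
          absurd ()

  Jac-reciprocity : ∀ {ℓ ps} → OddPrime ℓ → All OddPrime ps → All (_≢ ℓ) ps → Jac ps (+ ℓ) ≡ χ ℓ (+ ∏ₗ ps) * κ ps ^ ⌊ ℓ /2⌋
  Jac-reciprocity {ℓ} oℓ [] [] = sym (cong₂ _*_ (Symbol.χ-1 oℓ) (^-zeroˡ ⌊ ℓ /2⌋))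
  Jac-reciprocity {ℓ} {p ∷ ps} oℓ (op ∷ ops) (ne ∷ nes) =
    trans (cong₂ _*_ flip (Jac-reciprocity oℓ ops nes)) (trans (l (χ ℓ (+ p)) (κp ^ h) (χ ℓ (+ ∏ₗ ps)) (κ ps ^ h))
      (sym (cong₂ _*_ (trans (cong (χ ℓ) (pos-* p (∏ₗ ps))) (Symbol.χ-* oℓ (+ p) (+ ∏ₗ ps))) (^-distribˡ-* h κp (κ ps)))))
    where
    h = ⌊ ℓ /2⌋
    κp = -1ℤ ^ ⌊ p /2⌋
    l : ∀ a b c d → a * b * (c * d) ≡ a * c * (b * d)
    l = solve-∀
    recip : χ p (+ ℓ) * χ ℓ (+ p) ≡ κp ^ h
    recip = trans (Reciprocity.reciprocity op oℓ ne) (trans (^-*-assoc -1ℤ h ⌊ p /2⌋) (trans (cong (-1ℤ ^_) (ℕ.*-comm h ⌊ p /2⌋)) (sym (^-*-assoc -1ℤ ⌊ p /2⌋ h))))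
    ∤ : ¬ (+ ℓ ∣ + p)
    ∤ d = prime∤prime (OddPrime.prime oℓ) (OddPrime.prime op) (≢-sym ne) (∣⇒∣ᵤ d)
    cancel : ∀ x y z → (y ≡ 1ℤ ⊎ y ≡ -1ℤ) → x * y ≡ z → x ≡ y * z
    cancel x _ z (inj₁ refl) e = trans (sym (*-identityʳ x)) (trans e (sym (*-identityˡ z)))
    cancel x _ z (inj₂ refl) refl = r x
      where r : ∀ x → x ≡ -1ℤ * (x * -1ℤ)
            r = solve-∀
    flip : χ p (+ ℓ) ≡ χ ℓ (+ p) * κp ^ h
    flip = cancel (χ p (+ ℓ)) (χ ℓ (+ p)) (κp ^ h) (Symbol.χ-∤ oℓ ∤) recip

  -- For `m ≡ 3` modulo 4 the reciprocity sign is `(-1/ℓ)`, so it is absorbed by replacing `m` with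
  -- `-m`. Thus the Jacobi symbol over `m` is the character of ℚ(√-m) on odd primes not dividing
  -- `m`.
  Jac-flip : ∀ {ℓ ps k} → OddPrime ℓ → All OddPrime ps → All (_≢ ℓ) ps → ∏ₗ ps ≡ 3 ℕ.+ k ℕ.* 4 → Jac ps (+ ℓ) ≡ χ ℓ (- + ∏ₗ ps)
  Jac-flip {ℓ} {ps} {k} oℓ ops nes e = trans (Jac-reciprocity oℓ ops nes) (trans (cong (χ ℓ (+ ∏ₗ ps) *_) (trans (cong (_^ ⌊ ℓ /2⌋) (κ≡-1 {k = k} ops e)) (sym (Symbol.χ-neg1 oℓ))))
    (trans (sym (Symbol.χ-* oℓ (+ ∏ₗ ps) -1ℤ)) (cong (χ ℓ) (l (+ ∏ₗ ps)))))
    where l : ∀ x → x * -1ℤ ≡ - x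
          l = solve-∀

  oddPrime5 : OddPrime 5
  oddPrime5 = oddPrime (from-yes (prime? 5)) refl

  -- `(-1/m) = -1` since `m ≡ 3` modulo 4, and `(5/m) = (-m/5) = -1` since `(-m)² ≡ -1` modulo 5.
  Jac-neg5 : ∀ {ps k j} → All OddPrime ps → ∏ₗ ps ≡ 3 ℕ.+ k ℕ.* 4 → + ∏ₗ ps * + ∏ₗ ps + 1ℤ ≡ + 5 * j → All (_≢ 5) ps → Jac ps (- + 5) ≡ 1ℤ
  Jac-neg5 {ps} {k} {j} ops e h5 nes = trans (Jac-* ops -1ℤ (+ 5)) (cong₂ _*_ (trans (Jac-neg1 ops) (κ≡-1 {k = k} ops e)) (trans (Jac-flip {k = k} oddPrime5 ops nes e) χ5))
    where
    open Mod (+ 5)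
    l : ∀ m j → m * m + 1ℤ ≡ + 5 * j → - m * (- m * 1ℤ) - -1ℤ ≡ j * + 5
    l m j h = trans (r m) (trans h (*-comm (+ 5) j))
      where r : ∀ m → - m * (- m * 1ℤ) - -1ℤ ≡ m * m + 1ℤ
            r = solve-∀
    χ5 : χ 5 (- + ∏ₗ ps) ≡ -1ℤ
    χ5 = Symbol.χ-unique oddPrime5 (- + ∏ₗ ps) min (mod (divides j (l (+ ∏ₗ ps) j h5)))

  odd≡1⇒ : ∀ n → odd n ≢ 0ℤ → n ≡ suc (⌊ n /2⌋ ℕ.+ ⌊ n /2⌋)
  odd≡1⇒ 0 nz = ⊥-elim (nz refl)
  odd≡1⇒ 1 nz = refl
  odd≡1⇒ (suc (suc n)) nz = cong suc (trans (cong suc (odd≡1⇒ n nz)) (cong suc (sym (ℕ.+-suc ⌊ n /2⌋ ⌊ n /2⌋))))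

  odd-of-odd : ∀ h → odd (suc (h ℕ.+ h)) ≡ 1ℤ
  odd-of-odd zero = refl
  odd-of-odd (suc h) = trans (cong (λ u → odd (suc (suc u))) (ℕ.+-suc h h)) (odd-of-odd h)

  oddPrime-odd : ∀ {p} → OddPrime p → odd p ≡ 1ℤ
  oddPrime-odd {p} op = trans (cong odd (OddPrime.odd op)) (odd-of-odd ⌊ p /2⌋)

-- Existence of a norm with prescribed symbols

module GenusExistence where

  open Folds
  open LegendreSymbol
  open QuadraticReciprocity using (prime∤prime)
  open Characters
  open CharacterSums
  open DivisorSums
  open JacobiSymbol
  open import Data.Nat as ℕ using (ℕ; zero; suc; z≤n; s≤s) renaming (_*_ to _·_)
  import Data.Nat.Properties as ℕ
  import Data.Nat.Divisibility as ℕ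
  open import Data.Nat.Coprimality using (Coprime) renaming (sym to coprime-sym)
  open import Data.Nat.Primality using (Prime; euclidsLemma)
  open import Data.Nat.Tactic.RingSolver renaming (solve-∀ to ℕ-solve-∀)
  open import Data.Integer using (ℤ; +_; 0ℤ; 1ℤ; -1ℤ; _+_; _-_; _*_; -_; _^_; _≤_; _≟_; ∣_∣; +≤+)
  open import Data.Integer.Properties hiding (_≟_)
  open import Data.Integer.Divisibility.Signed using (_∣_; divides; ∣⇒∣ᵤ; ∣ᵤ⇒∣)
  open import Data.Integer.Tactic.RingSolver using (solve-∀)
  open import Data.List using (List; []; _∷_; length)
  open import Data.List.Relation.Unary.All as All using (All; []; _∷_)
  open import Data.List.Relation.Unary.AllPairs using (AllPairs; []; _∷_)
  open import Relation.Binary using (tri<; tri≈; tri>)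

  ∑-mono : ∀ n (f g : ℕ → ℤ) → (∀ i → i ℕ.< n → f i ≤ g i) → ∑ n f ≤ ∑ n g
  ∑-mono zero f g h = ≤-refl
  ∑-mono (suc n) f g h = +-mono-≤ (∑-mono n f g (λ i p → h i (ℕ.m<n⇒m<1+n p))) (h n ℕ.≤-refl)

  ∑-const : ∀ n c → ∑ n (λ _ → + c) ≡ + (n · c)
  ∑-const zero c = refl
  ∑-const (suc n) c = trans (cong (λ u → u + + c) (∑-const n c)) (cong +_ (ℕ.+-comm (n · c) c))

  ∑≢0 : ∀ n (f : ℕ → ℤ) → ∑ n f ≢ 0ℤ → ∃[ i ] i ℕ.< n × f i ≢ 0ℤ
  ∑≢0 zero f h = ⊥-elim (h refl)
  ∑≢0 (suc n) f h = pick (f n ≟ 0ℤ)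
    where
    pick : Dec (f n ≡ 0ℤ) → ∃[ i ] i ℕ.< suc n × f i ≢ 0ℤ
    pick (no ne) = n , ℕ.≤-refl , ne
    pick (yes e) with ∑≢0 n f (λ z → h (cong₂ _+_ z e))
    ... | i , i<n , ne = i , ℕ.m<n⇒m<1+n i<n , ne

  search₂ : ∀ I J n (φ : ℕ → ℕ → ℕ) → (∃[ i ] ∃[ j ] i ℕ.< I × j ℕ.< J × φ i j ≡ n) ⊎ (∀ i j → i ℕ.< I → j ℕ.< J → φ i j ≢ n)
  search₂ zero J n φ = inj₂ (λ i j ())
  search₂ (suc I) J n φ with search (λ j → φ I j ℕ.≟ n) J | search₂ I J n φ
  ... | inj₁ (j , j< , e) | _ = inj₁ (I , j , ℕ.≤-refl , j< , e)
  ... | inj₂ _ | inj₁ (i , j , i< , j< , e) = inj₁ (i , j , ℕ.m<n⇒m<1+n i< , j< , e)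
  ... | inj₂ none | inj₂ none′ = inj₂ λ i j i< j< → pick i j j< (<1+⇒<∨≡ i<)
    where
    pick : ∀ i j → j ℕ.< J → i ℕ.< I ⊎ i ≡ I → φ i j ≢ n
    pick i j j< (inj₁ lt) = none′ i j lt j<
    pick i j j< (inj₂ refl) = none j j<

  ∑-image : ∀ L I J (φ : ℕ → ℕ → ℕ) (w : ℕ → ℤ) →
    (∀ i j → i ℕ.< I → j ℕ.< J → φ i j ℕ.< L) →
    (∀ i j i′ j′ → i ℕ.< I → j ℕ.< J → i′ ℕ.< I → j′ ℕ.< J → φ i j ≡ φ i′ j′ → i ≡ i′ × j ≡ j′) →
    (∀ n → n ℕ.< L → 0ℤ ≤ w n) → (∀ i j → i ℕ.< I → j ℕ.< J → 1ℤ ≤ w (φ i j)) → + (I · J) ≤ ∑ L w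
  ∑-image L I J φ w φ<L inj w≥0 w≥1 = subst (_≤ ∑ L w) count (∑-mono L hits w below)
    where
    ind : ℕ → ℕ → ℕ → ℤ
    ind i j n = 𝟙 (φ i j ℕ.≟ n)
    hits : ℕ → ℤ
    hits n = ∑ I (λ i → ∑ J (λ j → ind i j n))
    count : ∑ L hits ≡ + (I · J)
    count = trans (∑-swap L I (λ n i → ∑ J (λ j → ind i j n))) (trans (∑-cong I (λ i i< → trans (∑-swap L J (λ n j → ind i j n))
       (trans (∑-cong J (λ j j< → trans (∑-single L (φ i j) (ind i j) (φ<L i j i< j<) (λ n _ ne → 𝟙-no (φ i j ℕ.≟ n) (≢-sym ne))) (𝟙-yes (φ i j ℕ.≟ φ i j) refl)))
          (trans (∑-const J 1) (cong +_ (ℕ.*-identityʳ J)))))) (∑-const I J))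
    below : ∀ n → n ℕ.< L → hits n ≤ w n
    below n n<L = pick (search₂ I J n φ)
      where
      pick : (∃[ i ] ∃[ j ] i ℕ.< I × j ℕ.< J × φ i j ≡ n) ⊎ (∀ i j → i ℕ.< I → j ℕ.< J → φ i j ≢ n) → hits n ≤ w n
      pick (inj₂ none) = subst (_≤ w n) (sym (trans (∑-cong I (λ i i< → trans (∑-cong J (λ j j< → 𝟙-no (φ i j ℕ.≟ n) (none i j i< j<))) (∑-0 J))) (∑-0 I))) (w≥0 n n<L)
      pick (inj₁ (i , j , i< , j< , refl)) = subst (_≤ w (φ i j)) (sym (trans
        (∑-single I i (λ i′ → ∑ J (λ j′ → ind i′ j′ (φ i j))) i< (λ i′ i′< ne → trans (∑-cong J (λ j′ j′< → 𝟙-no (φ i′ j′ ℕ.≟ φ i j) (λ e → ne (proj₁ (inj i′ j′ i j i′< j′< i< j< e))))) (∑-0 J)))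
        (trans (∑-single J j (λ j′ → ind i j′ (φ i j)) j< (λ j′ j′< ne → 𝟙-no (φ i j′ ℕ.≟ φ i j) (λ e → ne (proj₂ (inj i j′ i j i< j′< i< j< e)))))
          (𝟙-yes (φ i j ℕ.≟ φ i j) refl)))) (w≥1 i j i< j<)

  module Convolve (X : ℕ) (c : ℕ → ℤ) (c-mult : ∀ x y → c (x · y) ≡ c x * c y) (c-tri : ∀ x → Tri (c x)) (c-unit : c 1 ≡ 1ℤ) where
    open Hyperbola X
    open DivSum L c c-mult c-tri c-unit

    -- Collect the pairs by `n = ab`; then `b` runs through the divisors of `n`. Pairs with product
    -- 0 do not form a divisor sum, and `G 0 ≡ 0ℤ` discards them.
    Tot-conv : (G : ℕ → ℤ) → G 0 ≡ 0ℤ → Tot (λ a b → G (a · b) * c b) ≡ ∑ L (λ n → G n * R n)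
    Tot-conv G G0 =
      trans (∑-cong L (λ a _ → ∑-cong L (λ b _ → spread a b)))
      (trans (∑-cong L (λ a _ → ∑-swap L L (λ b n → 𝟙 (a · b ℕ.≟ n) * (G n * c b))))
      (trans (∑-swap L L (λ a n → ∑ L (λ b → 𝟙 (a · b ℕ.≟ n) * (G n * c b))))
      (∑-cong L (λ n n<L → collect n n<L))))
      where
      spread : ∀ a b → 𝟙 (a · b ℕ.≤? N) * (G (a · b) * c b) ≡ ∑ L (λ n → 𝟙 (a · b ℕ.≟ n) * (G n * c b))
      spread a b = pick (a · b ℕ.≤? N)
        where
        pick : Dec (a · b ℕ.≤ N) → 𝟙 (a · b ℕ.≤? N) * (G (a · b) * c b) ≡ ∑ L (λ n → 𝟙 (a · b ℕ.≟ n) * (G n * c b))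
        pick (yes p) = trans (cong (_* (G (a · b) * c b)) (trans (𝟙-yes (a · b ℕ.≤? N) p) (sym (𝟙-yes (a · b ℕ.≟ a · b) refl))))
          (sym (∑-single L (a · b) (λ n → 𝟙 (a · b ℕ.≟ n) * (G n * c b)) (s≤s p) (λ n _ ne → cong (_* (G n * c b)) (𝟙-no (a · b ℕ.≟ n) (≢-sym ne)))))
        pick (no q) = trans (cong (_* (G (a · b) * c b)) (𝟙-no (a · b ℕ.≤? N) q))
          (sym (trans (∑-cong L (λ n n<L → cong (_* (G n * c b)) (𝟙-no (a · b ℕ.≟ n) (λ e → q (subst (ℕ._≤ N) (sym e) (ℕ.≤-pred n<L)))))) (∑-0 L)))
      dvd-count : ∀ n b → 1 ℕ.≤ n → n ℕ.< L → ∑ L (λ a → 𝟙 (a · b ℕ.≟ n)) ≡ dvd b n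
      dvd-count n b 1≤n n<L = pick (b ℕ.∣? n)
        where
        pick : Dec (b ℕ.∣ n) → ∑ L (λ a → 𝟙 (a · b ℕ.≟ n)) ≡ dvd b n
        pick (no nd) = trans (trans (∑-cong L (λ a _ → 𝟙-no (a · b ℕ.≟ n) (λ e → nd (ℕ.divides a (sym e))))) (∑-0 L)) (sym (𝟙-no (b ℕ.∣? n) nd))
        pick (yes d@(ℕ.divides q e)) = trans (∑-single L q (λ a → 𝟙 (a · b ℕ.≟ n)) q<L (λ a _ ne → 𝟙-no (a · b ℕ.≟ n) (λ f → ne (ℕ.*-cancelʳ-≡ a q b (trans f e)))))
            (trans (𝟙-yes (q · b ℕ.≟ n) (sym e)) (sym (𝟙-yes (b ℕ.∣? n) d)))
          where
          instance
            b-nz : ℕ.NonZero b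
            b-nz = ℕ.≢-nonZero (λ { refl → ℕ.m<n⇒n≢0 1≤n (trans e (ℕ.*-zeroʳ q)) })
          q<L : q ℕ.< L
          q<L = ℕ.≤-<-trans (subst (q ℕ.≤_) (sym e) (ℕ.m≤m*n q b)) n<L
      r : ∀ i g c → i * (g * c) ≡ g * (i * c)
      r = solve-∀
      zero-row : ∀ i c → i * (0ℤ * c) ≡ 0ℤ
      zero-row = solve-∀
      collect : ∀ n → n ℕ.< L → ∑ L (λ a → ∑ L (λ b → 𝟙 (a · b ℕ.≟ n) * (G n * c b))) ≡ G n * R n
      collect zero _ = trans (∑-cong L (λ a _ → trans (∑-cong L (λ b _ → trans (cong (λ g → 𝟙 (a · b ℕ.≟ 0) * (g * c b)) G0) (zero-row (𝟙 (a · b ℕ.≟ 0)) (c b)))) (∑-0 L))) (trans (∑-0 L) (sym (cong (_* R 0) G0)))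
      collect n@(suc _) n<L = trans (∑-swap L L (λ a b → 𝟙 (a · b ℕ.≟ n) * (G n * c b)))
        (trans (∑-cong L (λ b _ → trans (∑-cong L (λ a _ → *-comm (𝟙 (a · b ℕ.≟ n)) (G n * c b))) (trans (∑-scale L (G n * c b) (λ a → 𝟙 (a · b ℕ.≟ n)))
          (trans (cong (G n * c b *_) (dvd-count n b (s≤s z≤n) n<L)) (trans (*-comm (G n * c b) (dvd b n)) (r (dvd b n) (G n) (c b)))))))
          (∑-scale L (G n) (λ b → dvd b n * c b)))

  module Twist (X : ℕ) (ε : ℕ → ℤ) (ε-tri : ∀ p → Tri (ε p)) where
    open Expand X ε ε-tri

    cs : (ℕ → ℕ → ℤ) → List ℕ → ℕ → ℤ
    cs c [] x = 1ℤ
    cs c (p ∷ ps) x = c p x * cs c ps x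

    twist-val : ∀ c ps α x → twist ps c α x ≡ α x * cs c ps x
    twist-val c [] α x = sym (*-identityʳ (α x))
    twist-val c (p ∷ ps) α x = trans (twist-val c ps (α ⊙ c p) x) (*-assoc (α x) (c p x) (cs c ps x))

    F : List ℕ → ℕ → ℤ
    F [] n = 1ℤ
    F (p ∷ ps) n = (χ² p n + ε p * χℕ p n) * F ps n

    cube : ∀ {z} → Tri z → z * z * z ≡ z
    cube zer = refl
    cube one = refl
    cube min = refl

    -- From `χ(b)³ = χ(b)` each factor is `χ²(ab) + ε χ(ab)` times `χ(b)`. The first part depends on
    -- `n = ab` only and vanishes unless `χ(n) = ε`, given that `ε` is nonzero.
    T-val : ∀ {ps} → All OddPrime ps → ∀ a b → T ps a b ≡ F ps (a · b) * cs χℕ ps b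
    T-val [] a b = refl
    T-val {p ∷ ps} (op ∷ ops) a b = trans (cong₂ _*_ step (T-val ops a b)) (l₃ (χ² p (a · b) + ε p * χℕ p (a · b)) (χℕ p b) (F ps (a · b)) (cs χℕ ps b))
      where
      open Char (χ-char op)
      l₃ : ∀ a b c d → a * b * (c * d) ≡ a * c * (b * d)
      l₃ = solve-∀
      x = χℕ p a
      y = χℕ p b
      l₁ : ∀ x y e → x * x * y + e * (x * (y * y)) ≡ x * x * y + e * (x * y) * y
      l₁ = solve-∀
      l₂ : ∀ x y e → x * x * (y * y * y) + e * (x * y) * y ≡ (x * y * (x * y) + e * (x * y)) * y
      l₂ = solve-∀
      step : χ² p a * y + ε p * (x * χ² p b) ≡ (χ² p (a · b) + ε p * χℕ p (a · b)) * y
      step = trans (l₁ x y (ε p)) (trans (cong (λ u → x * x * u + ε p * (x * y) * y) (sym (cube (tri b))))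
        (trans (l₂ x y (ε p)) (cong (λ u → (u * u + ε p * u) * y) (sym (mult a b)))))

    χ²χ : ∀ {ps} → All OddPrime ps → ∀ b → cs χ² ps b * cs χℕ ps b ≡ cs χℕ ps b
    χ²χ [] b = refl
    χ²χ {p ∷ ps} (op ∷ ops) b = trans (l (χ² p b) (cs χ² ps b) (χℕ p b) (cs χℕ ps b)) (cong₂ _*_ (cube (χ-tri p (+ b))) (χ²χ ops b))
      where l : ∀ a b c d → a * b * (c * d) ≡ a * c * (b * d)
            l = solve-∀

    twist-char : ∀ ps {M α} → All OddPrime ps → Char M α → Char (M · ∏ₗ ps) (twist ps χℕ α)
    twist-char [] {M} {α} _ A = subst (λ u → Char u α) (sym (ℕ.*-identityʳ M)) A
    twist-char (p ∷ ps) {M} {α} (op ∷ ops) A = subst (λ u → Char u (twist ps χℕ (α ⊙ χℕ p))) (ℕ.*-assoc M p (∏ₗ ps)) (twist-char ps ops (⊙-char A (χ-char op)))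

    twist²-char : ∀ ps {M α} → All OddPrime ps → Char M α → Char (M · ∏ₗ ps) (twist ps χ² α)
    twist²-char [] {M} {α} _ A = subst (λ u → Char u α) (sym (ℕ.*-identityʳ M)) A
    twist²-char (p ∷ ps) {M} {α} (op ∷ ops) A = subst (λ u → Char u (twist ps χ² (α ⊙ χ² p))) (ℕ.*-assoc M p (∏ₗ ps)) (twist²-char ps ops (⊙-char A (χ²-char op)))

    odd-sq : ∀ b → odd b * odd b ≡ odd b
    odd-sq 0 = refl
    odd-sq 1 = refl
    odd-sq (suc (suc b)) = odd-sq b

    cs-Jac : ∀ ps x → cs χℕ ps x ≡ Jac ps (+ x)
    cs-Jac [] x = refl
    cs-Jac (p ∷ ps) x = cong (χ p (+ x) *_) (cs-Jac ps x)

  record Genus (qs : List ℕ) (ε : ℕ → ℤ) : Set where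
    field
      rs : List ℕ
      n f : ℕ
      n≡ : n ≡ ∏ₗ rs · (f · f)
      n≥1 : 1 ℕ.≤ n
      rs-odd : All OddPrime rs
      distinct : AllPairs _≢_ rs
      rs∉qs : All (λ ℓ → All (_≢ ℓ) qs) rs
      rs-split : All (λ ℓ → χ ℓ (- + ∏ₗ qs) ≡ 1ℤ) rs
      values : All (λ p → χ p (+ n) ≡ ε p) qs

  distinct-coprime : ∀ {q qs} → OddPrime q → All OddPrime qs → All (q ≢_) qs → All (Coprime q) qs
  distinct-coprime oq [] [] = []
  distinct-coprime oq (or ∷ ors) (ne ∷ nes) =
    prime∤⇒coprime (OddPrime.prime or) (prime∤prime (OddPrime.prime or) (OddPrime.prime oq) (≢-sym ne)) ∷ distinct-coprime oq ors nes

  -- Every sign vector ε on the primes of m ≡ 3 mod 4 whose product is 1 is the vector of values (n / p)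
  -- of some n all of whose primes of odd exponent split in ℚ(√-m).
  module Existence (p : ℕ) (ps : List ℕ) (ops : All OddPrime (p ∷ ps)) (uniq : AllPairs _≢_ (p ∷ ps)) (k₀ : ℕ) (m≡3 : ∏ₗ (p ∷ ps) ≡ 3 ℕ.+ k₀ · 4)
                   (ε : ℕ → ℤ) (ε-tri : ∀ q → Tri (ε q)) (ε-nz : All (λ q → ε q ≢ 0ℤ) (p ∷ ps)) where
    qs = p ∷ ps
    m = ∏ₗ qs
    -- V is chosen so that the V³ values φ i j below outweigh the error term K (X + 1).
    K = 2 ℕ.^ length qs · (3 · (2 · m))
    V = 9 · m · K
    X = 8 · m · (V · V)

    open Hyperbola X
    open Expand X ε ε-tri
    open Twist X ε ε-tri

    -- `chi` is the character of ℚ(√-m) restricted to odd numbers, and `ind` the indicator of the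
    -- numbers prime to `2m`. Starting from `odd` keeps the prime 2 out of every `n`.
    chi ind : ℕ → ℤ
    chi = twist qs χℕ odd
    ind = twist qs χ² odd

    chi-char : Char (2 · m) chi
    chi-char = twist-char qs ops odd-char

    ind-char : Char (2 · m) ind
    ind-char = twist²-char qs ops odd-char

    open DivSum L chi (Char.mult chi-char) (Char.tri chi-char) (Char.unit chi-char)
    open Convolve X chi (Char.mult chi-char) (Char.tri chi-char) (Char.unit chi-char)

    m≥1 : 1 ℕ.≤ m
    m≥1 = subst (1 ℕ.≤_) (sym m≡3) (s≤s z≤n)

    pos-^ : ∀ t → 1 ℕ.≤ 2 ℕ.^ t
    pos-^ zero = ℕ.≤-refl
    pos-^ (suc t) = ℕ.≤-trans (pos-^ t) (ℕ.m≤m+n _ _)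

    K≥1 : 1 ℕ.≤ K
    K≥1 = ℕ.*-mono-≤ (pos-^ (length qs)) (ℕ.*-mono-≤ (s≤s (z≤n {2})) (ℕ.*-mono-≤ (s≤s (z≤n {1})) m≥1))

    V≥1 : 1 ℕ.≤ V
    V≥1 = ℕ.*-mono-≤ (ℕ.*-mono-≤ (s≤s (z≤n {8})) m≥1) K≥1

    weight : ∀ a b → odd a * odd b * T qs a b ≡ (odd (a · b) * F qs (a · b)) * chi b
    weight a b = trans (cong (odd a * odd b *_) (T-val ops a b)) (trans (cong (λ u → odd a * u * (F qs (a · b) * cs χℕ qs b)) (sym (odd-sq b)))
      (trans (l (odd a) (odd b) (F qs (a · b)) (cs χℕ qs b)) (cong₂ (λ u v → u * F qs (a · b) * v) (sym (Char.mult odd-char a b)) (sym (twist-val χℕ qs odd b)))))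
      where l : ∀ a b F c → a * (b * b) * (F * c) ≡ a * b * F * (b * c)
            l = solve-∀

    W-conv : W qs odd odd ≡ ∑ L (λ n → odd n * F qs n * R n)
    W-conv = trans (Tot-cong weight) (Tot-conv (λ n → odd n * F qs n) refl)

    ind-chi : ∀ a b → ind a * chi b ≡ ind (a · b) * chi b
    ind-chi a b = trans (cong (ind a *_) (sym (trans (cong₂ _*_ (twist-val χ² qs odd b) (twist-val χℕ qs odd b))
        (trans (l (odd b) (cs χ² qs b) (cs χℕ qs b)) (trans (cong₂ _*_ (odd-sq b) (χ²χ ops b)) (sym (twist-val χℕ qs odd b)))))))
      (trans (sym (*-assoc (ind a) (ind b) (chi b))) (cong (_* chi b) (sym (Char.mult ind-char a b))))
      where l : ∀ o x y → o * x * (o * y) ≡ o * o * (x * y)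
            l = solve-∀

    ind-0 : ind 0 ≡ 0ℤ
    ind-0 = twist-val χ² qs odd 0

    Pure-conv : Pure ind chi ≡ ∑ L (λ n → ind n * R n)
    Pure-conv = trans (Tot-cong ind-chi) (Tot-conv ind ind-0)

    *-nz : ∀ {x y : ℤ} → x * y ≢ 0ℤ → x ≢ 0ℤ × y ≢ 0ℤ
    *-nz {x} {y} h = (λ { refl → h refl }) , (λ { refl → h (*-zeroʳ x) })

    chi-nz⇒ : ∀ ℓ → Prime ℓ → chi ℓ ≢ 0ℤ → OddPrime ℓ × All (_≢ ℓ) qs × chi ℓ ≡ χ ℓ (- + m)
    chi-nz⇒ ℓ pℓ nz = oℓ , nes ops (proj₂ split) , trans (twist-val χℕ qs odd ℓ) (trans (cong₂ _*_ (oddPrime-odd oℓ) (cs-Jac qs ℓ)) (trans (*-identityˡ _) (Jac-flip {k = k₀} oℓ ops (nes ops (proj₂ split)) m≡3)))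
      where
      split : odd ℓ ≢ 0ℤ × cs χℕ qs ℓ ≢ 0ℤ
      split = *-nz (λ e → nz (trans (twist-val χℕ qs odd ℓ) e))
      oℓ : OddPrime ℓ
      oℓ = oddPrime pℓ (odd≡1⇒ ℓ (proj₁ split))
      nes : ∀ {ps} → All OddPrime ps → cs χℕ ps ℓ ≢ 0ℤ → All (_≢ ℓ) ps
      nes [] _ = []
      nes {q ∷ ps} (oq ∷ oqs) h = (λ { refl → proj₁ (*-nz {χℕ q ℓ} h) (Symbol.χ-∣ oq (divides 1ℤ (sym (*-identityˡ (+ q))))) }) ∷ nes oqs (proj₂ (*-nz {χℕ q ℓ} h))

    Rep : ℕ → Set
    Rep n = (∃[ u ] ∃[ v ] n ≡ u · u ℕ.+ m · (v · v)) × (∀ ℓ → Prime ℓ → ℓ ℕ.∣ n → chi ℓ ≢ 0ℤ)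

    -- If `ℓ` divides `u² + mv²` but not `v`, then `-m` is a square modulo `ℓ`, contrary to `ℓ`
    -- being inert. So `ℓ` divides both `u` and `v`.
    Rep-inert : ∀ {n} → Rep n → ∀ ℓ → IsInert n ℓ → ∃[ k ] n ≡ ℓ · (ℓ · k) × Rep k
    Rep-inert {n} ((u , v , e) , nz) ℓ (pℓ , d , cℓ) = go (ℓ ℕ.∣? v)
      where
      facts = chi-nz⇒ ℓ pℓ (nz ℓ pℓ d)
      oℓ = proj₁ facts
      χℓ : χ ℓ (- + m) ≡ -1ℤ
      χℓ = trans (sym (proj₂ (proj₂ facts))) cℓ
      open Symbol oℓ
      open Mod (+ ℓ)
      sq≢-1 : ∀ {z} → Tri z → z * z ≢ -1ℤ
      sq≢-1 zer ()
      sq≢-1 one ()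
      sq≢-1 min ()
      go : Dec (ℓ ℕ.∣ v) → ∃[ k ] n ≡ ℓ · (ℓ · k) × Rep k
      go (no ℓ∤v) = ⊥-elim (sq≢-1 (χ-tri ℓ (+ u)) (trans (sym (χ-* (+ u) (+ u))) (trans (χ-cong cong-uv) (trans (χ-* (- + m) (+ v * + v))
          (cong₂ _*_ χℓ (χ-sq (+ v) (λ h → ℓ∤v (∣⇒∣ᵤ h))))))))
        where
        l : ∀ u m v → u * u - - m * (v * v) ≡ u * u + m * (v * v)
        l = solve-∀
        cong-uv : + u * + u ≈ - + m * (+ v * + v)
        cong-uv = mod (subst (+ ℓ ∣_) (sym (trans (l (+ u) (+ m) (+ v)) (trans (cong₂ (λ x y → x + + m * y) (sym (pos-* u u)) (sym (pos-* v v)))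
          (trans (cong (λ x → + (u · u) + x) (sym (pos-* m (v · v)))) (cong +_ (sym e)))))) (∣ᵤ⇒∣ d))
      go (yes (ℕ.divides v′ ev)) = fin (both (euclidsLemma u u pℓ ℓ∣uu))
        where
        ℓ∣uu : ℓ ℕ.∣ u · u
        ℓ∣uu = ℕ.∣m+n∣m⇒∣n (subst (ℓ ℕ.∣_) (trans e (ℕ.+-comm (u · u) (m · (v · v)))) d) (ℕ.∣n⇒∣m*n m (ℕ.∣m⇒∣m*n v (ℕ.divides v′ ev)))
        both : ∀ {A : Set} → A ⊎ A → A
        both (inj₁ a) = a
        both (inj₂ a) = a
        fin : ℓ ℕ.∣ u → ∃[ k ] n ≡ ℓ · (ℓ · k) × Rep k
        fin (ℕ.divides u′ eu) = k , n≡ , (u′ , v′ , refl) , (λ q pq h → nz q pq (ℕ.∣-trans h (ℕ.divides (ℓ · ℓ) (trans n≡ (sym (ℕ.*-assoc ℓ ℓ k))))))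
          where
          k = u′ · u′ ℕ.+ m · (v′ · v′)
          l : ∀ u v ℓ m → u · ℓ · (u · ℓ) ℕ.+ m · (v · ℓ · (v · ℓ)) ≡ ℓ · (ℓ · (u · u ℕ.+ m · (v · v)))
          l = ℕ-solve-∀
          n≡ : n ≡ ℓ · (ℓ · k)
          n≡ = trans e (trans (cong₂ (λ x y → x · x ℕ.+ m · (y · y)) eu ev) (l u′ v′ ℓ m))

    -- `Uᵢ i ≡ 1` modulo `2m`, and with an even second coordinate all values `φ i j` are 1 modulo
    -- `2m`: every character there takes the value 1 on them. The offset `V · V` makes `Uᵢ` large
    -- enough for `φ-lt`.
    Uᵢ : ℕ → ℕ
    Uᵢ i = 1 ℕ.+ 2 · m · (V · V ℕ.+ suc i)

    φ : ℕ → ℕ → ℕ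
    φ i j = Uᵢ i · Uᵢ i ℕ.+ m · (2 · suc j · (2 · suc j))

    φ-1 : ∀ i j → ∃[ k ] φ i j ≡ 1 ℕ.+ k · (2 · m)
    φ-1 i j = 2 · (V · V ℕ.+ suc i) ℕ.+ 2 · m · ((V · V ℕ.+ suc i) · (V · V ℕ.+ suc i)) ℕ.+ 2 · (suc j · suc j) , l m (V · V ℕ.+ suc i) (suc j)
      where l : ∀ m y j → (1 ℕ.+ 2 · m · y) · (1 ℕ.+ 2 · m · y) ℕ.+ m · (2 · j · (2 · j)) ≡ 1 ℕ.+ (2 · y ℕ.+ 2 · m · (y · y) ℕ.+ 2 · (j · j)) · (2 · m)
            l = ℕ-solve-∀

    char-φ : ∀ {α} → Char (2 · m) α → ∀ i j → α (φ i j) ≡ 1ℤ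
    char-φ {α} A i j with φ-1 i j
    ... | k , e = trans (cong α e) (trans (Char.periodic A 1 k) (Char.unit A))

    φ-rep : ∀ i j → Rep (φ i j)
    φ-rep i j = (Uᵢ i , 2 · suc j , refl) , nz
      where
      nz : ∀ ℓ → Prime ℓ → ℓ ℕ.∣ φ i j → chi ℓ ≢ 0ℤ
      nz ℓ pℓ (ℕ.divides q e) z = absurd (trans (sym (char-φ chi-char i j)) (trans (cong chi e) (trans (Char.mult chi-char q ℓ) (trans (cong (chi q *_) z) (*-zeroʳ (chi q))))))
        where absurd : 1ℤ ≢ 0ℤ
              absurd ()

    φ≥1 : ∀ i j → 1 ℕ.≤ φ i j
    φ≥1 i j = subst (1 ℕ.≤_) (sym (proj₂ (φ-1 i j))) (s≤s z≤n)

    φ<L : ∀ i j → i ℕ.< V · V → j ℕ.< V → φ i j ℕ.< L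
    φ<L i j i< j< = s≤s (begin
      Uᵢ i · Uᵢ i ℕ.+ m · (2 · suc j · (2 · suc j))   ≤⟨ ℕ.+-mono-≤ (ℕ.*-mono-≤ U≤ U≤) (ℕ.*-monoʳ-≤ m (ℕ.*-mono-≤ (ℕ.*-monoʳ-≤ 2 j<) (ℕ.*-monoʳ-≤ 2 j<))) ⟩
      5 · Y · (5 · Y) ℕ.+ m · (2 · V · (2 · V))       ≡⟨ cong (5 · Y · (5 · Y) ℕ.+_) (l₁ m V) ⟩
      5 · Y · (5 · Y) ℕ.+ 4 · Y                       ≤⟨ ℕ.+-monoʳ-≤ (5 · Y · (5 · Y)) (ℕ.*-monoʳ-≤ 4 (ℕ.m≤m*n Y Y {{ℕ.>-nonZero Y≥1}})) ⟩
      5 · Y · (5 · Y) ℕ.+ 4 · (Y · Y)                 ≤⟨ ℕ.m≤m+n _ (35 · (Y · Y)) ⟩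
      5 · Y · (5 · Y) ℕ.+ 4 · (Y · Y) ℕ.+ 35 · (Y · Y) ≡⟨ l₂ Y ⟩
      8 · Y · (8 · Y)                                 ≡⟨ cong (λ u → u · u) (sym (ℕ.*-assoc 8 m (V · V))) ⟩
      X · X                                           ∎)
      where
      open ℕ.≤-Reasoning
      Y = m · (V · V)
      Y≥1 : 1 ℕ.≤ Y
      Y≥1 = ℕ.*-mono-≤ m≥1 (ℕ.*-mono-≤ V≥1 V≥1)
      l₁ : ∀ m V → m · (2 · V · (2 · V)) ≡ 4 · (m · (V · V))
      l₁ = ℕ-solve-∀
      l₂ : ∀ Y → 5 · Y · (5 · Y) ℕ.+ 4 · (Y · Y) ℕ.+ 35 · (Y · Y) ≡ 8 · Y · (8 · Y)
      l₂ = ℕ-solve-∀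
      l₃ : ∀ m W → 2 · m · (W ℕ.+ W) ≡ 4 · (m · W)
      l₃ = ℕ-solve-∀
      U≤ : Uᵢ i ℕ.≤ 5 · Y
      U≤ = ℕ.+-mono-≤ Y≥1 (ℕ.≤-trans (ℕ.*-monoʳ-≤ (2 · m) (ℕ.+-monoʳ-≤ (V · V) i<)) (ℕ.≤-reflexive (l₃ m (V · V))))

    -- The second summand is at most `4mV² ≤ 2u`, less than the gap between `u²` and `(u + 1)²`. So
    -- the values for different `i` lie in disjoint intervals, and distinctness needs no arithmetic
    -- of norms.
    φ-lt : ∀ i j i′ j′ → j′ ℕ.< V → i′ ℕ.< i → φ i′ j′ ℕ.< φ i j
    φ-lt i j i′ j′ j′< i′<i = begin-strict
      u · u ℕ.+ m · (2 · suc j′ · (2 · suc j′))       ≤⟨ ℕ.+-monoʳ-≤ (u · u) (ℕ.*-monoʳ-≤ m (ℕ.*-mono-≤ (ℕ.*-monoʳ-≤ 2 j′<) (ℕ.*-monoʳ-≤ 2 j′<))) ⟩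
      u · u ℕ.+ m · (2 · V · (2 · V))                 ≡⟨ cong (u · u ℕ.+_) (l₁ m V) ⟩
      u · u ℕ.+ 2 · (2 · m · (V · V))                 ≤⟨ ℕ.+-monoʳ-≤ (u · u) (ℕ.*-monoʳ-≤ 2 (ℕ.≤-trans (ℕ.*-monoʳ-≤ (2 · m) (ℕ.m≤m+n (V · V) (suc i′))) (ℕ.n≤1+n _))) ⟩
      u · u ℕ.+ 2 · u                                 <⟨ ℕ.≤-reflexive (l₂ u) ⟩
      suc u · suc u                                   ≤⟨ ℕ.*-mono-≤ u<U u<U ⟩
      Uᵢ i · Uᵢ i                                     ≤⟨ ℕ.m≤m+n _ _ ⟩
      φ i j                                           ∎
      where
      open ℕ.≤-Reasoning
      u = Uᵢ i′
      l₁ : ∀ m V → m · (2 · V · (2 · V)) ≡ 2 · (2 · m · (V · V))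
      l₁ = ℕ-solve-∀
      l₂ : ∀ u → suc (u · u ℕ.+ 2 · u) ≡ suc u · suc u
      l₂ = ℕ-solve-∀
      u<U : u ℕ.< Uᵢ i
      u<U = s≤s (ℕ.*-monoʳ-< (2 · m) {{ℕ.>-nonZero (ℕ.*-mono-≤ (s≤s (z≤n {1})) m≥1)}} (ℕ.+-monoʳ-< (V · V) (s≤s i′<i)))

    φ-inj : ∀ i j i′ j′ → i ℕ.< V · V → j ℕ.< V → i′ ℕ.< V · V → j′ ℕ.< V → φ i j ≡ φ i′ j′ → i ≡ i′ × j ≡ j′
    φ-inj i j i′ j′ i< j< i′< j′< e with ℕ.<-cmp i i′
    ... | tri< lt _ _ = ⊥-elim (ℕ.<-irrefl e (φ-lt i′ j′ i j j< lt))
    ... | tri> _ _ gt = ⊥-elim (ℕ.<-irrefl (sym e) (φ-lt i j i′ j′ j′< gt))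
    ... | tri≈ _ refl _ = refl , ℕ.suc-injective (ℕ.*-cancelˡ-≡ (suc j) (suc j′) 2 (sq-inj (2 · suc j) (2 · suc j′)
            (ℕ.*-cancelˡ-≡ _ _ m {{ℕ.>-nonZero m≥1}} (ℕ.+-cancelˡ-≡ (Uᵢ i · Uᵢ i) _ _ e))))
      where
      sq-inj : ∀ a b → a · a ≡ b · b → a ≡ b
      sq-inj a b e with ℕ.<-cmp a b
      ... | tri< lt _ _ = ⊥-elim (ℕ.<-irrefl e (ℕ.*-mono-< lt lt))
      ... | tri≈ _ q _ = q
      ... | tri> _ _ gt = ⊥-elim (ℕ.<-irrefl (sym e) (ℕ.*-mono-< gt gt))

    -- All terms `ind n * R n` are nonnegative, and at the `V³` distinct values of `φ` they are at
    -- least 1.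
    main-term : + (V · V · V) ≤ Pure ind chi
    main-term = subst (+ (V · V · V) ≤_) (sym Pure-conv) (∑-image L (V · V) V φ (λ n → ind n * R n) φ<L φ-inj nonneg big)
      where
      nonneg : ∀ n → n ℕ.< L → 0ℤ ≤ ind n * R n
      nonneg zero _ = ≤-reflexive (sym (cong (_* R 0) ind-0))
      nonneg n@(suc _) n<L = mul (ind n) (R n) ind≥0 (R≥0 n (s≤s z≤n) n<L)
        where
        mul : ∀ x y → 0ℤ ≤ x → 0ℤ ≤ y → 0ℤ ≤ x * y
        mul (+ x) (+ y) _ _ = subst (0ℤ ≤_) (pos-* x y) (+≤+ z≤n)
        odd≥0 : ∀ n → 0ℤ ≤ odd n
        odd≥0 0 = +≤+ z≤n
        odd≥0 1 = +≤+ z≤n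
        odd≥0 (suc (suc n)) = odd≥0 n
        sq≥0 : ∀ {z} → Tri z → 0ℤ ≤ z * z
        sq≥0 zer = +≤+ z≤n
        sq≥0 one = +≤+ z≤n
        sq≥0 min = +≤+ z≤n
        cs≥0 : ∀ ps → 0ℤ ≤ cs χ² ps n
        cs≥0 [] = +≤+ z≤n
        cs≥0 (q ∷ ps) = mul (χ² q n) (cs χ² ps n) (sq≥0 (χ-tri q (+ n))) (cs≥0 ps)
        ind≥0 : 0ℤ ≤ ind n
        ind≥0 = subst (0ℤ ≤_) (sym (twist-val χ² qs odd n)) (mul (odd n) (cs χ² qs n) (odd≥0 n) (cs≥0 qs))
      big : ∀ i j → i ℕ.< V · V → j ℕ.< V → 1ℤ ≤ ind (φ i j) * R (φ i j)
      big i j i< j< = subst (1ℤ ≤_) (sym (trans (cong (_* R (φ i j)) (char-φ ind-char i j)) (*-identityˡ _)))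
        (R-rep Rep proj₂ Rep-inert (φ i j) (φ i j) ℕ.≤-refl (φ≥1 i j) (φ<L i j i< j<) (φ-rep i j))

    error-term : bound 2 qs ℕ.≤ V · V · V
    error-term = begin
      2 ℕ.^ length qs · (3 · (2 · m) · suc X)   ≡⟨ sym (ℕ.*-assoc (2 ℕ.^ length qs) (3 · (2 · m)) (suc X)) ⟩
      K · suc X                                 ≤⟨ ℕ.*-monoʳ-≤ K (ℕ.+-monoˡ-≤ X Y≥1) ⟩
      K · (m · (V · V) ℕ.+ 8 · m · (V · V))     ≡⟨ l K m (V · V) ⟩
      V · (V · V)                               ≡⟨ ℕ.*-comm V (V · V) ⟩
      V · V · V                                 ∎
      where
      open ℕ.≤-Reasoning
      Y≥1 : 1 ℕ.≤ m · (V · V)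
      Y≥1 = ℕ.*-mono-≤ m≥1 (ℕ.*-mono-≤ V≥1 V≥1)
      l : ∀ K m W → K · (m · W ℕ.+ 8 · m · W) ≡ 9 · m · K · W
      l = ℕ-solve-∀

    admissible : Admissible 2 qs
    admissible = _ , ops , two ops , pairs ops uniq
      where
      absurd : 1ℤ ≢ 0ℤ
      absurd ()
      two : ∀ {qs} → All OddPrime qs → All (Coprime 2) qs
      two [] = []
      two {q ∷ _} (oq ∷ oqs) = (λ {d} → coprime-sym (Char.support odd-char q (λ z → absurd (trans (sym (oddPrime-odd oq)) z))) {d}) ∷ two oqs
      pairs : ∀ {qs} → All OddPrime qs → AllPairs _≢_ qs → AllPairs Coprime qs
      pairs [] [] = []
      pairs (oq ∷ oqs) (u ∷ us) = distinct-coprime oq oqs u ∷ pairs oqs us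

    -- The sum is within `V³` of twice a number `P ≥ V³ > 0`, hence positive.
    total≢0 : E qs ≡ 1ℤ → W qs odd odd ≢ 0ℤ
    total≢0 E≡1 z = contra (Pure ind chi) (V · V · V) (ℕ.*-mono-≤ (ℕ.*-mono-≤ V≥1 V≥1) V≥1) main-term
      (ℕ.≤-trans (subst (λ u → ∣ u - + 2 * Pure ind chi ∣ ℕ.≤ bound 2 qs) z (full p ps admissible odd-char E≡1)) error-term)
      where
      contra : ∀ P Q → 1 ℕ.≤ Q → + Q ≤ P → ∣ 0ℤ - + 2 * P ∣ ℕ.≤ Q → ⊥
      contra (+ P) Q Q≥1 (+≤+ Q≤P) h = ℕ.<⇒≱ (ℕ.<-≤-trans (ℕ.m<n+m P (ℕ.≤-trans Q≥1 Q≤P)) (ℕ.≤-reflexive (sym abs≡))) (ℕ.≤-trans h Q≤P)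
        where
        abs≡ : ∣ 0ℤ - + 2 * + P ∣ ≡ P ℕ.+ P
        abs≡ = trans (cong ∣_∣ (trans (+-identityˡ (- (+ 2 * + P))) (cong -_ (sym (pos-* 2 P))))) (trans (∣-i∣≡∣i∣ (+ (2 · P))) (cong (P ℕ.+_) (ℕ.+-identityʳ P)))

    -- A nonzero sum has a nonzero term, and each factor of that term speaks: `F qs n` fixes the
    -- symbols of `n`, and `R n` together with the absence of ramified primes gives the shape
    -- `∏ₗ rs · (f · f)` with split `rs`.
    exists : E qs ≡ 1ℤ → Genus qs ε
    exists E≡1 = build (∑≢0 L (λ n → odd n * F qs n * R n) (λ z → total≢0 E≡1 (trans W-conv z)))
      where
      value : ∀ q n → ε q ≢ 0ℤ → χ² q n + ε q * χℕ q n ≢ 0ℤ → χℕ q n ≡ ε q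
      value q n εnz h = go (χ-tri q (+ n)) (ε-tri q) εnz h
        where
        go : ∀ {x e} → Tri x → Tri e → e ≢ 0ℤ → x * x + e * x ≢ 0ℤ → x ≡ e
        go x zer enz h = ⊥-elim (enz refl)
        go zer one enz h = ⊥-elim (h refl)
        go zer min enz h = ⊥-elim (h refl)
        go one one enz h = refl
        go one min enz h = ⊥-elim (h refl)
        go min one enz h = ⊥-elim (h refl)
        go min min enz h = refl
      values : ∀ {qs} n → All (λ q → ε q ≢ 0ℤ) qs → F qs n ≢ 0ℤ → All (λ q → χ q (+ n) ≡ ε q) qs
      values n [] h = []
      values {q ∷ qs} n (e ∷ es) h = value q n e (proj₁ (*-nz {χ² q n + ε q * χℕ q n} {F qs n} h)) ∷ values n es (proj₂ (*-nz {χ² q n + ε q * χℕ q n} {F qs n} h))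
      cs-nz : ∀ {qs} n → All (λ q → ε q ≢ 0ℤ) qs → All (λ q → χ q (+ n) ≡ ε q) qs → cs χℕ qs n ≢ 0ℤ
      cs-nz n [] [] ()
      cs-nz {q ∷ qs} n (e ∷ es) (v ∷ vs) h = pick (i*j≡0⇒i≡0∨j≡0 (χℕ q n) h)
        where
        pick : χℕ q n ≡ 0ℤ ⊎ cs χℕ qs n ≡ 0ℤ → ⊥
        pick (inj₁ z) = e (trans (sym v) z)
        pick (inj₂ z) = cs-nz n es vs z
      build : (∃[ n ] n ℕ.< L × odd n * F qs n * R n ≢ 0ℤ) → Genus qs ε
      build (zero , _ , h) = ⊥-elim (h refl)
      build (n@(suc _) , n<L , h) = fin (R≢0⇒split n n ℕ.≤-refl (s≤s z≤n) n<L nz (proj₂ s₁))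
        where
        s₁ = *-nz {odd n * F qs n} {R n} h
        s₂ = *-nz {odd n} {F qs n} (proj₁ s₁)
        vals = values n ε-nz (proj₂ s₂)
        chi-n : chi n ≢ 0ℤ
        chi-n z = pick (i*j≡0⇒i≡0∨j≡0 (odd n) (trans (sym (twist-val χℕ qs odd n)) z))
          where
          pick : odd n ≡ 0ℤ ⊎ cs χℕ qs n ≡ 0ℤ → ⊥
          pick (inj₁ z) = proj₁ s₂ z
          pick (inj₂ z) = cs-nz n ε-nz vals z
        nz : ∀ ℓ → Prime ℓ → ℓ ℕ.∣ n → chi ℓ ≢ 0ℤ
        nz ℓ pℓ (ℕ.divides q e) z = chi-n (trans (cong chi e) (trans (Char.mult chi-char q ℓ) (trans (cong (chi q *_) z) (*-zeroʳ (chi q)))))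
        fin : (∃[ rs ] ∃[ f ] n ≡ ∏ₗ rs · (f · f) × All Prime rs × AllPairs _≢_ rs × All (λ q → chi q ≡ 1ℤ) rs) → Genus qs ε
        fin (rs , f , e , prs , us , cs₁) = record
          { rs = rs ; n = n ; f = f ; n≡ = e ; n≥1 = s≤s z≤n ; distinct = us ; values = vals
          ; rs-odd = All.map proj₁ facts ; rs∉qs = All.map (λ h → proj₁ (proj₂ h)) facts ; rs-split = All.map (λ h → proj₂ (proj₂ h)) facts }
          where
          absurd : 1ℤ ≢ 0ℤ
          absurd ()
          facts : All (λ ℓ → OddPrime ℓ × All (_≢ ℓ) qs × χ ℓ (- + m) ≡ 1ℤ) rs
          facts = All.zipWith (λ { {ℓ} (pℓ , c) → let o , nes , v = chi-nz⇒ ℓ pℓ (λ z → absurd (trans (sym c) z)) in o , nes , trans (sym v) c }) (prs , cs₁)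

-- Representation of m by G

module Representation where

  open TernaryForms using (G; m-represented; by₁; by₂; by₃)
  open LegendreSymbol
  open QuadraticReciprocity using (prime∤prime)
  open Characters
  open CharacterSums
  open DivisorSums
  open JacobiSymbol
  open GenusExistence
  open import Data.Nat as ℕ using (ℕ; zero; suc; z≤n; s≤s; ⌊_/2⌋) renaming (_*_ to _·_)
  import Data.Nat.Properties as ℕ
  import Data.Nat.Divisibility as ℕ
  open import Data.Nat.DivMod using (_%_; [m+kn]%n≡m%n)
  open import Data.Nat.Coprimality using (Coprime; coprime-divisor) renaming (sym to coprime-sym)
  open import Data.Nat.Primality using (Prime; prime⇒nonZero)
  open import Data.Nat.Tactic.RingSolver renaming (solve-∀ to ℕ-solve-∀)
  open import Data.Integer using (ℤ; +_; 0ℤ; 1ℤ; -1ℤ; _+_; _-_; _*_; -_; _≤_; ∣_∣; +≤+)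
  open import Data.Integer.Properties
  open import Data.Integer.DivMod using (_/ℕ_; _%ℕ_; a≡a%ℕn+[a/ℕn]*n; n%ℕd<d)
  open import Data.Integer.Divisibility.Signed using (_∣_; divides; ∣⇒∣ᵤ; ∣ᵤ⇒∣; ∣m∣n⇒∣m+n; ∣n⇒∣m*n)
  open import Data.Integer.Tactic.RingSolver using (solve-∀)
  open import Data.List using (List; []; _∷_)
  open import Data.List.Relation.Unary.All as All using (All; []; _∷_)
  open import Data.List.Relation.Unary.AllPairs using (AllPairs; []; _∷_)

  coprime-∏ : ∀ {x qs} → All (Coprime x) qs → Coprime x (∏ₗ qs)
  coprime-∏ [] (_ , d∣1) = ℕ.∣1⇒≡1 d∣1
  coprime-∏ {x} {q ∷ qs} (c ∷ cs) = coprime-* {x} {q} {∏ₗ qs} c (coprime-∏ cs)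

  coprime-∣-* : ∀ {M N} z → Coprime M N → + M ∣ z → + N ∣ z → + (M · N) ∣ z
  coprime-∣-* {M} {N} z c d e = ∣ᵤ⇒∣ (go (∣⇒∣ᵤ d) (∣⇒∣ᵤ e))
    where
    go : M ℕ.∣ ∣ z ∣ → N ℕ.∣ ∣ z ∣ → M · N ℕ.∣ ∣ z ∣
    go (ℕ.divides k eq) e = subst (M · N ℕ.∣_) (trans (ℕ.*-comm M k) (sym eq))
      (ℕ.*-monoʳ-∣ M (coprime-divisor {N} {M} (coprime-sym c) (subst (N ℕ.∣_) (trans eq (ℕ.*-comm k M)) e)))

  sqrt-list : ∀ {qs} a → All OddPrime qs → AllPairs _≢_ qs → All (λ q → χ q a ≡ 1ℤ) qs → ∃[ x ] + ∏ₗ qs ∣ x * x - a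
  sqrt-list a [] [] [] = 0ℤ , divides (0ℤ * 0ℤ - a) (sym (*-identityʳ _))
  sqrt-list {q ∷ qs} a (oq ∷ oqs) (u ∷ us) (s ∷ ss) = glue (Symbol.sqrt oq a s) (sqrt-list a oqs us ss) (inverse-mod {{prime⇒nonZero (OddPrime.prime oq)}} c)
    where
    P = ∏ₗ qs
    c : Coprime q P
    c = coprime-∏ (distinct-coprime oq oqs u)
    module Mq = Mod (+ q)
    glue : (∃[ y ] y * y Mq.≈ a) → (∃[ x ] + P ∣ x * x - a) → (∃[ w ] ∃[ t ] w · q ≡ 1 ℕ.+ t · P) → ∃[ z ] + (q · P) ∣ z * z - a
    glue (y , Mq.mod dq) (x , dP) (w , t , e) = z , coprime-∣-* (z * z - a) c
      (subst (+ q ∣_) (sym (l₁ y x (+ w) (+ q) a)) (∣m∣n⇒∣m+n dq (∣n⇒∣m*n ((x - y) * + w * (+ 2 * y + (x - y) * + w * + q)) (divides 1ℤ (sym (*-identityˡ (+ q)))))))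
      (subst (+ P ∣_) (sym (trans (cong (λ u → (y + (x - y) * u) * (y + (x - y) * u) - a) wq) (l₂ x y (+ t) (+ P) a)))
        (∣m∣n⇒∣m+n dP (∣n⇒∣m*n ((x - y) * + t * (+ 2 * x + (x - y) * + t * + P)) (divides 1ℤ (sym (*-identityˡ (+ P)))))))
      where
      -- `wq` is 0 modulo `q` and 1 modulo `P`, so `z` is `y` modulo `q` and `x` modulo `P`.
      z = y + (x - y) * (+ w * + q)
      wq : + w * + q ≡ 1ℤ + + t * + P
      wq = trans (sym (pos-* w q)) (trans (cong +_ e) (cong (λ u → 1ℤ + u) (pos-* t P)))
      l₁ : ∀ y x w q a → (y + (x - y) * (w * q)) * (y + (x - y) * (w * q)) - a ≡ y * y - a + (x - y) * w * (+ 2 * y + (x - y) * w * q) * q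
      l₁ = solve-∀
      l₂ : ∀ x y t P a → (y + (x - y) * (1ℤ + t * P)) * (y + (x - y) * (1ℤ + t * P)) - a ≡ x * x - a + (x - y) * t * (+ 2 * x + (x - y) * t * P) * P
      l₂ = solve-∀

  ∏ₗ≥1 : ∀ {qs} → All OddPrime qs → 1 ℕ.≤ ∏ₗ qs
  ∏ₗ≥1 [] = ℕ.≤-refl
  ∏ₗ≥1 {q ∷ qs} (oq ∷ oqs) = ℕ.*-mono-≤ (ℕ.>-nonZero⁻¹ q {{prime⇒nonZero (OddPrime.prime oq)}}) (∏ₗ≥1 oqs)

  odd-∏ : ∀ {qs} → All OddPrime qs → odd (∏ₗ qs) ≡ 1ℤ
  odd-∏ [] = refl
  odd-∏ {q ∷ qs} (oq ∷ oqs) = trans (Char.mult odd-char q (∏ₗ qs)) (cong₂ _*_ (oddPrime-odd oq) (odd-∏ oqs))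

  1≢0 : 1ℤ ≢ 0ℤ
  1≢0 ()

  odd-3+4* : ∀ k → odd (3 ℕ.+ k · 4) ≡ 1ℤ
  odd-3+4* zero = refl
  odd-3+4* (suc k) = odd-3+4* k

  odd⇒half : ∀ n → odd n ≡ 1ℤ → ∃[ h ] n ≡ suc (h ℕ.+ h)
  odd⇒half n e = ⌊ n /2⌋ , odd≡1⇒ n (λ z → 1≢0 (trans (sym e) z))

  -- A square root of -m modulo odd A can be taken odd, hence is one modulo 4A when m ≡ 3 mod 4.
  sqrt-4A : ∀ A m k x → odd A ≡ 1ℤ → m ≡ 3 ℕ.+ k · 4 → + A ∣ x * x - - + m → ∃[ B ] ∃[ C ] + 4 * + A * C - B * B ≡ + m
  sqrt-4A A m k x oA m≡ d = by-parity (x %ℕ 2) (x /ℕ 2) (n%ℕd<d x 2) (a≡a%ℕn+[a/ℕn]*n x 2)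
    where
    h = proj₁ (odd⇒half A oA)
    A≡ : + A ≡ 1ℤ + + 2 * + h
    A≡ = trans (cong +_ (trans (proj₂ (odd⇒half A oA)) (cong (λ u → suc (h ℕ.+ u)) (sym (ℕ.+-identityʳ h))))) (cong (λ u → 1ℤ + u) (pos-* 2 h))
    m≡ℤ : + m ≡ + 3 + + k * + 4
    m≡ℤ = trans (cong +_ m≡) (cong (λ u → + 3 + u) (pos-* k 4))
    4⊥A : Coprime 4 A
    4⊥A = coprime-sym (coprime-* {A} {2} {2} (λ {i} → s2 {i}) (λ {i} → s2 {i}))
      where
      s2 : Coprime A 2
      s2 = Char.support odd-char A (λ z → 1≢0 (trans (sym oA) z))
    finish : ∀ B c → B ≡ 1ℤ + + 2 * c → + A ∣ B * B - - + m → ∃[ B ] ∃[ C ] + 4 * + A * C - B * B ≡ + m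
    finish B c e dB = conclude (coprime-∣-* (B * B - - + m) 4⊥A (divides (c * c + c + 1ℤ + + k) (trans (cong₂ (λ b m → b * b - - m) e m≡ℤ) (l c (+ k)))) dB)
      where
      l : ∀ c k → (1ℤ + + 2 * c) * (1ℤ + + 2 * c) - - (+ 3 + k * + 4) ≡ (c * c + c + 1ℤ + k) * + 4
      l = solve-∀
      conclude : + (4 · A) ∣ B * B - - + m → ∃[ B ] ∃[ C ] + 4 * + A * C - B * B ≡ + m
      conclude (divides C e′) = B , C , r (+ A) B C (+ m) (trans e′ (cong (C *_) (pos-* 4 A)))
        where
        r : ∀ A B C m → B * B - - m ≡ C * (+ 4 * A) → + 4 * A * C - B * B ≡ m
        r A B C m h = by₁ -1ℤ h (i A B C m)
          where i : ∀ A B C m → + 4 * A * C - B * B - m ≡ -1ℤ * (B * B - - m - C * (+ 4 * A))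
                i = solve-∀
    by-parity : ∀ r q → r ℕ.< 2 → x ≡ + r + q * + 2 → ∃[ B ] ∃[ C ] + 4 * + A * C - B * B ≡ + m
    by-parity 1 q _ e = finish x q (trans e (cong (λ u → 1ℤ + u) (*-comm q (+ 2)))) d
    by-parity 0 q _ e = finish (x + + A) (q + + h) (trans (cong₂ _+_ e A≡) (l q (+ h)))
      (subst (+ A ∣_) (sym (l′ x (+ A) (+ m))) (∣m∣n⇒∣m+n d (∣n⇒∣m*n (+ 2 * x + + A) (divides 1ℤ (sym (*-identityˡ (+ A)))))))
      where
      l : ∀ q h → 0ℤ + q * + 2 + (1ℤ + + 2 * h) ≡ 1ℤ + + 2 * (q + h)
      l = solve-∀
      l′ : ∀ x A m → (x + A) * (x + A) - - m ≡ x * x - - m + (+ 2 * x + A) * A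
      l′ = solve-∀
    by-parity (suc (suc _)) q (s≤s (s≤s ())) e

  -- With `W` the inverse of `2A` modulo `m`, take `v = uBW`. Since `u² ≡ -5A`,
  -- `2uv + 5B ≡ -10ABW + 5B ≡ 0`; since also `B² ≡ 4AC`, `v² + 5C ≡ -5C(2AW)² + 5C ≡ 0`. `r` and
  -- `c` are the explicit quotients.
  from-residues : ∀ m A B C u b W t j → 0ℤ ≤ m - 1ℤ → 0ℤ ≤ A - 1ℤ → + 4 * A * C - B * B ≡ m → u * u - - (+ 5 * A) ≡ b * m →
    W * (+ 2 * A) ≡ 1ℤ + t * m → m * m + 1ℤ ≡ + 5 * j → ∃[ X ] ∃[ Y ] ∃[ Z ] G X Y Z ≡ m
  from-residues m A B C u b W t j m≥1 A≥1 eΔ eb eW h5 = m-represented m A B C u (u * B * W) b c r j m≥1 A≥1 eΔ hb hr hc h5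
    where
    c = b * B * B * W * W + + 5 * W * W * A - + 5 * C * t * (t * m + + 2)
    r = + 2 * b * B * W - + 5 * B * t
    i₁ : ∀ u A m b → u * u + + 5 * A - m * b ≡ 1ℤ * (u * u - - (+ 5 * A) - b * m)
    i₁ = solve-∀
    hb : u * u + + 5 * A ≡ m * b
    hb = by₁ 1ℤ eb (i₁ u A m b)
    i₂ : ∀ u A m b B W t → + 2 * u * (u * B * W) + + 5 * B - m * (+ 2 * b * B * W - + 5 * B * t)
         ≡ + 2 * B * W * (u * u + + 5 * A - m * b) + - (+ 5 * B) * (W * (+ 2 * A) - (1ℤ + t * m))
    i₂ = solve-∀
    hr : + 2 * u * (u * B * W) + + 5 * B ≡ m * r
    hr = by₂ (+ 2 * B * W) (- (+ 5 * B)) hb eW (i₂ u A m b B W t)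
    i₃ : ∀ u A m b B C W t → u * B * W * (u * B * W) + + 5 * C - m * (b * B * B * W * W + + 5 * W * W * A - + 5 * C * t * (t * m + + 2))
         ≡ B * B * W * W * (u * u + + 5 * A - m * b) + + 5 * A * W * W * (+ 4 * A * C - B * B - m)
           + - (+ 5 * C * (W * (+ 2 * A) + 1ℤ + t * m)) * (W * (+ 2 * A) - (1ℤ + t * m))
    i₃ = solve-∀
    hc : u * B * W * (u * B * W) + + 5 * C ≡ m * c
    hc = by₃ (B * B * W * W) (+ 5 * A * W * W) (- (+ 5 * C * (W * (+ 2 * A) + 1ℤ + t * m))) hb eΔ eW (i₃ u A m b B C W t)

  module SquareFree (p : ℕ) (ps : List ℕ) (ops : All OddPrime (p ∷ ps)) (uniq : AllPairs _≢_ (p ∷ ps)) (k : ℕ) (m≡3 : ∏ₗ (p ∷ ps) ≡ 3 ℕ.+ k · 4)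
                    (χ5m : χ 5 (+ ∏ₗ (p ∷ ps)) ≡ -1ℤ) where
    private
      qs = p ∷ ps
      m = ∏ₗ qs
      ε : ℕ → ℤ
      ε q = χ q (- + 5)

      5∤m : ¬ (5 ℕ.∣ m)
      5∤m d = contra (trans (sym χ5m) (Symbol.χ-∣ oddPrime5 (∣ᵤ⇒∣ d)))
        where contra : -1ℤ ≢ 0ℤ
              contra ()

      ∣∏ : ∀ {qs} → All (ℕ._∣ ∏ₗ qs) qs
      ∣∏ {[]} = []
      ∣∏ {q ∷ qs} = ℕ.m∣m*n (∏ₗ qs) ∷ All.map (λ d → ℕ.∣n⇒∣m*n q d) ∣∏

      q≢5 : All (_≢ 5) qs
      q≢5 = All.map (λ { d refl → 5∤m d }) ∣∏

      h5 : ∃[ j ] + m * + m + 1ℤ ≡ + 5 * j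
      h5 = conv (Symbol.euler oddPrime5 (+ m))
        where
        open Mod (+ 5)
        l : ∀ m → m * (m * 1ℤ) - -1ℤ ≡ m * m + 1ℤ
        l = solve-∀
        conv : + m * (+ m * 1ℤ) ≈ χ 5 (+ m) → ∃[ j ] + m * + m + 1ℤ ≡ + 5 * j
        conv h with subst (λ u → + m * (+ m * 1ℤ) ≈ u) χ5m h
        ... | mod (divides j e) = j , trans (sym (l (+ m))) (trans e (*-comm j (+ 5)))

      ε-nz : All (λ q → ε q ≢ 0ℤ) qs
      ε-nz = All.zipWith (λ { (oq , ne) → nz oq ne }) (ops , q≢5)
        where
        nz : ∀ {q} → OddPrime q → q ≢ 5 → χ q (- + 5) ≢ 0ℤ
        nz {q} oq ne z = pick (Symbol.χ-∤ oq {(- + 5)} (λ d → prime∤prime (OddPrime.prime oq) (OddPrime.prime oddPrime5) ne (∣⇒∣ᵤ d)))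
          where
          pick : χ q (- + 5) ≡ 1ℤ ⊎ χ q (- + 5) ≡ -1ℤ → ⊥
          pick (inj₁ e) = 1≢0 (trans (sym e) z)
          pick (inj₂ e) = contra (trans (sym e) z)
            where contra : -1ℤ ≢ 0ℤ
                  contra ()

      module Ex = Existence p ps ops uniq k m≡3 ε (λ q → χ-tri q (- + 5)) ε-nz
      module Exp = Expand Ex.X ε (λ q → χ-tri q (- + 5))

      E≡Jac : ∀ qs → Exp.E qs ≡ Jac qs (- + 5)
      E≡Jac [] = refl
      E≡Jac (q ∷ qs) = cong (χ q (- + 5) *_) (E≡Jac qs)

      genus : Genus qs ε
      genus = Ex.exists (trans (E≡Jac qs) (Jac-neg5 {k = k} {j = proj₁ h5} ops m≡3 (proj₂ h5) q≢5))

      open Genus genus using (rs; n; f; n≡; rs-odd; distinct; rs∉qs; rs-split; values)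

      A = ∏ₗ rs

      -- `n` is `A` times a square, so `A` and `n` have the same symbol at `q`, namely that of -5;
      -- the product of -5 and `A` thus has symbol 1.
      residues : All (λ q → χ q (- (+ 5 * + A)) ≡ 1ℤ) qs
      residues = go ops ε-nz values
        where
        go : ∀ {qs} → All OddPrime qs → All (λ q → ε q ≢ 0ℤ) qs → All (λ q → χ q (+ n) ≡ ε q) qs → All (λ q → χ q (- (+ 5 * + A)) ≡ 1ℤ) qs
        go [] [] [] = []
        go {q ∷ _} (oq ∷ oqs) (e ∷ es) (v ∷ vs) = val ∷ go oqs es vs
          where
          open Symbol oq
          split : χ q (+ A) * (χ q (+ f) * χ q (+ f)) ≡ ε q
          split = trans (sym (trans (cong (λ u → χ q (+ u)) n≡) (trans (cong (χ q) (trans (pos-* A (f · f)) (cong (+ A *_) (pos-* f f))))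
                    (trans (χ-* (+ A) (+ f * + f)) (cong (χ q (+ A) *_) (χ-* (+ f) (+ f))))))) v
          tri-case : ∀ {a b e} → Tri a → Tri b → Tri e → e ≢ 0ℤ → a * (b * b) ≡ e → e * a ≡ 1ℤ
          tri-case zer b e nz refl = ⊥-elim (nz refl)
          tri-case one zer e nz refl = ⊥-elim (nz refl)
          tri-case one one e nz refl = refl
          tri-case one min e nz refl = refl
          tri-case min zer e nz refl = ⊥-elim (nz refl)
          tri-case min one e nz refl = refl
          tri-case min min e nz refl = refl
          l : ∀ x → - (+ 5 * x) ≡ - + 5 * x
          l = solve-∀
          val : χ q (- (+ 5 * + A)) ≡ 1ℤ
          val = trans (cong (χ q) (l (+ A))) (trans (χ-* (- + 5) (+ A)) (tri-case (χ-tri q (+ A)) (χ-tri q (+ f)) (χ-tri q (- + 5)) e split))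

      2A⊥m : Coprime (2 · A) m
      2A⊥m = coprime-sym (coprime-* {m} {2} {A} (Char.support odd-char m (λ z → 1≢0 (trans (sym (odd-∏ ops)) z))) (coprime-∏ (go rs-odd rs∉qs)))
        where
        go : ∀ {rs} → All OddPrime rs → All (λ ℓ → All (_≢ ℓ) qs) rs → All (Coprime m) rs
        go [] [] = []
        go (oℓ ∷ os) (ne ∷ nes) = coprime-sym (coprime-∏ (distinct-coprime oℓ ops (All.map ≢-sym ne))) ∷ go os nes

    opaque
      squarefree-represented : ∃[ X ] ∃[ Y ] ∃[ Z ] G X Y Z ≡ + m
      squarefree-represented = go (sqrt-list (- (+ 5 * + A)) ops uniq residues) (sqrt-list (- + m) rs-odd distinct rs-split)
          (inverse-mod {{ℕ.m*n≢0 2 A {{_}} {{ℕ.>-nonZero (∏ₗ≥1 rs-odd)}}}} 2A⊥m)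
        where
        go : (∃[ u ] + m ∣ u * u - - (+ 5 * + A)) → (∃[ x ] + A ∣ x * x - - + m) → (∃[ w ] ∃[ t ] w · (2 · A) ≡ 1 ℕ.+ t · m) → ∃[ X ] ∃[ Y ] ∃[ Z ] G X Y Z ≡ + m
        go (u , divides b eb) (x , dA) (w , t , ew) = fin (sqrt-4A A m k x (odd-∏ rs-odd) m≡3 dA)
          where
          eW : + w * (+ 2 * + A) ≡ 1ℤ + + t * + m
          eW = trans (cong (+ w *_) (sym (pos-* 2 A))) (trans (sym (pos-* w (2 · A))) (trans (cong +_ ew) (cong (λ u → 1ℤ + u) (pos-* t m))))
          fin : (∃[ B ] ∃[ C ] + 4 * + A * C - B * B ≡ + m) → ∃[ X ] ∃[ Y ] ∃[ Z ] G X Y Z ≡ + m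
          fin (B , C , eΔ) = from-residues (+ m) (+ A) B C u b (+ w) (+ t) (proj₁ h5)
            (i≤j⇒0≤j-i (+≤+ (∏ₗ≥1 ops))) (i≤j⇒0≤j-i (+≤+ (∏ₗ≥1 rs-odd))) eΔ eb eW (proj₂ h5)

  G-scale : ∀ f X Y Z → G (f * X) (f * Y) (f * Z) ≡ f * f * G X Y Z
  G-scale = l
    where l : ∀ f x y z → + 2 * (f * x * (f * x) + f * y * (f * y) + f * z * (f * z)) - f * x * (f * y) - f * y * (f * z) - f * z * (f * x)
                ≡ f * f * (+ 2 * (x * x + y * y + z * z) - x * y - y * z - z * x)
          l = solve-∀

  opaque
    -- Removing the square factor `f²` keeps both congruences: `f` is odd, so `f² ≡ 1` modulo 4, and
    -- `f` is prime to 5, so the symbol modulo 5 is unchanged. `G` is homogeneous of degree 2, which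
    -- puts `f` back.
    represented : ∀ m k → m ≡ 3 ℕ.+ k · 4 → χ 5 (+ m) ≡ -1ℤ → ∃[ X ] ∃[ Y ] ∃[ Z ] G X Y Z ≡ + m
    represented m k m≡ χm = go (squarefree-part m (subst (1 ℕ.≤_) (sym m≡) (s≤s z≤n)))
      where
      odd-m : odd m ≡ 1ℤ
      odd-m = trans (cong odd m≡) (odd-3+4* k)
      odd-factor : ∀ a b → m ≡ a · b → odd a ≢ 0ℤ × odd b ≢ 0ℤ
      odd-factor a b e = (λ z → 1≢0 (trans (sym odd-m) (trans (cong odd e) (trans (Char.mult odd-char a b) (cong (_* odd b) z))))) ,
                         (λ z → 1≢0 (trans (sym odd-m) (trans (cong odd e) (trans (Char.mult odd-char a b) (trans (cong (odd a *_) z) (*-zeroʳ (odd a)))))))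
      go : (∃[ qs ] ∃[ f ] m ≡ ∏ₗ qs · (f · f) × All Prime qs × AllPairs _≢_ qs × All (ℕ._∣ m) qs) → ∃[ X ] ∃[ Y ] ∃[ Z ] G X Y Z ≡ + m
      go (qs , f , e , pqs , us , ds) = nonempty qs ops us m₀≡3 χm₀ e
        where
        ops : All OddPrime qs
        ops = All.zipWith (λ { {q} (pq , ℕ.divides c ec) → oddPrime pq (odd≡1⇒ q (proj₂ (odd-factor c q ec))) }) (pqs , ds)
        h : ℕ
        h = ⌊ f /2⌋
        f≡ : f ≡ suc (h ℕ.+ h)
        f≡ = odd≡1⇒ f (λ z → proj₂ (odd-factor (∏ₗ qs) (f · f) e) (trans (Char.mult odd-char f f) (cong (_* odd f) z)))
        m₀≡3 : ∃[ j ] ∏ₗ qs ≡ 3 ℕ.+ j · 4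
        m₀≡3 = pick (κ-mod4 ops)
          where
          pick : (κ qs ≡ 1ℤ × ∃[ j ] ∏ₗ qs ≡ 1 ℕ.+ j · 4) ⊎ (κ qs ≡ -1ℤ × ∃[ j ] ∏ₗ qs ≡ 3 ℕ.+ j · 4) → ∃[ j ] ∏ₗ qs ≡ 3 ℕ.+ j · 4
          pick (inj₂ (_ , r)) = r
          pick (inj₁ (_ , j , ej)) = ⊥-elim (absurd (trans (sym ([m+kn]%n≡m%n 1 (j ℕ.+ (1 ℕ.+ j · 4) · (h · h ℕ.+ h)) 4)) (trans (cong (_% 4) (sym m≡1)) (trans (cong (_% 4) m≡) ([m+kn]%n≡m%n 3 k 4)))))
            where
            absurd : 1 ≢ 3
            absurd ()
            l : ∀ j h → (1 ℕ.+ j · 4) · (suc (h ℕ.+ h) · suc (h ℕ.+ h)) ≡ 1 ℕ.+ (j ℕ.+ (1 ℕ.+ j · 4) · (h · h ℕ.+ h)) · 4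
            l = ℕ-solve-∀
            m≡1 : m ≡ 1 ℕ.+ (j ℕ.+ (1 ℕ.+ j · 4) · (h · h ℕ.+ h)) · 4
            m≡1 = trans e (trans (cong₂ (λ a b → a · (b · b)) ej f≡) (l j h))
        χm₀ : χ 5 (+ ∏ₗ qs) ≡ -1ℤ
        χm₀ = tri-case (χ-tri 5 (+ ∏ₗ qs)) (χ-tri 5 (+ f)) (trans (sym (trans (cong (χ 5) (trans (cong +_ e) (trans (pos-* (∏ₗ qs) (f · f)) (cong (+ ∏ₗ qs *_) (pos-* f f)))))
                 (trans (S.χ-* (+ ∏ₗ qs) (+ f * + f)) (cong (χ 5 (+ ∏ₗ qs) *_) (S.χ-* (+ f) (+ f)))))) χm)
          where
          module S = Symbol oddPrime5
          tri-case : ∀ {a b} → Tri a → Tri b → a * (b * b) ≡ -1ℤ → a ≡ -1ℤ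
          tri-case zer b ()
          tri-case one zer ()
          tri-case one one ()
          tri-case one min ()
          tri-case min b e = refl
        nonempty : ∀ qs → All OddPrime qs → AllPairs _≢_ qs → (∃[ j ] ∏ₗ qs ≡ 3 ℕ.+ j · 4) → χ 5 (+ ∏ₗ qs) ≡ -1ℤ → m ≡ ∏ₗ qs · (f · f) → ∃[ X ] ∃[ Y ] ∃[ Z ] G X Y Z ≡ + m
        nonempty [] _ _ (j , ()) _ _
        nonempty (p ∷ ps) ops us (j , ej) χm₀ e = scale (SquareFree.squarefree-represented p ps ops us j ej χm₀)
          where
          scale : (∃[ X ] ∃[ Y ] ∃[ Z ] G X Y Z ≡ + ∏ₗ (p ∷ ps)) → ∃[ X ] ∃[ Y ] ∃[ Z ] G X Y Z ≡ + m
          scale (X , Y , Z , eG) = + f * X , + f * Y , + f * Z , trans (G-scale (+ f) X Y Z)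
            (trans (cong₂ _*_ (sym (pos-* f f)) eG) (trans (sym (pos-* (f · f) (∏ₗ (p ∷ ps)))) (cong +_ (trans (ℕ.*-comm (f · f) (∏ₗ (p ∷ ps))) (sym e)))))

-- Verification for small n by computation

module SmallNumbers where

  open import Defs
  open import Data.Nat using (ℕ; zero; suc; _+_; _*_; _∸_; _≤_; _<_; s≤s; _≡ᵇ_)
  open import Data.Nat.Properties
  open import Data.Nat.DivMod using (_/_; m*n/n≡m)
  open import Data.Nat.Tactic.RingSolver using (solve-∀)
  open import Data.Bool using (Bool; true; false; _∧_; _∨_; if_then_else_)
  open import Data.Bool.Properties using (T-≡)
  open import Function using (Equivalence)
  open import Data.List using (List; []; _∷_; replicate)

  triangular : ∀ k → ∃[ t ] k * suc k ≡ t * 2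
  triangular zero = 0 , refl
  triangular (suc k) with triangular k
  ... | t , e = t + suc k , trans (l k) (trans (cong (_+ suc k * 2) e) (sym (*-distribʳ-+ 2 t (suc k))))
    where l : ∀ k → suc k * suc (suc k) ≡ k * suc k + suc k * 2
          l = solve-∀

  p₅-double : ∀ x → 2 * p₅ x + x ≡ 3 * (x * x)
  p₅-double zero = refl
  p₅-double (suc k) with triangular k
  ... | t , e = trans (cong (λ u → 2 * u + suc k) half) (trans (l₂ t k) (trans (cong (λ u → 2 * (k * k + 2 * k + 1) + u + suc k) (sym e)) (l₃ k)))
    where
    l₀ : ∀ k → 3 * suc k ≡ suc (3 * k + 2)
    l₀ = solve-∀
    l₁ : ∀ k → suc k * (3 * k + 2) ≡ (k * k + 2 * k + 1) * 2 + k * suc k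
    l₁ = solve-∀
    half : p₅ (suc k) ≡ k * k + 2 * k + 1 + t
    half = trans (cong (λ u → (suc k * (u ∸ 1)) / 2) (l₀ k))
      (trans (cong (_/ 2) (trans (l₁ k) (trans (cong ((k * k + 2 * k + 1) * 2 +_) e) (sym (*-distribʳ-+ 2 (k * k + 2 * k + 1) t)))))
             (m*n/n≡m (k * k + 2 * k + 1 + t) 2))
    l₂ : ∀ t k → 2 * (k * k + 2 * k + 1 + t) + suc k ≡ 2 * (k * k + 2 * k + 1) + t * 2 + suc k
    l₂ = solve-∀
    l₃ : ∀ k → 2 * (k * k + 2 * k + 1) + k * suc k + suc k ≡ 3 * (suc k * suc k)
    l₃ = solve-∀

  p₅-suc : ∀ z → p₅ (suc z) ≡ p₅ z + suc (3 * z)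
  p₅-suc z = *-cancelˡ-≡ (p₅ (suc z)) (p₅ z + suc (3 * z)) 2 (+-cancelʳ-≡ (suc z) _ _
    (trans (p₅-double (suc z)) (sym (trans (l₁ (p₅ z) z) (trans (cong (_+ (6 * z + 3)) (p₅-double z)) (l₂ z))))))
    where
    l₁ : ∀ p z → 2 * (p + suc (3 * z)) + suc z ≡ 2 * p + z + (6 * z + 3)
    l₁ = solve-∀
    l₂ : ∀ z → 3 * (z * z) + (6 * z + 3) ≡ 3 * (suc z * suc z)
    l₂ = solve-∀

  Representable : ℕ → Set
  Representable n = ∃[ x ] ∃[ y ] ∃[ z ] ∃[ w ] n ≡ p₅ x + p₅ y + p₅ z + 2 * p₅ w

  at : List Bool → ℕ → Bool
  at [] i = false
  at (b ∷ L) zero = b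
  at (b ∷ L) (suc i) = at L i

  Sound : (ℕ → Set) → List Bool → Set
  Sound P L = ∀ i → at L i ≡ true → P i

  zipOr : List Bool → List Bool → List Bool
  zipOr [] M = M
  zipOr (l ∷ L) [] = []
  zipOr (l ∷ L) (m ∷ M) = (l ∨ m) ∷ zipOr L M

  shiftOr : ℕ → List Bool → List Bool → List Bool
  shiftOr zero L M = zipOr L M
  shiftOr (suc k) L [] = []
  shiftOr (suc k) L (m ∷ M) = m ∷ shiftOr k L M

  ∨-true : ∀ a {b} → a ∨ b ≡ true → a ≡ true ⊎ b ≡ true
  ∨-true true _ = inj₁ refl
  ∨-true false e = inj₂ e

  ∧-true : ∀ a {b} → a ∧ b ≡ true → a ≡ true × b ≡ true
  ∧-true true e = refl , e

  zipOr-sound : ∀ {P Q : ℕ → Set} L M → Sound P L → Sound Q M → (∀ i → P i → Q i) → Sound Q (zipOr L M)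
  zipOr-sound [] M p q f = q
  zipOr-sound (l ∷ L) (m ∷ M) p q f zero e with ∨-true l e
  ... | inj₁ h = f 0 (p 0 h)
  ... | inj₂ h = q 0 h
  zipOr-sound (l ∷ L) (m ∷ M) p q f (suc i) e =
    zipOr-sound L M (λ i → p (suc i)) (λ i → q (suc i)) (λ i → f (suc i)) i e

  shiftOr-sound : ∀ {P Q : ℕ → Set} k L M → Sound P L → Sound Q M → (∀ i → P i → Q (k + i)) → Sound Q (shiftOr k L M)
  shiftOr-sound zero L M p q f = zipOr-sound L M p q f
  shiftOr-sound (suc k) L (m ∷ M) p q f zero e = q 0 e
  shiftOr-sound {Q = Q} (suc k) L (m ∷ M) p q f (suc i) e = shiftOr-sound {Q = λ j → Q (suc j)} k L M p (λ i → q (suc i)) f i e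

  -- Sets of naturals below `size` as bit lists: this is the union of the shifts of `L` by `f 0`,
  -- ..., `f (c - 1)`. Shifts are cut off at the length of the accumulator, so the lists stay of
  -- bounded size.
  layer : ℕ → (ℕ → ℕ) → ℕ → List Bool → List Bool
  layer size f zero L = replicate size false
  layer size f (suc c) L = shiftOr (f c) L (layer size f c L)

  layer-sound : ∀ {P : ℕ → Set} size f c L → Sound P L → Sound (λ i → ∃[ x ] ∃[ j ] P j × i ≡ f x + j) (layer size f c L)
  layer-sound size f zero L p i e = absurd size i e
    where
    absurd : ∀ {A : Set} n i → at (replicate n false) i ≡ true → A
    absurd (suc n) (suc i) e = absurd n i e
  layer-sound size f (suc c) L p = shiftOr-sound (f c) L (layer size f c L) p (layer-sound size f c L p) (λ i h → c , i , h , refl)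

  Ternary₅ : ℕ → Set
  Ternary₅ r = ∃[ x ] ∃[ y ] ∃[ w ] r ≡ p₅ x + p₅ y + 2 * p₅ w

  table : ℕ → ℕ → ℕ → List Bool
  table size a b = layer size (λ w → 2 * p₅ w) b (layer size p₅ a (layer size p₅ a (true ∷ [])))

  table-sound : ∀ size a b → Sound Ternary₅ (table size a b)
  table-sound size a b r e = rearrange (layer-sound size (λ w → 2 * p₅ w) b _ (layer-sound size p₅ a _ (layer-sound size p₅ a (true ∷ []) unit)) r e)
    where
    unit : Sound (_≡ 0) (true ∷ [])
    unit zero _ = refl
    l : ∀ x y w → w + (y + (x + 0)) ≡ x + y + w
    l = solve-∀
    rearrange : (∃[ w ] ∃[ j ] (∃[ y ] ∃[ j′ ] (∃[ x ] ∃[ j″ ] j″ ≡ 0 × j′ ≡ p₅ x + j″) × j ≡ p₅ y + j′) × r ≡ 2 * p₅ w + j) → Ternary₅ r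
    rearrange (w , _ , (y , _ , (x , _ , refl , refl) , refl) , e) = x , y , w , trans e (l (p₅ x) (p₅ y) (2 * p₅ w))

  -- Searches for `n = p₅ z + i` with `j` attempts at the third summand, decreasing `z`. Going from
  -- `suc z` to `z` enlarges the remainder by `3z + 1`, the difference of consecutive pentagonal
  -- numbers.
  good : List Bool → ℕ → ℕ → ℕ → Bool
  good L zero z i = false
  good L (suc j) zero i = at L i
  good L (suc j) (suc z) i = at L i ∨ good L j z (i + suc (3 * z))

  -- Walks through consecutive `n` while keeping the pair (z, i) with `i ≤ 3z`: after `i = 3z` comes
  -- the next pentagonal number. Neither `n` nor `p₅ z` has to be computed.
  run : List Bool → ℕ → ℕ → ℕ → Bool
  run L zero z i = true
  run L (suc k) z i = good L 4 z i ∧ (if i ≡ᵇ 3 * z then run L k (suc z) 0 else run L k z (suc i))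

  use-table : ∀ {L} → Sound Ternary₅ L → ∀ z i → at L i ≡ true → Representable (p₅ z + i)
  use-table S z i e with S i e
  ... | x , y , w , eq = x , y , z , w , trans (cong (p₅ z +_) eq) (l (p₅ z) (p₅ x) (p₅ y) (2 * p₅ w))
    where l : ∀ z x y w → z + (x + y + w) ≡ x + y + z + w
          l = solve-∀

  good-sound : ∀ {L} → Sound Ternary₅ L → ∀ j z i → good L j z i ≡ true → Representable (p₅ z + i)
  good-sound {L} S (suc j) zero i e = use-table {L} S 0 i e
  good-sound {L} S (suc j) (suc z) i e with ∨-true (at L i) e
  ... | inj₁ h = use-table {L} S (suc z) i h
  ... | inj₂ h = subst Representable (trans (l (p₅ z) i (suc (3 * z))) (cong (_+ i) (sym (p₅-suc z)))) (good-sound {L} S j z (i + suc (3 * z)) h)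
    where l : ∀ p i s → p + (i + s) ≡ p + s + i
          l = solve-∀

  run-sound : ∀ {L} → Sound Ternary₅ L → ∀ k z i → run L k z i ≡ true → ∀ t → t < k → Representable (p₅ z + i + t)
  run-sound {L} S (suc k) z i e zero _ with ∧-true (good L 4 z i) e
  ... | h , _ = subst Representable (sym (+-identityʳ (p₅ z + i))) (good-sound {L} S 4 z i h)
  run-sound {L} S (suc k) z i e (suc t) (s≤s t<k) with ∧-true (good L 4 z i) e
  ... | _ , h with i ≡ᵇ 3 * z in eq
  ... | true = subst Representable (trans (cong (λ p → p + 0 + t) (p₅-suc z)) (trans (cong (λ u → p₅ z + suc u + 0 + t) (sym i≡)) (l (p₅ z) i t))) (run-sound {L} S k (suc z) 0 h t t<k)
    where
    i≡ : i ≡ 3 * z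
    i≡ = ≡ᵇ⇒≡ i (3 * z) (Equivalence.from T-≡ eq)
    l : ∀ p i t → p + suc i + 0 + t ≡ p + i + suc t
    l = solve-∀
  ... | false = subst Representable (l (p₅ z) i t) (run-sound {L} S k z (suc i) h t t<k)
    where l : ∀ p i t → p + suc i + t ≡ p + i + suc t
          l = solve-∀

  -- Each n < 27610 is p₅ z + r with r < 1100 in the table for one of the four largest possible z; p₅ 28 and 2 p₅ 20 exceed 1100.
  opaque
    small : ∀ n → n < 27610 → Representable n
    small = run-sound {table 1100 28 20} (table-sound 1100 28 20) 27610 0 0 refl

-- Cauchy's lemma and the choice of b for large n

module LargeNumbers where

  open import Defs
  open TernaryForms using (G; by₁; by₂; by₃; 0≤+; 0≤*; 0≤ℕ; 0≤sq; ¬0≤neg)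
  open LegendreSymbol
  open JacobiSymbol using (oddPrime5)
  open Representation using (represented)
  open SmallNumbers using (p₅-double; Representable; small)
  open import Data.Nat as ℕ using (ℕ; zero; suc; z≤n; s≤s) renaming (_*_ to _·_)
  import Data.Nat.Properties as ℕ
  open import Data.Nat.DivMod using (_%_; _/_; m≡m%n+[m/n]*n; m%n<n)
  import Data.Nat.Divisibility as ℕ
  open import Data.Nat.Tactic.RingSolver renaming (solve-∀ to ℕ-solve-∀)
  open import Data.Integer using (ℤ; +_; -[1+_]; 0ℤ; 1ℤ; -1ℤ; _+_; _-_; _*_; -_; _≤_; ∣_∣; +≤+)
  open import Data.Integer.Properties
  open import Data.Integer.Divisibility.Signed using (_∣_; divides; ∣⇒∣ᵤ)
  open import Data.Integer.Tactic.RingSolver using (solve-∀)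

  -- Cauchy's lemma: with a = x²+y²+z²+2w² and b = x+y+z+2w, the inequality 4a < b²+2b+5 forces x, y, z, w ≥ 0.
  module Cauchy (a : ℤ) (b : ℕ) (bound : 0ℤ ≤ + b * + b + + 2 * + b + + 5 - + 4 * a - 1ℤ) where

    -- Cauchy-Schwarz with weights 1, 1, 2 gives `(b - x)² ≤ 4(a - x²)`, so `b² - 2bx + 5x² ≤ 4a`;
    -- for `x ≤ -1` this contradicts `bound`. The squares in the certificate are the Lagrange
    -- identity of this inequality.
    nonneg₁ : ∀ x y z w → x + y + z + + 2 * w ≡ + b → x * x + y * y + z * z + + 2 * (w * w) ≡ a → 0ℤ ≤ x
    nonneg₁ (+ n) _ _ _ _ _ = 0≤ℕ
    nonneg₁ x@(-[1+ n ]) y z w refl′ refl″ = ⊥-elim (¬0≤neg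
      (0≤+ (0≤+ (0≤+ bound (0≤+ (0≤sq (y - z)) (0≤* (0≤ℕ {2}) (0≤+ (0≤sq (y - w)) (0≤sq (z - w)))))) (0≤* (0≤* (0≤ℕ {2}) (0≤ℕ {b})) (0≤ℕ {n}))) (0≤* (0≤ℕ {5}) (0≤+ (0≤sq (+ n)) (0≤* (0≤ℕ {2}) (0≤ℕ {n})))))
      (l y z w (+ n) (+ b) a (subst (λ u → u + y + z + + 2 * w ≡ + b) (x≡ n) refl′) (subst (λ u → u * u + y * y + z * z + + 2 * (w * w) ≡ a) (x≡ n) refl″)))
      where
      x≡ : ∀ n → -[1+ n ] ≡ - (1ℤ + + n)
      x≡ n = refl
      i : ∀ y z w n b a → b * b + + 2 * b + + 5 - + 4 * a - 1ℤ + ((y - z) * (y - z) + + 2 * ((y - w) * (y - w) + (z - w) * (z - w))) + + 2 * b * n + + 5 * (n * n + + 2 * n) - -1ℤ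
            ≡ (- (- (1ℤ + n) + y + z + + 2 * w + b) - + 2 * (1ℤ + n)) * (- (1ℤ + n) + y + z + + 2 * w - b) + + 4 * (- (1ℤ + n) * - (1ℤ + n) + y * y + z * z + + 2 * (w * w) - a)
      i = solve-∀
      l : ∀ y z w n b a → - (1ℤ + n) + y + z + + 2 * w ≡ b → - (1ℤ + n) * - (1ℤ + n) + y * y + z * z + + 2 * (w * w) ≡ a →
        b * b + + 2 * b + + 5 - + 4 * a - 1ℤ + ((y - z) * (y - z) + + 2 * ((y - w) * (y - w) + (z - w) * (z - w))) + + 2 * b * n + + 5 * (n * n + + 2 * n) ≡ -1ℤ
      l y z w n b a e₁ e₂ = by₂ (- (- (1ℤ + n) + y + z + + 2 * w + b) - + 2 * (1ℤ + n)) (+ 4) e₁ e₂ (i y z w n b a)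

    -- Here `(b - 2w)² ≤ 3(a - 2w²)`, so `w ≤ -1` would give `b² + 4b + 10 ≤ 3a`; four times this is
    -- incompatible with three times `bound`.
    nonneg₂ : ∀ x y z w → x + y + z + + 2 * w ≡ + b → x * x + y * y + z * z + + 2 * (w * w) ≡ a → 0ℤ ≤ w
    nonneg₂ _ _ _ (+ n) _ _ = 0≤ℕ
    nonneg₂ x y z -[1+ n ] e₁ e₂ = ⊥-elim (¬0≤neg
      (0≤+ (0≤+ (0≤* (0≤ℕ {3}) bound) (0≤* (0≤ℕ {4}) (0≤+ (0≤+ (0≤sq (x - y)) (0≤sq (y - z))) (0≤sq (z - x)))))
        (0≤+ (0≤+ (0≤sq (+ b)) (0≤* (0≤ℕ {b}) (0≤+ (0≤ℕ {10}) (0≤* (0≤ℕ {16}) (0≤ℕ {n}))))) (0≤* (0≤ℕ {40}) (0≤+ (0≤sq (+ n)) (0≤* (0≤ℕ {2}) (0≤ℕ {n}))))))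
      (l x y z (+ n) (+ b) a e₁ e₂))
      where
      i : ∀ x y z n b a → + 3 * (b * b + + 2 * b + + 5 - + 4 * a - 1ℤ) + + 4 * ((x - y) * (x - y) + (y - z) * (y - z) + (z - x) * (z - x))
            + (b * b + b * (+ 10 + + 16 * n) + + 40 * (n * n + + 2 * n)) - - + 28
            ≡ - (+ 4 * (x + y + z + b + + 2 * (1ℤ + n))) * (x + y + z + + 2 * - (1ℤ + n) - b) + + 12 * (x * x + y * y + z * z + + 2 * (- (1ℤ + n) * - (1ℤ + n)) - a)
      i = solve-∀
      l : ∀ x y z n b a → x + y + z + + 2 * - (1ℤ + n) ≡ b → x * x + y * y + z * z + + 2 * (- (1ℤ + n) * - (1ℤ + n)) ≡ a →
        + 3 * (b * b + + 2 * b + + 5 - + 4 * a - 1ℤ) + + 4 * ((x - y) * (x - y) + (y - z) * (y - z) + (z - x) * (z - x))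
            + (b * b + b * (+ 10 + + 16 * n) + + 40 * (n * n + + 2 * n)) ≡ - + 28
      l x y z n b a e₁ e₂ = by₂ (- (+ 4 * (x + y + z + b + + 2 * (1ℤ + n)))) (+ 12) e₁ e₂ (i x y z n b a)

  -- 2n = 3a - b, with b moved so that no subtraction occurs.
  pentagonal-sum : ∀ n x y z w → 2 · n ℕ.+ (x ℕ.+ y ℕ.+ z ℕ.+ 2 · w) ≡ 3 · (x · x ℕ.+ y · y ℕ.+ z · z ℕ.+ 2 · (w · w)) → n ≡ p₅ x ℕ.+ p₅ y ℕ.+ p₅ z ℕ.+ 2 · p₅ w
  pentagonal-sum n x y z w e = ℕ.*-cancelˡ-≡ n (p₅ x ℕ.+ p₅ y ℕ.+ p₅ z ℕ.+ 2 · p₅ w) 2 (ℕ.+-cancelʳ-≡ (x ℕ.+ y ℕ.+ z ℕ.+ 2 · w) _ _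
    (trans e (sym (trans (l₁ (p₅ x) (p₅ y) (p₅ z) (p₅ w) x y z w)
      (trans (cong₂ ℕ._+_ (cong₂ ℕ._+_ (cong₂ ℕ._+_ (p₅-double x) (p₅-double y)) (p₅-double z)) (cong (2 ·_) (p₅-double w))) (l₂ (x · x) (y · y) (z · z) (w · w)))))))
    where
    l₁ : ∀ p q r s x y z w → 2 · (p ℕ.+ q ℕ.+ r ℕ.+ 2 · s) ℕ.+ (x ℕ.+ y ℕ.+ z ℕ.+ 2 · w) ≡ 2 · p ℕ.+ x ℕ.+ (2 · q ℕ.+ y) ℕ.+ (2 · r ℕ.+ z) ℕ.+ 2 · (2 · s ℕ.+ w)
    l₁ = ℕ-solve-∀
    l₂ : ∀ x y z w → 3 · x ℕ.+ 3 · y ℕ.+ 3 · z ℕ.+ 2 · (3 · w) ≡ 3 · (x ℕ.+ y ℕ.+ z ℕ.+ 2 · w)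
    l₂ = ℕ-solve-∀

  -- The numbers are tied by `3a = 2n + b` and `5a = 2m + b²`. Eliminating `a` gives `h6`, and
  -- `a = 2·3a - 5a` in `ha` defines `a` without dividing by 3. `hb` is `bound` multiplied by 3,
  -- with `a` eliminated.
  module FromG (n b : ℕ) (m a : ℤ) (h6 : + 10 * + n + + 5 * + b - + 3 * (+ b * + b) ≡ + 6 * m)
               (ha : a ≡ + 2 * (+ 2 * + n + + b) - + 2 * m - + b * + b) (hb : 0ℤ ≤ + 3 * (+ b * + b) + + 2 * + b + + 15 - + 8 * + n - 1ℤ) where

    five-a : + 5 * a ≡ + 2 * m + + b * + b
    five-a = l (+ n) (+ b) m a h6 ha
      where
      i : ∀ n b m a → + 5 * a - (+ 2 * m + b * b) ≡ + 2 * (+ 10 * n + + 5 * b - + 3 * (b * b) - + 6 * m) + + 5 * (a - (+ 2 * (+ 2 * n + b) - + 2 * m - b * b))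
      i = solve-∀
      l : ∀ n b m a → + 10 * n + + 5 * b - + 3 * (b * b) ≡ + 6 * m → a ≡ + 2 * (+ 2 * n + b) - + 2 * m - b * b → + 5 * a ≡ + 2 * m + b * b
      l n b m a h₁ h₂ = by₂ (+ 2) (+ 5) h₁ h₂ (i n b m a)

    three-a : + 2 * + n + + b ≡ + 3 * a
    three-a = l (+ n) (+ b) m a h6 ha
      where
      i : ∀ n b m a → + 2 * n + b - + 3 * a ≡ -1ℤ * (+ 10 * n + + 5 * b - + 3 * (b * b) - + 6 * m) + - + 3 * (a - (+ 2 * (+ 2 * n + b) - + 2 * m - b * b))
      i = solve-∀
      l : ∀ n b m a → + 10 * n + + 5 * b - + 3 * (b * b) ≡ + 6 * m → a ≡ + 2 * (+ 2 * n + b) - + 2 * m - b * b → + 2 * n + b ≡ + 3 * a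
      l n b m a h₁ h₂ = by₂ -1ℤ (- + 3) h₁ h₂ (i n b m a)

    bound : 0ℤ ≤ + b * + b + + 2 * + b + + 5 - + 4 * a - 1ℤ
    bound = third _ (subst (0ℤ ≤_) (l (+ n) (+ b) a three-a) hb)
      where
      third : ∀ t → 0ℤ ≤ + 3 * t + + 2 → 0ℤ ≤ t
      third (+ t) _ = 0≤ℕ
      third -[1+ t ] h = ⊥-elim (¬0≤neg (0≤+ h (0≤* (0≤ℕ {3}) (0≤ℕ {t}))) (r (+ t)))
        where r : ∀ t → + 3 * - (1ℤ + t) + + 2 + + 3 * t ≡ -1ℤ
              r = solve-∀
      i : ∀ n b a → + 3 * (b * b) + + 2 * b + + 15 - + 8 * n - 1ℤ - (+ 3 * (b * b + + 2 * b + + 5 - + 4 * a - 1ℤ) + + 2) ≡ - + 4 * (+ 2 * n + b - + 3 * a)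
      i = solve-∀
      l : ∀ n b a → + 2 * n + b ≡ + 3 * a → + 3 * (b * b) + + 2 * b + + 15 - + 8 * n - 1ℤ ≡ + 3 * (b * b + + 2 * b + + 5 - + 4 * a - 1ℤ) + + 2
      l n b a h = by₁ (- + 4) h (i n b a)

    open Cauchy a b bound

    naturals : ∀ x y z w → x + y + z + + 2 * w ≡ + b → x * x + y * y + z * z + + 2 * (w * w) ≡ a → Representable n
    naturals x y z w e₁ e₂ = go x y z w (nonneg₁ x y z w e₁ e₂) (nonneg₁ y x z w (trans (s₁ x y z w) e₁) (trans (q₁ x y z w) e₂))
        (nonneg₁ z y x w (trans (s₂ x y z w) e₁) (trans (q₂ x y z w) e₂)) (nonneg₂ x y z w e₁ e₂) e₁ e₂
      where
      s₁ : ∀ x y z w → y + x + z + + 2 * w ≡ x + y + z + + 2 * w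
      s₁ = solve-∀
      q₁ : ∀ x y z w → y * y + x * x + z * z + + 2 * (w * w) ≡ x * x + y * y + z * z + + 2 * (w * w)
      q₁ = solve-∀
      s₂ : ∀ x y z w → z + y + x + + 2 * w ≡ x + y + z + + 2 * w
      s₂ = solve-∀
      q₂ : ∀ x y z w → z * z + y * y + x * x + + 2 * (w * w) ≡ x * x + y * y + z * z + + 2 * (w * w)
      q₂ = solve-∀
      sq : ∀ x → + (x · x) ≡ + x * + x
      sq x = pos-* x x
      go : ∀ x y z w → 0ℤ ≤ x → 0ℤ ≤ y → 0ℤ ≤ z → 0ℤ ≤ w → x + y + z + + 2 * w ≡ + b → x * x + y * y + z * z + + 2 * (w * w) ≡ a → Representable n
      go (+ x) (+ y) (+ z) (+ w) _ _ _ _ e₁ e₂ = x , y , z , w , pentagonal-sum n x y z w (+-injective (begin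
        + (2 · n ℕ.+ (x ℕ.+ y ℕ.+ z ℕ.+ 2 · w))                ≡⟨ cong₂ _+_ (pos-* 2 n) (cong (λ u → + x + + y + + z + u) (pos-* 2 w)) ⟩
        + 2 * + n + (+ x + + y + + z + + 2 * + w)               ≡⟨ cong (λ u → + 2 * + n + u) e₁ ⟩
        + 2 * + n + + b                                         ≡⟨ three-a ⟩
        + 3 * a                                                 ≡⟨ cong (+ 3 *_) (sym e₂) ⟩
        + 3 * (+ x * + x + + y * + y + + z * + z + + 2 * (+ w * + w))  ≡⟨ cong (+ 3 *_) (sym (cong₂ _+_ (cong₂ _+_ (cong₂ _+_ (sq x) (sq y)) (sq z)) (trans (pos-* 2 (w · w)) (cong (+ 2 *_) (sq w))))) ⟩
        + 3 * + (x · x ℕ.+ y · y ℕ.+ z · z ℕ.+ 2 · (w · w))     ≡⟨ sym (pos-* 3 (x · x ℕ.+ y · y ℕ.+ z · z ℕ.+ 2 · (w · w))) ⟩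
        + (3 · (x · x ℕ.+ y · y ℕ.+ z · z ℕ.+ 2 · (w · w)))     ∎))
        where open ≡-Reasoning

    -- Inverts the passage to differences: with `w = -q` and `x = X + w`, `y = Y + w`, `z = Z + w`
    -- the linear sum is `X + Y + Z - 5q = b`, and the sum of squares follows from the value of `G`.
    shift : ∀ X Y Z q → G X Y Z ≡ m → X + Y + Z - + b ≡ q * + 5 → Representable n
    shift X Y Z q eG e = naturals (X - q) (Y - q) (Z - q) (- q) (sum X Y Z q (+ b) e) (*-cancelˡ-≡ (+ 5) _ _ (squares X Y Z q (+ b) m a eG e five-a))
      where
      i₁ : ∀ X Y Z q b → X - q + (Y - q) + (Z - q) + + 2 * - q - b ≡ 1ℤ * (X + Y + Z - b - q * + 5)
      i₁ = solve-∀
      sum : ∀ X Y Z q b → X + Y + Z - b ≡ q * + 5 → X - q + (Y - q) + (Z - q) + + 2 * - q ≡ b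
      sum X Y Z q b e = by₁ 1ℤ e (i₁ X Y Z q b)
      i₂ : ∀ X Y Z q b m a → + 5 * ((X - q) * (X - q) + (Y - q) * (Y - q) + (Z - q) * (Z - q) + + 2 * (- q * - q)) - + 5 * a
            ≡ + 2 * (+ 2 * (X * X + Y * Y + Z * Z) - X * Y - Y * Z - Z * X - m) + (X + Y + Z - + 5 * q + b) * (X + Y + Z - b - q * + 5) + -1ℤ * (+ 5 * a - (+ 2 * m + b * b))
      i₂ = solve-∀
      squares : ∀ X Y Z q b m a → + 2 * (X * X + Y * Y + Z * Z) - X * Y - Y * Z - Z * X ≡ m → X + Y + Z - b ≡ q * + 5 → + 5 * a ≡ + 2 * m + b * b →
        + 5 * ((X - q) * (X - q) + (Y - q) * (Y - q) + (Z - q) * (Z - q) + + 2 * (- q * - q)) ≡ + 5 * a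
      squares X Y Z q b m a h₁ h₂ h₃ = by₃ (+ 2) (X + Y + Z - + 5 * q + b) -1ℤ h₁ h₂ h₃ (i₂ X Y Z q b m a)

    -- 2G = 5(X²+Y²+Z²) - (X+Y+Z)², so X+Y+Z ≡ ±b modulo 5.
    from-G : ∀ X Y Z → G X Y Z ≡ m → Representable n
    from-G X Y Z eG = pick (euclid (OddPrime.prime oddPrime5) (X + Y + Z - + b) (X + Y + Z + + b) (divides (X * X + Y * Y + Z * Z - a) (l X Y Z (+ b) m a eG five-a)))
      where
      i : ∀ X Y Z b m a → (X + Y + Z - b) * (X + Y + Z + b) - (X * X + Y * Y + Z * Z - a) * + 5
          ≡ - + 2 * (+ 2 * (X * X + Y * Y + Z * Z) - X * Y - Y * Z - Z * X - m) + 1ℤ * (+ 5 * a - (+ 2 * m + b * b))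
      i = solve-∀
      l : ∀ X Y Z b m a → + 2 * (X * X + Y * Y + Z * Z) - X * Y - Y * Z - Z * X ≡ m → + 5 * a ≡ + 2 * m + b * b →
          (X + Y + Z - b) * (X + Y + Z + b) ≡ (X * X + Y * Y + Z * Z - a) * + 5
      l X Y Z b m a h₁ h₂ = by₂ (- + 2) 1ℤ h₁ h₂ (i X Y Z b m a)
      g : ∀ x y z → + 2 * (- x * - x + - y * - y + - z * - z) - - x * - y - - y * - z - - z * - x ≡ + 2 * (x * x + y * y + z * z) - x * y - y * z - z * x
      g = solve-∀
      j : ∀ X Y Z b q → - X + - Y + - Z - b - - q * + 5 ≡ -1ℤ * (X + Y + Z + b - q * + 5)
      j = solve-∀
      pick : (+ 5 ∣ X + Y + Z - + b) ⊎ (+ 5 ∣ X + Y + Z + + b) → Representable n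
      pick (inj₁ (divides q e)) = shift X Y Z q eG e
      pick (inj₂ (divides q e)) = shift (- X) (- Y) (- Z) (- q) (trans (g X Y Z) eG) (by₁ -1ℤ e (j X Y Z (+ b) q))

  crossing : ∀ {P : ℕ → Set} → (∀ i → Dec (P i)) → ∀ s → ¬ P s → ∀ d → P (s ℕ.+ d) → ∃[ c ] s ℕ.≤ c × ¬ P c × P (suc c)
  crossing {P} P? s ¬p zero p = ⊥-elim (¬p (subst P (ℕ.+-identityʳ s) p))
  crossing {P} P? s ¬p (suc d) p with P? (s ℕ.+ d)
  ... | yes q = crossing P? s ¬p d q
  ... | no ¬q = s ℕ.+ d , ℕ.m≤m+n s d , ¬q , subst P (ℕ.+-suc s d) p

  %-≡⇒∣ : ∀ x y → x % 24 ≡ y % 24 → + 24 ∣ + x - + y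
  %-≡⇒∣ x y e = divides (+ (x / 24) - + (y / 24)) (l (+ x) (+ y) (+ (x % 24)) (+ (x / 24)) (+ (y / 24)) (ex x) (trans (ex y) (cong (λ u → + u + + (y / 24) * + 24) (sym e))))
    where
    ex : ∀ x → + x ≡ + (x % 24) + + (x / 24) * + 24
    ex x = trans (cong +_ (m≡m%n+[m/n]*n x 24)) (cong (λ u → + (x % 24) + u) (pos-* (x / 24) 24))
    l : ∀ x y r p q → x ≡ r + p * + 24 → y ≡ r + q * + 24 → x - y ≡ (p - q) * + 24
    l x y r p q refl refl = i r p q
      where i : ∀ r p q → r + p * + 24 - (r + q * + 24) ≡ (p - q) * + 24
            i = solve-∀

  opaque
    -- `m ≡ 3` modulo 4 means `6m = 10n + 5b - 3b² ≡ 18` modulo 24, which depends on `n` modulo 12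
    -- and `b` modulo 24. With the condition modulo 5 the period in `b` is 120, and a window of 33
    -- consecutive values is checked from each starting class.
    residue : ∀ {r} → r ℕ.< 12 → ∀ {s} → s ℕ.< 120 →
      ∃[ i ] i ℕ.< 33 × (10 · r ℕ.+ 5 · (s ℕ.+ i)) % 24 ≡ (18 ℕ.+ 3 · ((s ℕ.+ i) · (s ℕ.+ i))) % 24 × (s ℕ.+ i) % 5 ≢ 0
    residue = toWitness {a? = ℕ.allUpTo? (λ r → ℕ.allUpTo? (λ s → ℕ.anyUpTo? (λ i → ((10 · r ℕ.+ 5 · (s ℕ.+ i)) % 24 ℕ.≟ (18 ℕ.+ 3 · ((s ℕ.+ i) · (s ℕ.+ i))) % 24) ×-dec ¬? ((s ℕ.+ i) % 5 ℕ.≟ 0)) 33) 120) 12} tt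

  -- 2 is a nonresidue modulo 5. From `10n + 5b - 3b² = 6m` one gets `m ≡ 2b²` modulo 5, so `5 ∤ b`
  -- is what the condition on `m` comes to.
  χ5-twice-square : ∀ b → ¬ (5 ℕ.∣ b) → χ 5 (+ 2 * (+ b * + b)) ≡ -1ℤ
  χ5-twice-square b nd = trans (χ-* (+ 2) (+ b * + b)) (cong₂ _*_ (χ-unique (+ 2) min (mod (divides 1ℤ refl))) (χ-sq (+ b) (λ d → nd (∣⇒∣ᵤ d))))
    where
    open Symbol oddPrime5
    open Mod (+ 5)

  -- b runs over the 33 integers above the last c with 3c² + 2c + 15 ≤ 8n, which is enough to reach m ≡ 3 mod 4 and 5 ∤ b.
  -- All of them satisfy 3b² < 10n + 5b (so m > 0) once c ≥ 271, that is, from n = 27610 on.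
  module Large (n : ℕ) (n≥ : 27610 ℕ.≤ n) where
    P : ℕ → Set
    P b = 8 · n ℕ.< 3 · (b · b) ℕ.+ 2 · b ℕ.+ 15

    threshold : ∃[ c ] 271 ℕ.≤ c × ¬ P c × P (suc c)
    threshold = crossing {P} (λ b → 8 · n ℕ.<? 3 · (b · b) ℕ.+ 2 · b ℕ.+ 15) 271 (ℕ.≤⇒≯ (ℕ.*-monoʳ-≤ 8 n≥)) (8 · n) far
      where
      far : P (271 ℕ.+ 8 · n)
      far = begin-strict
        8 · n                                         ≤⟨ ℕ.m≤n+m (8 · n) 271 ⟩
        271 ℕ.+ 8 · n                                 ≤⟨ ℕ.m≤n*m (271 ℕ.+ 8 · n) 2 ⟩
        2 · (271 ℕ.+ 8 · n)                           <⟨ ℕ.m<m+n (2 · (271 ℕ.+ 8 · n)) {15} (s≤s z≤n) ⟩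
        2 · (271 ℕ.+ 8 · n) ℕ.+ 15                    ≤⟨ ℕ.+-monoˡ-≤ 15 (ℕ.m≤n+m (2 · (271 ℕ.+ 8 · n)) (3 · ((271 ℕ.+ 8 · n) · (271 ℕ.+ 8 · n)))) ⟩
        3 · ((271 ℕ.+ 8 · n) · (271 ℕ.+ 8 · n)) ℕ.+ 2 · (271 ℕ.+ 8 · n) ℕ.+ 15 ∎
        where open ℕ.≤-Reasoning

    c = proj₁ threshold

    choice = residue (m%n<n n 12) (m%n<n (suc c) 120)
    i = proj₁ choice
    t = suc c % 120 ℕ.+ i
    q = n / 12
    q′ = suc c / 120
    b = suc c ℕ.+ i

    b≡ : b ≡ t ℕ.+ q′ · 120
    b≡ = trans (cong (ℕ._+ i) (m≡m%n+[m/n]*n (suc c) 120)) (l (suc c % 120) (q′ · 120) i)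
      where l : ∀ s k i → s ℕ.+ k ℕ.+ i ≡ s ℕ.+ i ℕ.+ k
            l = ℕ-solve-∀

    5∤b : ¬ (5 ℕ.∣ b)
    5∤b d = proj₂ (proj₂ (proj₂ choice)) (ℕ.n∣m⇒m%n≡0 t 5 (ℕ.∣m+n∣m⇒∣n (subst (5 ℕ.∣_) (trans b≡ (ℕ.+-comm t (q′ · 120))) d)
      (ℕ.∣n⇒∣m*n q′ (ℕ.divides 24 refl))))

    lower : P b
    lower = ℕ.<-≤-trans (proj₂ (proj₂ (proj₂ threshold))) (ℕ.+-monoˡ-≤ 15 (ℕ.+-mono-≤ (ℕ.*-monoʳ-≤ 3 (ℕ.*-mono-≤ le le)) (ℕ.*-monoʳ-≤ 2 le)))
      where le : suc c ℕ.≤ b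
            le = ℕ.m≤m+n (suc c) i

    -- As `c` fails `P`, `8n ≥ 3c² + 2c + 15`, while `c < b ≤ c + 33`. This bounds both sides,
    -- multiplied by 4, by polynomials in `c`.
    upper : 3 · (b · b) ℕ.< 10 · n ℕ.+ 5 · b
    upper = ℕ.*-cancelˡ-< 4 (3 · (b · b)) (10 · n ℕ.+ 5 · b) (begin-strict
      4 · (3 · (b · b))                                          ≡⟨ l₁ b ⟩
      12 · (b · b)                                               ≤⟨ ℕ.*-monoʳ-≤ 12 (ℕ.*-mono-≤ b≤ b≤) ⟩
      12 · ((c ℕ.+ 33) · (c ℕ.+ 33))                             <⟨ poly (proj₁ (proj₂ threshold)) ⟩
      15 · (c · c) ℕ.+ 30 · c ℕ.+ 95                             ≡⟨ l₂ c ⟩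
      5 · (3 · (c · c) ℕ.+ 2 · c ℕ.+ 15) ℕ.+ 20 · suc c          ≤⟨ ℕ.+-mono-≤ (ℕ.*-monoʳ-≤ 5 (ℕ.≮⇒≥ (proj₁ (proj₂ (proj₂ threshold))))) (ℕ.*-monoʳ-≤ 20 (ℕ.m≤m+n (suc c) i)) ⟩
      5 · (8 · n) ℕ.+ 20 · b                                     ≡⟨ l₃ n b ⟩
      4 · (10 · n ℕ.+ 5 · b)                                     ∎)
      where
      open ℕ.≤-Reasoning
      l₁ : ∀ b → 4 · (3 · (b · b)) ≡ 12 · (b · b)
      l₁ = ℕ-solve-∀
      l₂ : ∀ c → 15 · (c · c) ℕ.+ 30 · c ℕ.+ 95 ≡ 5 · (3 · (c · c) ℕ.+ 2 · c ℕ.+ 15) ℕ.+ 20 · suc c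
      l₂ = ℕ-solve-∀
      l₃ : ∀ n b → 5 · (8 · n) ℕ.+ 20 · b ≡ 4 · (10 · n ℕ.+ 5 · b)
      l₃ = ℕ-solve-∀
      b≤ : b ℕ.≤ c ℕ.+ 33
      b≤ = subst (ℕ._≤ c ℕ.+ 33) (ℕ.+-suc c i) (ℕ.+-monoʳ-≤ c (proj₁ (proj₂ choice)))
      g₁ : ∀ c k → 12 · ((c ℕ.+ k) · (c ℕ.+ k)) ≡ 12 · (c · c) ℕ.+ 24 · k · c ℕ.+ 12 · (k · k)
      g₁ = ℕ-solve-∀
      g₂ : ∀ x y z u v → x ℕ.+ (y ℕ.+ z) ℕ.+ (u ℕ.+ v) ≡ x ℕ.+ y ℕ.+ (z ℕ.+ u) ℕ.+ v
      g₂ = ℕ-solve-∀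
      g₃ : ∀ x y v → 12 · x ℕ.+ y ℕ.+ 3 · x ℕ.+ v ≡ 15 · x ℕ.+ y ℕ.+ v
      g₃ = ℕ-solve-∀
      -- After cancellation `3c²` has to exceed `762c + 12973`, and `c ≥ 271` gives
      -- `3c² ≥ 813c ≥ 762c + 51 · 271`.
      poly : ∀ {c} → 271 ℕ.≤ c → 12 · ((c ℕ.+ 33) · (c ℕ.+ 33)) ℕ.< 15 · (c · c) ℕ.+ 30 · c ℕ.+ 95
      poly {c} le = begin-strict
        12 · ((c ℕ.+ 33) · (c ℕ.+ 33))                             ≡⟨ g₁ c 33 ⟩
        12 · (c · c) ℕ.+ 792 · c ℕ.+ 13068                         ≡⟨ cong (λ u → 12 · (c · c) ℕ.+ u ℕ.+ 13068) (ℕ.*-distribʳ-+ c 30 762) ⟩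
        12 · (c · c) ℕ.+ (30 · c ℕ.+ 762 · c) ℕ.+ 13068            <⟨ ℕ.+-monoʳ-< (12 · (c · c) ℕ.+ (30 · c ℕ.+ 762 · c)) (ℕ.≤ᵇ⇒≤ 13069 13916 tt) ⟩
        12 · (c · c) ℕ.+ (30 · c ℕ.+ 762 · c) ℕ.+ (51 · 271 ℕ.+ 95) ≡⟨ g₂ (12 · (c · c)) (30 · c) (762 · c) (51 · 271) 95 ⟩
        12 · (c · c) ℕ.+ 30 · c ℕ.+ (762 · c ℕ.+ 51 · 271) ℕ.+ 95  ≤⟨ ℕ.+-monoˡ-≤ 95 (ℕ.+-monoʳ-≤ (12 · (c · c) ℕ.+ 30 · c) cc) ⟩
        12 · (c · c) ℕ.+ 30 · c ℕ.+ 3 · (c · c) ℕ.+ 95             ≡⟨ g₃ (c · c) (30 · c) 95 ⟩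
        15 · (c · c) ℕ.+ 30 · c ℕ.+ 95                             ∎
        where
        cc : 762 · c ℕ.+ 51 · 271 ℕ.≤ 3 · (c · c)
        cc = begin
          762 · c ℕ.+ 51 · 271     ≤⟨ ℕ.+-monoʳ-≤ (762 · c) (ℕ.*-monoʳ-≤ 51 le) ⟩
          762 · c ℕ.+ 51 · c       ≡⟨ sym (ℕ.*-distribʳ-+ c 762 51) ⟩
          813 · c                  ≡⟨ ℕ.*-assoc 3 271 c ⟩
          3 · (271 · c)            ≤⟨ ℕ.*-monoʳ-≤ 3 (ℕ.*-monoˡ-≤ c le) ⟩
          3 · (c · c)              ∎

    24∣ : ∃[ k ] + 10 * + n + + 5 * + b - + 3 * (+ b * + b) - + 18 ≡ k * + 24
    24∣ = lift (%-≡⇒∣ (10 · (n % 12) ℕ.+ 5 · t) (18 ℕ.+ 3 · (t · t)) (proj₁ (proj₂ (proj₂ choice))))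
      where
      r = n % 12
      lin : + (10 · r ℕ.+ 5 · t) - + (18 ℕ.+ 3 · (t · t)) ≡ + 10 * + r + + 5 * + t - (+ 18 + + 3 * (+ t * + t))
      lin = cong₂ (λ u v → u - v) (cong₂ _+_ (pos-* 10 r) (pos-* 5 t)) (cong (λ u → + 18 + u) (trans (pos-* 3 (t · t)) (cong (+ 3 *_) (pos-* t t))))
      nℤ : + n ≡ + r + + q * + 12
      nℤ = trans (cong +_ (m≡m%n+[m/n]*n n 12)) (cong (λ u → + r + u) (pos-* q 12))
      bℤ : + b ≡ + t + + q′ * + 120
      bℤ = trans (cong +_ b≡) (cong (λ u → + t + u) (pos-* q′ 120))
      l : ∀ r t q q′ k → + 10 * r + + 5 * t - (+ 18 + + 3 * (t * t)) ≡ k * + 24 →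
          + 10 * (r + q * + 12) + + 5 * (t + q′ * + 120) - + 3 * ((t + q′ * + 120) * (t + q′ * + 120)) - + 18
          ≡ (k + + 5 * q + + 25 * q′ - + 15 * q′ * (+ 2 * t + q′ * + 120)) * + 24
      l r t q q′ k e = by₁ 1ℤ e (j r t q q′ k)
        where
        j : ∀ r t q q′ k → + 10 * (r + q * + 12) + + 5 * (t + q′ * + 120) - + 3 * ((t + q′ * + 120) * (t + q′ * + 120)) - + 18
          - (k + + 5 * q + + 25 * q′ - + 15 * q′ * (+ 2 * t + q′ * + 120)) * + 24 ≡ 1ℤ * (+ 10 * r + + 5 * t - (+ 18 + + 3 * (t * t)) - k * + 24)
        j = solve-∀
      lift : + 24 ∣ + (10 · r ℕ.+ 5 · t) - + (18 ℕ.+ 3 · (t · t)) → ∃[ k ] + 10 * + n + + 5 * + b - + 3 * (+ b * + b) - + 18 ≡ k * + 24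
      lift (divides k e) = k + + 5 * + q + + 25 * + q′ - + 15 * + q′ * (+ 2 * + t + + q′ * + 120) ,
        trans (cong₂ (λ u v → + 10 * u + + 5 * v - + 3 * (v * v) - + 18) nℤ bℤ) (l (+ r) (+ t) (+ q) (+ q′) k (trans (sym lin) e))

    positive : 0ℤ ≤ + 10 * + n + + 5 * + b - + 3 * (+ b * + b)
    positive = subst (0ℤ ≤_) (cong₂ (λ u v → u - v) (cong₂ _+_ (pos-* 10 n) (pos-* 5 b)) (trans (pos-* 3 (b · b)) (cong (+ 3 *_) (pos-* b b)))) (i≤j⇒0≤j-i (+≤+ (ℕ.<⇒≤ upper)))

    lowerℤ : 0ℤ ≤ + 3 * (+ b * + b) + + 2 * + b + + 15 - + 8 * + n - 1ℤ
    lowerℤ = subst (0ℤ ≤_) (trans (cong₂ (λ u v → u - (1ℤ + v)) (cong₂ (λ u v → u + v + + 15) (trans (pos-* 3 (b · b)) (cong (+ 3 *_) (pos-* b b))) (pos-* 2 b)) (pos-* 8 n))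
        (l (+ 3 * (+ b * + b) + + 2 * + b + + 15) (+ 8 * + n))) (i≤j⇒0≤j-i (+≤+ lower))
      where l : ∀ x y → x - (1ℤ + y) ≡ x - y - 1ℤ
            l = solve-∀

    large : Representable n
    large = go (proj₁ 24∣) (proj₂ 24∣)
      where
      go : ∀ k → + 10 * + n + + 5 * + b - + 3 * (+ b * + b) - + 18 ≡ k * + 24 → Representable n
      -- A negative quotient would make `10n + 5b - 3b²` at most -6, against `positive`; hence
      -- `m = 3 + 4k` with `k` natural.
      go -[1+ k ] e = ⊥-elim (¬0≤neg (0≤+ positive (0≤* (0≤ℕ {24}) (0≤ℕ {k}))) (l (+ 10 * + n + + 5 * + b - + 3 * (+ b * + b)) (+ k) e))
        where
        j : ∀ x k → x + + 24 * k - - + 6 ≡ 1ℤ * (x - + 18 - - (1ℤ + k) * + 24)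
        j = solve-∀
        l : ∀ x k → x - + 18 ≡ - (1ℤ + k) * + 24 → x + + 24 * k ≡ - + 6
        l x k e = by₁ 1ℤ e (j x k)
      go (+ k) e = fin (represented (3 ℕ.+ k · 4) k refl χm)
        where
        m = 3 ℕ.+ k · 4
        mℤ : + m ≡ + 3 + + k * + 4
        mℤ = cong (λ u → + 3 + u) (pos-* k 4)
        h6 : + 10 * + n + + 5 * + b - + 3 * (+ b * + b) ≡ + 6 * + m
        h6 = trans (l (+ 10 * + n + + 5 * + b - + 3 * (+ b * + b)) (+ k) e) (cong (+ 6 *_) (sym mℤ))
          where
          j : ∀ x k → x - + 6 * (+ 3 + k * + 4) ≡ 1ℤ * (x - + 18 - k * + 24)
          j = solve-∀
          l : ∀ x k → x - + 18 ≡ k * + 24 → x ≡ + 6 * (+ 3 + k * + 4)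
          l x k e = by₁ 1ℤ e (j x k)
        χm : χ 5 (+ m) ≡ -1ℤ
        χm = trans (Symbol.χ-cong oddPrime5 (Mod.mod (divides (+ 2 * + n + + b - + b * + b - + m) (l (+ n) (+ b) (+ m) h6)))) (χ5-twice-square b 5∤b)
          where
          j : ∀ n b m → m - + 2 * (b * b) - (+ 2 * n + b - b * b - m) * + 5 ≡ -1ℤ * (+ 10 * n + + 5 * b - + 3 * (b * b) - + 6 * m)
          j = solve-∀
          l : ∀ n b m → + 10 * n + + 5 * b - + 3 * (b * b) ≡ + 6 * m → m - + 2 * (b * b) ≡ (+ 2 * n + b - b * b - m) * + 5
          l n b m h = by₁ -1ℤ h (j n b m)
        fin : (∃[ X ] ∃[ Y ] ∃[ Z ] G X Y Z ≡ + m) → Representable n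
        fin (X , Y , Z , eG) = FromG.from-G n b (+ m) _ h6 refl lowerℤ X Y Z eG

open import Defs
open import Data.Nat using (ℕ; _+_; _*_)
open import Data.Nat.Properties using (_<?_; ≮⇒≥)

theorem1p1 : (n : ℕ) → ∃[ x ] ∃[ y ] ∃[ z ] ∃[ w ] n ≡ p₅ x + p₅ y + p₅ z + 2 * p₅ w
theorem1p1 n with n <? 27610
... | yes lt = SmallNumbers.small n lt
... | no ge = LargeNumbers.Large.large n (≮⇒≥ ge)
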